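{- Let $K=\mathbb Q(\sqrt2)$ with $\mathcal O_K=\mathbb Z[\sqrt2]$, and in $\left(\frac{ -1,-1}{K}\right)$ let $$\mathcal G=\mathcal O_K\oplus\mathcal O_K2\sqrt2\mathbf i\oplus\mathcal O_K\Big(2\mathbf i+\tfrac{\mathbf i+\mathbf j}{\sqrt2}\Big)\oplus\mathcal O_K\tfrac{(1+\sqrt2)+(3+\sqrt2)\mathbf i+\mathbf j+\mathbf k}{2}.$$ Let $\alpha\in\mathcal O_K$ be totally positive with $\alpha\in(\sqrt2)^e\mathcal O_K\setminus(\sqrt2)^{e+1}\mathcal O_K$. Then $$r_{\mathcal G}(\alpha)=2\sum_{\substack{\delta\mathcal O_K\mid\alpha\mathcal O_K\\ \sqrt2\mathcal O_K\nmid\delta\mathcal O_K}}\operatorname{Nm}(\delta\mathcal O_K)\cdot\begin{cases}1,&e=0,\\2\cdot2,&e=1,\\3\cdot2^2,&e=2,\\4\cdot2^3,&e=3,\\2(2^3+\dots+2^e)+3\cdot2^e-2^3,&e\ge4.\end{cases}$$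
   Context: $\left(\frac{ -1,-1}{K}\right)$ has $K$-basis $1,\mathbf i,\mathbf j,\mathbf k$ with $\mathbf i^2=\mathbf j^2=-1$, $\mathbf k=\mathbf i\mathbf j=-\mathbf j\mathbf i$, reduced norm $\operatorname{nrd}(t+x\mathbf i+y\mathbf j+z\mathbf k)=t^2+x^2+y^2+z^2$. $r_{\mathcal G}(\alpha)=\#\{\mathbf q\in\mathcal G:\operatorname{nrd}\mathbf q=\alpha\}$; the sum runs over ideals of $\mathcal O_K$ dividing $\alpha\mathcal O_K$ not divisible by $\sqrt2\mathcal O_K$; $\operatorname{Nm}$ absolute norm. -}

module Defs where

open import Data.Nat as ℕ using (ℕ; zero; suc; _∸_; _^_)
open import Data.Integer as ℤ using (ℤ; +_; ∣_∣)
open import Data.Rational as ℚ using (ℚ; ½; 0ℚ; 1ℚ)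
open import Data.List using (List; []; _∷_; map; upTo; drop; length)
open import Data.Nat.ListAction using (sum)
open import Data.List.Membership.Propositional using (_∈_)
open import Data.List.Relation.Unary.All using (All)
open import Data.List.Relation.Unary.AllPairs using (AllPairs)
open import Data.List.Relation.Unary.Unique.Propositional using (Unique)
open import Data.Product using (Σ; ∃; ∃-syntax; _×_; _,_)
open import Relation.Nullary using (¬_)
open import Relation.Binary.PropositionalEquality using (_≡_)
open import Function.Bundles using (_⇔_)

-- The ring of integers O_K = ℤ[√2] : mkO a b = a + b√2 with a b ∈ ℤ

record OK : Set where
  constructor mkO
  field
    re : ℤ
    im : ℤ
open OK public

infixl 6 _+ᴼ_
infixl 7 _*ᴼ_

_+ᴼ_ : OK → OK → OK
mkO a b +ᴼ mkO c d = mkO (a ℤ.+ c) (b ℤ.+ d)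

_*ᴼ_ : OK → OK → OK
mkO a b *ᴼ mkO c d =
  mkO (a ℤ.* c ℤ.+ + 2 ℤ.* (b ℤ.* d)) (a ℤ.* d ℤ.+ b ℤ.* c)

oneᴼ : OK
oneᴼ = mkO (+ 1) (+ 0)

√2ᴼ : OK
√2ᴼ = mkO (+ 0) (+ 1)

_^ᴼ_ : OK → ℕ → OK
x ^ᴼ zero = oneᴼ
x ^ᴼ suc n = x *ᴼ (x ^ᴼ n)

_∣ᴼ_ : OK → OK → Set
d ∣ᴼ a = ∃[ c ] a ≡ d *ᴼ c

_~ᴼ_ : OK → OK → Set
d ~ᴼ d' = d ∣ᴼ d' × d' ∣ᴼ d

Nm : OK → ℕ
Nm (mkO a b) = ∣ a ℤ.* a ℤ.- + 2 ℤ.* (b ℤ.* b) ∣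

-- totally positive: both real embeddings a + b√2 and a − b√2 are > 0,
-- i.e. a > 0 and a² > 2 b²
TotallyPositive : OK → Set
TotallyPositive (mkO a b) = (+ 0 ℤ.< a) × (+ 2 ℤ.* (b ℤ.* b) ℤ.< a ℤ.* a)

-- The field K = ℚ(√2) : a + b√2 with a b ∈ ℚ

record K : Set where
  constructor mkK
  field
    kre : ℚ
    kim : ℚ

infixl 6 _+ᴷ_
infixl 7 _*ᴷ_

_+ᴷ_ : K → K → K
mkK a b +ᴷ mkK c d = mkK (a ℚ.+ c) (b ℚ.+ d)

_*ᴷ_ : K → K → K
mkK a b *ᴷ mkK c d =
  mkK (a ℚ.* c ℚ.+ (ℤ.+ 2 ℚ./ 1) ℚ.* (b ℚ.* d)) (a ℚ.* d ℚ.+ b ℚ.* c)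

ι : OK → K
ι (mkO a b) = mkK (a ℚ./ 1) (b ℚ./ 1)

ℚ→K : ℚ → K
ℚ→K q = mkK q 0ℚ

0ᴷ : K
0ᴷ = mkK 0ℚ 0ℚ

-- The quaternion algebra (−1,−1 / K): t + x i + y j + z k

record H : Set where
  constructor quat
  field
    t : K
    x : K
    y : K
    z : K

infixl 6 _+ᴴ_
infixl 7 _·ᴴ_

_+ᴴ_ : H → H → H
quat t x y z +ᴴ quat t' x' y' z' = quat (t +ᴷ t') (x +ᴷ x') (y +ᴷ y') (z +ᴷ z')

_·ᴴ_ : K → H → H
c ·ᴴ quat t x y z = quat (c *ᴷ t) (c *ᴷ x) (c *ᴷ y) (c *ᴷ z)

nrd : H → K
nrd (quat t x y z) = t *ᴷ t +ᴷ x *ᴷ x +ᴷ y *ᴷ y +ᴷ z *ᴷ z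

-- the O_K-basis of 𝒢
--   g₁ = 1
--   g₂ = 2√2 i
--   g₃ = 2 i + (i + j)/√2        = (2 + √2/2) i + (√2/2) j
--   g₄ = ((1+√2) + (3+√2) i + j + k)/2
g₁ g₂ g₃ g₄ : H
g₁ = quat (mkK 1ℚ 0ℚ) 0ᴷ 0ᴷ 0ᴷ
g₂ = quat 0ᴷ (mkK 0ℚ (ℤ.+ 2 ℚ./ 1)) 0ᴷ 0ᴷ
g₃ = quat 0ᴷ (mkK (ℤ.+ 2 ℚ./ 1) ½) (mkK 0ℚ ½) 0ᴷ
g₄ = quat (mkK ½ ½) (mkK (ℤ.+ 3 ℚ./ 2) ½) (mkK ½ 0ℚ) (mkK ½ 0ℚ)

_∈𝒢 : H → Set
q ∈𝒢 = ∃[ c₁ ] ∃[ c₂ ] ∃[ c₃ ] ∃[ c₄ ]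
  q ≡ ι c₁ ·ᴴ g₁ +ᴴ ι c₂ ·ᴴ g₂ +ᴴ ι c₃ ·ᴴ g₃ +ᴴ ι c₄ ·ᴴ g₄

r𝒢≡ : OK → ℕ → Set
r𝒢≡ α n = Σ (List H) λ qs →
  Unique qs × (∀ q → (q ∈ qs) ⇔ (q ∈𝒢 × nrd q ≡ ι α)) × length qs ≡ n

-- Summation index set: the ideals δO_K with δO_K ∣ αO_K and √2O_K ∤ δO_K.
-- (All ideals of O_K are principal.)  A list ds lists each such ideal
-- exactly once, through a generator.

DivisorIdealList : OK → List OK → Set
DivisorIdealList α ds =
  All (λ δ → δ ∣ᴼ α × ¬ (√2ᴼ ∣ᴼ δ)) ds
  × (∀ δ → δ ∣ᴼ α → ¬ (√2ᴼ ∣ᴼ δ) → ∃[ d ] (d ∈ ds × d ~ᴼ δ))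
  × AllPairs (λ d d' → ¬ (d ~ᴼ d')) ds

pow2Sum3 : ℕ → ℕ
pow2Sum3 e = sum (map (λ k → 2 ^ k) (drop 3 (upTo (suc e))))

factor : ℕ → ℕ
factor 0 = 1
factor 1 = 2 ℕ.* 2
factor 2 = 3 ℕ.* 2 ^ 2
factor 3 = 4 ℕ.* 2 ^ 3
factor e@(suc (suc (suc (suc _)))) = 2 ℕ.* pow2Sum3 e ℕ.+ 3 ℕ.* 2 ^ e ∸ 2 ^ 3

module Submission where

-- Up to conjugation, 𝒢 is the suborder of the maximal order 𝒪 of (−1,−1 / K) of all x whose image in 𝒪/2 ≅
-- M₂(O_K/2) is diagonal. For odd totally positive m the representations of m by 𝒪 are counted through 𝒪/m ≅
-- M₂(O_K/m): an x of norm m generates a right ideal, which corresponds to a sublattice of O_K² of index m.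
-- There are ∑ Nm δ such lattices over the divisors δ of m, by Hermite normal forms, and since 𝒪 is
-- norm-Euclidean every one of them comes from a principal ideal, which has exactly 48 generators of norm m.
-- At the prime above 2 the totally positive generator η = 2 + √2 satisfies the Hecke relation r(ηα) + 2
-- r(α/η) = 3 r(α), whence r(ηᵏm) = (2ᵏ⁺¹ − 1) r(m). Finally, twisting x ↦ u x v by units permutes the
-- elements of a given norm, and the number of twists (out of 72) for which u x v has diagonal image modulo
-- 2 depends only on x modulo 2: it is 3 if nrd x is odd, 4 if nrd x is even and η ∤ x, 12 or 16 if x = η y
-- with η ∤ y, according to the parity of nrd y, and 72 if η² ∣ x. Averaging therefore expresses the
-- representation numbers of 𝒢 through those of 𝒪.

-- The quotients `𝒪/m` are never formed. The isomorphism with matrices is a pair of polynomial maps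
-- `φ`, `ψ` whose laws hold over `O_K` up to explicit multiples of `ρ`, the value of a conic at a
-- chosen point. The conic is solved modulo the square of the norm of `m`, and the spare factor
-- shows that a gcd has norm `m` times a unit. This unit is totally positive, hence a square, so a
-- scalar brings the norm to exactly `m`. Euclidean division is tight: the rational part of the
-- reduced norm is a sum of two Hurwitz forms, each of which can in general be reduced only to 1/2,
-- and the bound 1 is attained when both remainders are deep holes. There another representative is
-- chosen, with nonzero irrational part, which lowers the field norm. Twisting on both sides is
-- forced by the singular elements: for a fixed right factor the number of left twists that make `x`
-- diagonal depends on the position of its kernel, and three right factors whose pairs of lines are
-- disjoint even this out.

module OKRing where
  open import Defs
  open import Data.Integer using (ℤ; +_; -_; _*_; _+_)
  import Data.Integer.Properties as ℤP
  open import Data.Integer.Tactic.RingSolver using () renaming (solve-∀ to ℤsolve)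
  open import Algebra.Bundles using (CommutativeRing)
  open import Algebra.Structures using (IsCommutativeRing)
  open import Level using (0ℓ)
  open import Tactic.RingSolver.Core.AlmostCommutativeRing using (AlmostCommutativeRing; fromCommutativeRing)
  open import Data.Maybe using (Maybe; just; nothing)
  open import Data.Product using (_,_)
  open import Relation.Binary.PropositionalEquality

  infix 8 -ᴼ_
  -ᴼ_ : OK → OK
  -ᴼ mkO a b = mkO (- a) (- b)
  0ᴼ : OK
  0ᴼ = mkO (+ 0) (+ 0)

  assoc-re : ∀ a b c d e f → (a * c + + 2 * (b * d)) * e + + 2 * ((a * d + b * c) * f)
     ≡ a * (c * e + + 2 * (d * f)) + + 2 * (b * (c * f + d * e))
  assoc-re = ℤsolve
  assoc-im : ∀ a b c d e f → (a * c + + 2 * (b * d)) * f + (a * d + b * c) * e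
     ≡ a * (c * f + d * e) + b * (c * e + + 2 * (d * f))
  assoc-im = ℤsolve
  comm-re : ∀ a b c d → a * c + + 2 * (b * d) ≡ c * a + + 2 * (d * b)
  comm-re = ℤsolve
  comm-im : ∀ a b c d → a * d + b * c ≡ c * b + d * a
  comm-im = ℤsolve
  dist-re : ∀ a b c d e f → a * (c + e) + + 2 * (b * (d + f))
    ≡ (a * c + + 2 * (b * d)) + (a * e + + 2 * (b * f))
  dist-re = ℤsolve
  dist-im : ∀ a b c d e f → a * (d + f) + b * (c + e) ≡ (a * d + b * c) + (a * f + b * e)
  dist-im = ℤsolve
  one-re : ∀ a b → + 1 * a + + 2 * (+ 0 * b) ≡ a
  one-re = ℤsolve
  one-im : ∀ a b → + 1 * b + + 0 * a ≡ b
  one-im = ℤsolve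

  *ᴼ-comm : ∀ x y → x *ᴼ y ≡ y *ᴼ x
  *ᴼ-comm (mkO a b) (mkO c d) = cong₂ mkO (comm-re a b c d) (comm-im a b c d)
  *ᴼ-idˡ : ∀ x → oneᴼ *ᴼ x ≡ x
  *ᴼ-idˡ (mkO a b) = cong₂ mkO (one-re a b) (one-im a b)
  *ᴼ-distˡ : ∀ x y z → x *ᴼ (y +ᴼ z) ≡ x *ᴼ y +ᴼ x *ᴼ z
  *ᴼ-distˡ (mkO a b) (mkO c d) (mkO e f) = cong₂ mkO (dist-re a b c d e f) (dist-im a b c d e f)
  *ᴼ-distʳ : ∀ x y z → (y +ᴼ z) *ᴼ x ≡ y *ᴼ x +ᴼ z *ᴼ x
  *ᴼ-distʳ x y z = trans (*ᴼ-comm (y +ᴼ z) x) (trans (*ᴼ-distˡ x y z) (cong₂ _+ᴼ_ (*ᴼ-comm x y) (*ᴼ-comm x z)))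

  isCR : IsCommutativeRing _≡_ _+ᴼ_ _*ᴼ_ -ᴼ_ 0ᴼ oneᴼ
  isCR = record
    { isRing = record
      { +-isAbelianGroup = record
        { isGroup = record
          { isMonoid = record
            { isSemigroup = record
              { isMagma = record { isEquivalence = isEquivalence ; ∙-cong = cong₂ _+ᴼ_ }
              ; assoc = λ { (mkO a b) (mkO c d) (mkO e f) → cong₂ mkO (ℤP.+-assoc a c e) (ℤP.+-assoc b d f) } }
            ; identity = (λ { (mkO a b) → cong₂ mkO (ℤP.+-identityˡ a) (ℤP.+-identityˡ b) })
                       , (λ { (mkO a b) → cong₂ mkO (ℤP.+-identityʳ a) (ℤP.+-identityʳ b) }) }
          ; inverse = (λ { (mkO a b) → cong₂ mkO (ℤP.+-inverseˡ a) (ℤP.+-inverseˡ b) })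
                    , (λ { (mkO a b) → cong₂ mkO (ℤP.+-inverseʳ a) (ℤP.+-inverseʳ b) })
          ; ⁻¹-cong = cong -ᴼ_ }
        ; comm = λ { (mkO a b) (mkO c d) → cong₂ mkO (ℤP.+-comm a c) (ℤP.+-comm b d) } }
      ; *-cong = cong₂ _*ᴼ_
      ; *-assoc = λ { (mkO a b) (mkO c d) (mkO e f) → cong₂ mkO (assoc-re a b c d e f) (assoc-im a b c d e f) }
      ; *-identity = *ᴼ-idˡ , (λ x → trans (*ᴼ-comm x oneᴼ) (*ᴼ-idˡ x))
      ; distrib = *ᴼ-distˡ , *ᴼ-distʳ }
    ; *-comm = *ᴼ-comm }

  OKR : CommutativeRing 0ℓ 0ℓ
  OKR = record { isCommutativeRing = isCR }

  0≟ : ∀ x → Maybe (0ᴼ ≡ x)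
  0≟ (mkO (+ 0) (+ 0)) = just refl
  0≟ _ = nothing

  ring : AlmostCommutativeRing 0ℓ 0ℓ
  ring = fromCommutativeRing OKR 0≟

  open CommutativeRing OKR public using () renaming
    ( +-assoc to +ᴼ-assoc; +-comm to +ᴼ-comm; +-identityˡ to +ᴼ-idˡ; +-identityʳ to +ᴼ-idʳ
    ; -‿inverseˡ to +ᴼ-invˡ; -‿inverseʳ to +ᴼ-invʳ; *-assoc to *ᴼ-assoc; *-identityʳ to *ᴼ-idʳ)

  infixl 6 _-ᴼ_
  _-ᴼ_ : OK → OK → OK
  a -ᴼ b = a +ᴼ -ᴼ b

-- Polynomial identities over ℤ[√2] by comparison of normal forms.

module Solver where
  open import Defs
  open OKRing using () renaming (ring to OK-ring)
  open import Level using (0ℓ)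
  open import Tactic.RingSolver.Core.AlmostCommutativeRing using (AlmostCommutativeRing)
  open import Tactic.RingSolver.Core.Expression public using (Expr; Κ; _⊕_; _⊗_; ⊝_)
  open import Data.Nat using (ℕ)
  open import Data.Integer using (ℤ; +_)
  import Data.Integer.Tactic.RingSolver as ℤSolver
  open import Data.Product using (_×_; _,_; proj₁; proj₂)
  open import Data.Vec using (Vec; []; _∷_) public
  import Data.Vec as Vec
  import Data.Vec.N-ary as N
  open import Data.Vec.N-ary using (N-ary)
  open import Relation.Binary.PropositionalEquality using (_≡_; refl; cong)

  record Quat (A : Set) : Set where
    constructor ⟪_,_,_,_⟫
    field
      q₁ q₂ q₃ q₄ : A
  open Quat public

  quat≡ : ∀ {A : Set} {a b c d a' b' c' d' : A} → a ≡ a' → b ≡ b' → c ≡ c' → d ≡ d' →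
    ⟪ a , b , c , d ⟫ ≡ ⟪ a' , b' , c' , d' ⟫
  quat≡ refl refl refl refl = refl

  mapQ : ∀ {A B : Set} → (A → B) → Quat A → Quat B
  mapQ f ⟪ a , b , c , d ⟫ = ⟪ f a , f b , f c , f d ⟫

  infix 4 _≐_
  _≐_ : ∀ {A : Set} → A → A → A × A
  _≐_ = _,_

  module Solve (ring : AlmostCommutativeRing 0ℓ 0ℓ) where
    open AlmostCommutativeRing ring using (Carrier; _≈_; sym; trans; reflexive)
    open import Tactic.RingSolver.NonReflective ring using (module Ops)
    open Ops using (norm; ⟦_⟧; correct)

    -- Comparing the normal forms, which are closed terms, is much faster than letting the
    -- library compare their values at a vector of variables.
    proveE : ∀ {n} (l r : Expr Carrier n) → norm l ≡ norm r → ∀ ρ → ⟦ l ⟧ ρ ≈ ⟦ r ⟧ ρ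
    proveE l r eq ρ = trans (sym (correct l ρ)) (trans (reflexive (cong (λ p → ⟦ p ⟧ₚ ρ) eq)) (correct r ρ))
      where
      open import Tactic.RingSolver.Core.Polynomial.Semantics Ops.homo renaming (⟦_⟧ to ⟦_⟧ₚ)

    close : ∀ {B : Set} n → N-ary n (Expr Carrier n) B → B
    close n f = f N.$ⁿ Vec.map Expr.Ι (Vec.allFin n)

    prove : ∀ n (f : N-ary n (Expr Carrier n) (Expr Carrier n × Expr Carrier n)) →
      norm (proj₁ (close n f)) ≡ norm (proj₂ (close n f)) →
      ∀ ρ → ⟦ proj₁ (close n f) ⟧ ρ ≈ ⟦ proj₂ (close n f) ⟧ ρ
    prove n f = proveE (proj₁ (close n f)) (proj₂ (close n f))

  open Solve OK-ring public using (prove)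
  open Solve ℤSolver.ring public using () renaming (prove to proveℤ)

  open Solve OK-ring using (close; proveE)
  open import Tactic.RingSolver.NonReflective OK-ring using (module Ops)
  open Ops using (norm; ⟦_⟧)

  proveQ : ∀ n (f : N-ary n (Expr OK n) (Quat (Expr OK n) × Quat (Expr OK n))) →
    mapQ norm (proj₁ (close n f)) ≡ mapQ norm (proj₂ (close n f)) →
    ∀ ρ → mapQ (λ e → ⟦ e ⟧ ρ) (proj₁ (close n f)) ≡ mapQ (λ e → ⟦ e ⟧ ρ) (proj₂ (close n f))
  proveQ n f eq ρ = quat≡ (proveE (q₁ l) (q₁ r) (cong q₁ eq) ρ) (proveE (q₂ l) (q₂ r) (cong q₂ eq) ρ)
                           (proveE (q₃ l) (q₃ r) (cong q₃ eq) ρ) (proveE (q₄ l) (q₄ r) (cong q₄ eq) ρ)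
    where
    l = proj₁ (close n f)
    r = proj₂ (close n f)

  -- O_K-valued expressions given by their two ℤ-valued coordinates.
  module Pairs {n : ℕ} where
    Pair : Set
    Pair = Expr ℤ n × Expr ℤ n
    infixl 6 _⊕²_
    infixl 7 _⊗²_
    _⊕²_ _⊗²_ : Pair → Pair → Pair
    (a , b) ⊕² (c , d) = (a ⊕ c) , (b ⊕ d)
    (a , b) ⊗² (c , d) = (a ⊗ c) ⊕ (Κ (+ 2) ⊗ (b ⊗ d)) , (a ⊗ d) ⊕ (b ⊗ c)
    ⊝²_ : Pair → Pair
    ⊝² (a , b) = (⊝ a) , (⊝ b)
    √2² : Pair
    √2² = Κ (+ 0) , Κ (+ 1)

-- The maximal order: multiplication, conjugation, reduced norm.

module Quaternion where
  open import Defs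
  open OKRing hiding (ring)
  open Solver
  open import Data.Nat using (ℕ)
  open import Data.Product using (_,_)
  open import Relation.Binary.PropositionalEquality
  open import Algebra.Bundles using (Ring)
  open import Algebra.Structures using (IsRing)
  open import Level using (0ℓ)

  -- The maximal order has the O_K-basis 1, e, f, g = ef with e = (1+i)/√2, f = (1+j)/√2;
  -- the products are e² = √2e−1, f² = √2f−1, fe = √2(e+f)−1−g, eg = √2g−f, gf = √2g−e,
  -- fg = ge = e+f−√2, g² = g−1.
  module Formulas {A : Set} (_+_ _*_ : A → A → A) (-_ : A → A) (w : A) where
    private
      infixl 6 _⊹_
      infixl 7 _✶_
      _⊹_ = _+_
      _✶_ = _*_
    mul : Quat A → Quat A → Quat A
    mul ⟪ t , x , y , z ⟫ ⟪ a , b , c , d ⟫ =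
      ⟪ t ✶ a ⊹ (- (x ✶ b)) ⊹ (- (y ✶ b)) ⊹ (- (y ✶ c)) ⊹ (- (z ✶ d)) ⊹ (- (w ✶ (y ✶ d ⊹ z ✶ b)))
      , t ✶ b ⊹ x ✶ a ⊹ y ✶ d ⊹ z ✶ b ⊹ (- (z ✶ c)) ⊹ w ✶ (x ✶ b ⊹ y ✶ b)
      , t ✶ c ⊹ y ✶ a ⊹ y ✶ d ⊹ z ✶ b ⊹ (- (x ✶ d)) ⊹ w ✶ (y ✶ b ⊹ y ✶ c)
      , t ✶ d ⊹ z ✶ a ⊹ x ✶ c ⊹ z ✶ d ⊹ (- (y ✶ b)) ⊹ w ✶ (x ✶ d ⊹ z ✶ c) ⟫
    -- The reduced norm. A cross coefficient is the trace of one basis element times the conjugate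
    -- of another: 1 for the pairs `1, g` and `e, f`, and `√2` for the other four.
    form : Quat A → A
    form ⟪ t , x , y , z ⟫ =
      t ✶ t ⊹ x ✶ x ⊹ y ✶ y ⊹ z ✶ z ⊹ t ✶ z ⊹ x ✶ y ⊹ w ✶ (t ✶ x ⊹ t ✶ y ⊹ x ✶ z ⊹ y ✶ z)
    -- Trace minus the element; the basis `1, e, f, g` has traces 2, √2, √2, 1.
    bar : Quat A → Quat A
    bar ⟪ t , x , y , z ⟫ = ⟪ t ⊹ w ✶ (x ⊹ y) ⊹ z , - x , - y , - z ⟫
    add : Quat A → Quat A → Quat A
    add ⟪ t , x , y , z ⟫ ⟪ a , b , c , d ⟫ = ⟪ t ⊹ a , x ⊹ b , y ⊹ c , z ⊹ d ⟫
    neg : Quat A → Quat A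
    neg ⟪ t , x , y , z ⟫ = ⟪ - t , - x , - y , - z ⟫
    scale : A → Quat A → Quat A
    scale k ⟪ a , b , c , d ⟫ = ⟪ k ✶ a , k ✶ b , k ✶ c , k ✶ d ⟫

  module E {n : ℕ} where
    open Formulas {Expr OK n} _⊕_ _⊗_ ⊝_ (Κ √2ᴼ) public
    oneE : Quat (Expr OK n)
    oneE = ⟪ Κ oneᴼ , Κ 0ᴼ , Κ 0ᴼ , Κ 0ᴼ ⟫

  𝒪 : Set
  𝒪 = Quat OK

  infixl 6 _+ᵠ_ _-ᵠ_
  infixl 7 _·_
  infixr 8 _•_

  0ᵠ 1ᵠ : 𝒪
  0ᵠ = ⟪ 0ᴼ , 0ᴼ , 0ᴼ , 0ᴼ ⟫
  1ᵠ = ⟪ oneᴼ , 0ᴼ , 0ᴼ , 0ᴼ ⟫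

  module F = Formulas _+ᴼ_ _*ᴼ_ -ᴼ_ √2ᴼ

  _+ᵠ_ _-ᵠ_ : 𝒪 → 𝒪 → 𝒪
  x +ᵠ y = F.add x y
  negᵠ : 𝒪 → 𝒪
  negᵠ = F.neg
  x -ᵠ y = x +ᵠ negᵠ y
  _•_ : OK → 𝒪 → 𝒪
  _•_ = F.scale

  opaque
    _·_ : 𝒪 → 𝒪 → 𝒪
    _·_ = F.mul
    N : 𝒪 → OK
    N = F.form
    conj : 𝒪 → 𝒪
    conj = F.bar

    ·-assoc : ∀ x y z → (x · y) · z ≡ x · (y · z)
    ·-assoc ⟪ t , x , y , z ⟫ ⟪ a , b , c , d ⟫ ⟪ t' , x' , y' , z' ⟫ =
      proveQ 12 (λ t x y z a b c d t' x' y' z' →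
        E.mul (E.mul ⟪ t , x , y , z ⟫ ⟪ a , b , c , d ⟫) ⟪ t' , x' , y' , z' ⟫
        ≐ E.mul ⟪ t , x , y , z ⟫ (E.mul ⟪ a , b , c , d ⟫ ⟪ t' , x' , y' , z' ⟫)) refl
        (t ∷ x ∷ y ∷ z ∷ a ∷ b ∷ c ∷ d ∷ t' ∷ x' ∷ y' ∷ z' ∷ [])

    N-· : ∀ x y → N (x · y) ≡ N x *ᴼ N y
    N-· ⟪ t , x , y , z ⟫ ⟪ a , b , c , d ⟫ =
      prove 8 (λ t x y z a b c d → E.form (E.mul ⟪ t , x , y , z ⟫ ⟪ a , b , c , d ⟫)
        ≐ E.form ⟪ t , x , y , z ⟫ ⊗ E.form ⟪ a , b , c , d ⟫) refl
        (t ∷ x ∷ y ∷ z ∷ a ∷ b ∷ c ∷ d ∷ [])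

    ·-distribˡ : ∀ x y z → x · (y +ᵠ z) ≡ x · y +ᵠ x · z
    ·-distribˡ ⟪ t , x , y , z ⟫ ⟪ a , b , c , d ⟫ ⟪ t' , x' , y' , z' ⟫ =
      proveQ 12 (λ t x y z a b c d t' x' y' z' →
        E.mul ⟪ t , x , y , z ⟫ (E.add ⟪ a , b , c , d ⟫ ⟪ t' , x' , y' , z' ⟫)
        ≐ E.add (E.mul ⟪ t , x , y , z ⟫ ⟪ a , b , c , d ⟫)
          (E.mul ⟪ t , x , y , z ⟫ ⟪ t' , x' , y' , z' ⟫)) refl
        (t ∷ x ∷ y ∷ z ∷ a ∷ b ∷ c ∷ d ∷ t' ∷ x' ∷ y' ∷ z' ∷ [])

    ·-distribʳ : ∀ x y z → (y +ᵠ z) · x ≡ y · x +ᵠ z · x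
    ·-distribʳ ⟪ t , x , y , z ⟫ ⟪ a , b , c , d ⟫ ⟪ t' , x' , y' , z' ⟫ =
      proveQ 12 (λ t x y z a b c d t' x' y' z' →
        E.mul (E.add ⟪ a , b , c , d ⟫ ⟪ t' , x' , y' , z' ⟫) ⟪ t , x , y , z ⟫
        ≐ E.add (E.mul ⟪ a , b , c , d ⟫ ⟪ t , x , y , z ⟫)
          (E.mul ⟪ t' , x' , y' , z' ⟫ ⟪ t , x , y , z ⟫)) refl
        (t ∷ x ∷ y ∷ z ∷ a ∷ b ∷ c ∷ d ∷ t' ∷ x' ∷ y' ∷ z' ∷ [])

    ·-identityˡ : ∀ x → 1ᵠ · x ≡ x
    ·-identityˡ ⟪ t , x , y , z ⟫ =
      proveQ 4 (λ t x y z → E.mul E.oneE ⟪ t , x , y , z ⟫ ≐ ⟪ t , x , y , z ⟫) refl (t ∷ x ∷ y ∷ z ∷ [])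

    ·-identityʳ : ∀ x → x · 1ᵠ ≡ x
    ·-identityʳ ⟪ t , x , y , z ⟫ =
      proveQ 4 (λ t x y z → E.mul ⟪ t , x , y , z ⟫ E.oneE ≐ ⟪ t , x , y , z ⟫) refl (t ∷ x ∷ y ∷ z ∷ [])

    conj-· : ∀ x → conj x · x ≡ N x • 1ᵠ
    conj-· ⟪ t , x , y , z ⟫ =
      proveQ 4 (λ t x y z → E.mul (E.bar ⟪ t , x , y , z ⟫) ⟪ t , x , y , z ⟫
        ≐ E.scale (E.form ⟪ t , x , y , z ⟫) E.oneE) refl (t ∷ x ∷ y ∷ z ∷ [])

    ·-conj : ∀ x → x · conj x ≡ N x • 1ᵠ
    ·-conj ⟪ t , x , y , z ⟫ =
      proveQ 4 (λ t x y z → E.mul ⟪ t , x , y , z ⟫ (E.bar ⟪ t , x , y , z ⟫)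
        ≐ E.scale (E.form ⟪ t , x , y , z ⟫) E.oneE) refl (t ∷ x ∷ y ∷ z ∷ [])

    N-conj : ∀ x → N (conj x) ≡ N x
    N-conj ⟪ t , x , y , z ⟫ =
      prove 4 (λ t x y z → E.form (E.bar ⟪ t , x , y , z ⟫) ≐ E.form ⟪ t , x , y , z ⟫) refl
        (t ∷ x ∷ y ∷ z ∷ [])

    N-• : ∀ k x → N (k • x) ≡ k *ᴼ k *ᴼ N x
    N-• k ⟪ t , x , y , z ⟫ =
      prove 5 (λ k t x y z → E.form (E.scale k ⟪ t , x , y , z ⟫) ≐ k ⊗ k ⊗ E.form ⟪ t , x , y , z ⟫) refl
        (k ∷ t ∷ x ∷ y ∷ z ∷ [])

    •-·-assoc : ∀ k x y → (k • x) · y ≡ k • (x · y)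
    •-·-assoc k ⟪ t , x , y , z ⟫ ⟪ a , b , c , d ⟫ =
      proveQ 9 (λ k t x y z a b c d → E.mul (E.scale k ⟪ t , x , y , z ⟫) ⟪ a , b , c , d ⟫
        ≐ E.scale k (E.mul ⟪ t , x , y , z ⟫ ⟪ a , b , c , d ⟫)) refl (k ∷ t ∷ x ∷ y ∷ z ∷ a ∷ b ∷ c ∷ d ∷ [])

    ·-•-comm : ∀ k x y → x · (k • y) ≡ k • (x · y)
    ·-•-comm k ⟪ t , x , y , z ⟫ ⟪ a , b , c , d ⟫ =
      proveQ 9 (λ k t x y z a b c d → E.mul ⟪ t , x , y , z ⟫ (E.scale k ⟪ a , b , c , d ⟫)
        ≐ E.scale k (E.mul ⟪ t , x , y , z ⟫ ⟪ a , b , c , d ⟫)) refl (k ∷ t ∷ x ∷ y ∷ z ∷ a ∷ b ∷ c ∷ d ∷ [])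

    N-1ᵠ : N 1ᵠ ≡ oneᴼ
    N-1ᵠ = refl

  •-assoc : ∀ k l x → k • (l • x) ≡ (k *ᴼ l) • x
  •-assoc k l ⟪ a , b , c , d ⟫ = sym (quat≡ (as a) (as b) (as c) (as d))
    where as = *ᴼ-assoc k l
  •-identityˡ : ∀ x → oneᴼ • x ≡ x
  •-identityˡ ⟪ a , b , c , d ⟫ = quat≡ (*ᴼ-idˡ a) (*ᴼ-idˡ b) (*ᴼ-idˡ c) (*ᴼ-idˡ d)
  •-distribˡ : ∀ k x y → k • (x +ᵠ y) ≡ k • x +ᵠ k • y
  •-distribˡ k ⟪ a , b , c , d ⟫ ⟪ a' , b' , c' , d' ⟫ =
    quat≡ (*ᴼ-distˡ k a a') (*ᴼ-distˡ k b b') (*ᴼ-distˡ k c c') (*ᴼ-distˡ k d d')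

  isRing : IsRing _≡_ _+ᵠ_ _·_ negᵠ 0ᵠ 1ᵠ
  isRing = record
      { +-isAbelianGroup = record
        { isGroup = record
          { isMonoid = record
            { isSemigroup = record
              { isMagma = record { isEquivalence = isEquivalence ; ∙-cong = cong₂ _+ᵠ_ }
              ; assoc = λ x y z → quat≡ (+ᴼ-assoc (q₁ x) (q₁ y) (q₁ z)) (+ᴼ-assoc (q₂ x) (q₂ y) (q₂ z))
                (+ᴼ-assoc (q₃ x) (q₃ y) (q₃ z)) (+ᴼ-assoc (q₄ x) (q₄ y) (q₄ z)) }
            ; identity = (λ x → quat≡ (+ᴼ-idˡ (q₁ x)) (+ᴼ-idˡ (q₂ x)) (+ᴼ-idˡ (q₃ x)) (+ᴼ-idˡ (q₄ x)))
                       , (λ x → quat≡ (+ᴼ-idʳ (q₁ x)) (+ᴼ-idʳ (q₂ x)) (+ᴼ-idʳ (q₃ x)) (+ᴼ-idʳ (q₄ x))) }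
          ; inverse = (λ x → quat≡ (+ᴼ-invˡ (q₁ x)) (+ᴼ-invˡ (q₂ x)) (+ᴼ-invˡ (q₃ x)) (+ᴼ-invˡ (q₄ x)))
                    , (λ x → quat≡ (+ᴼ-invʳ (q₁ x)) (+ᴼ-invʳ (q₂ x)) (+ᴼ-invʳ (q₃ x)) (+ᴼ-invʳ (q₄ x)))
          ; ⁻¹-cong = cong negᵠ }
        ; comm = λ x y → quat≡ (+ᴼ-comm (q₁ x) (q₁ y)) (+ᴼ-comm (q₂ x) (q₂ y)) (+ᴼ-comm (q₃ x) (q₃ y))
          (+ᴼ-comm (q₄ x) (q₄ y)) }
      ; *-cong = cong₂ _·_
      ; *-assoc = ·-assoc
      ; *-identity = ·-identityˡ , ·-identityʳ
      ; distrib = ·-distribˡ , ·-distribʳ }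

  𝒪R : Ring 0ℓ 0ℓ
  𝒪R = record { isRing = isRing }

-- Finite counts of predicates and double counting.

module Counting where
  open import Data.Nat using (ℕ; suc; _+_; _*_; _≤_; z≤n; s≤s)
  import Data.Nat.Properties as ℕP
  open import Data.Nat.ListAction using (sum)
  open import Data.List using (List; []; _∷_; map; length; filter; _++_)
  open import Data.List.Properties using (length-map; length-++)
  open import Data.List.Membership.Propositional using (_∈_)
  open import Data.List.Membership.Propositional.Properties
    using (∈-map⁺; ∈-map⁻; ∈-++⁺ˡ; ∈-++⁺ʳ; ∈-++⁻; ∈-filter⁺; ∈-filter⁻; ∈-∃++; ∈-deduplicate⁺; ∈-deduplicate⁻)
  open import Data.List.Relation.Unary.Any using (here; there)
  open import Data.List.Relation.Unary.All as All using (All; []; _∷_)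
  open import Data.List.Relation.Unary.AllPairs using ([]; _∷_)
  open import Data.List.Relation.Unary.Unique.Propositional using (Unique)
  open import Data.List.Relation.Unary.Unique.Propositional.Properties using (map⁺; ++⁺; filter⁺)
  open import Data.List.Relation.Unary.Unique.DecPropositional.Properties using (deduplicate-!)
  open import Data.List using (deduplicate)
  open import Data.Product using (Σ; ∃-syntax; _×_; _,_; proj₁; proj₂)
  open import Data.Sum using (_⊎_; inj₁; inj₂)
  open import Data.Empty using (⊥; ⊥-elim)
  open import Function.Bundles using (_⇔_; mk⇔; Equivalence)
  open import Relation.Nullary using (Dec; yes; no; ¬_)
  open import Relation.Unary using (Decidable)
  open import Relation.Binary using (DecidableEquality)
  open import Relation.Binary.PropositionalEquality hiding ([_])
  open Equivalence

  private variable
    A B I : Set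
    P Q : A → Set
    m n : ℕ

  -- This has the shape of `r𝒢≡`, so a count of the elements of 𝒢 of norm `α` is literally the
  -- required conclusion.
  Count : (A → Set) → ℕ → Set
  Count {A} P n = Σ (List A) λ xs → Unique xs × (∀ x → (x ∈ xs) ⇔ P x) × length xs ≡ n

  elements : Count P n → List _
  elements = proj₁

  count-resp : (∀ x → P x ⇔ Q x) → Count P n → Count Q n
  count-resp eq (xs , u , h , l) =
    xs , u , (λ x → mk⇔ (λ p → to (eq x) (to (h x) p)) (λ q → from (h x) (from (eq x) q))) , l

  count-map : (f : A → B) → (∀ {x y} → f x ≡ f y → x ≡ y) →
    (∀ x → P x → Q (f x)) → (∀ y → Q y → ∃[ x ] (P x × y ≡ f x)) → Count P n → Count Q n
  count-map {P = P} {Q = Q} f inj pq qp (xs , u , h , l) =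
    map f xs , map⁺ inj u , (λ y → mk⇔ (there′ y) (back y)) , trans (length-map f xs) l
    where
    there′ : ∀ y → y ∈ map f xs → Q y
    there′ y y∈ with ∈-map⁻ f y∈
    ... | x , x∈ , refl = pq x (to (h x) x∈)
    back : ∀ y → Q y → y ∈ map f xs
    back y q with qp y q
    ... | x , p , refl = ∈-map⁺ f (from (h x) p)

  count-⊥ : (∀ x → ¬ P x) → Count P 0
  count-⊥ np = [] , [] , (λ x → mk⇔ (λ ()) (λ p → ⊥-elim (np x p))) , refl

  count-⊎ : (∀ x → P x → Q x → ⊥) → Count P m → Count Q n → Count (λ x → P x ⊎ Q x) (m + n)
  count-⊎ {P = P} {Q = Q} dis (xs , u , h , l) (ys , v , k , r) =
    xs ++ ys , ++⁺ u v (λ {x} (a , b) → dis x (to (h x) a) (to (k x) b)) ,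
    (λ x → mk⇔ (there′ x) (back x)) , trans (length-++ xs) (cong₂ _+_ l r)
    where
    there′ : ∀ x → x ∈ xs ++ ys → P x ⊎ Q x
    there′ x x∈ with ∈-++⁻ xs x∈
    ... | inj₁ a = inj₁ (to (h x) a)
    ... | inj₂ b = inj₂ (to (k x) b)
    back : ∀ x → P x ⊎ Q x → x ∈ xs ++ ys
    back x (inj₁ p) = ∈-++⁺ˡ (from (h x) p)
    back x (inj₂ q) = ∈-++⁺ʳ xs (from (k x) q)

  count-⋃ : (is : List I) (R : I → A → Set) (k : I → ℕ) → Unique is →
    (∀ i → i ∈ is → Count (R i) (k i)) →
    (∀ i j x → i ∈ is → j ∈ is → R i x → R j x → i ≡ j) →
    Count (λ x → ∃[ i ] (i ∈ is × R i x)) (sum (map k is))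
  count-⋃ [] R k u c d = count-⊥ (λ { x (i , () , _) })
  count-⋃ (i ∷ is) R k (i∉ ∷ u) c d = count-resp split
    (count-⊎ disjoint (c i (here refl)) (count-⋃ is R k u (λ j j∈ → c j (there j∈))
      (λ j l x j∈ l∈ → d j l x (there j∈) (there l∈))))
    where
    disjoint : ∀ x → R i x → ∃[ j ] (j ∈ is × R j x) → ⊥
    disjoint x r (j , j∈ , s) = All.lookup i∉ j∈ (d i j x (here refl) (there j∈) r s)
    split : ∀ x → (R i x ⊎ ∃[ j ] (j ∈ is × R j x)) ⇔ (∃[ j ] (j ∈ i ∷ is × R j x))
    split x = mk⇔ (λ { (inj₁ r) → i , here refl , r ; (inj₂ (j , j∈ , r)) → j , there j∈ , r })
                  (λ { (_ , here refl , r) → inj₁ r ; (j , there j∈ , r) → inj₂ (j , j∈ , r) })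

  ⊆-length : ∀ {xs ys : List A} → Unique xs → (∀ {x} → x ∈ xs → x ∈ ys) → length xs ≤ length ys
  ⊆-length {xs = []} u sub = z≤n
  ⊆-length {xs = x ∷ xs} {ys} (x∉ ∷ u) sub with ∈-∃++ (sub (here refl))
  ... | as , bs , refl = ℕP.≤-trans (s≤s (⊆-length u sub′)) (ℕP.≤-reflexive len)
    where
    sub′ : ∀ {y} → y ∈ xs → y ∈ as ++ bs
    sub′ y∈ with ∈-++⁻ as (sub (there y∈))
    ... | inj₁ a = ∈-++⁺ˡ a
    ... | inj₂ (here refl) = ⊥-elim (All.lookup x∉ y∈ refl)
    ... | inj₂ (there b) = ∈-++⁺ʳ as b
    len : suc (length (as ++ bs)) ≡ length (as ++ x ∷ bs)
    len = trans (cong suc (length-++ as)) (trans (sym (ℕP.+-suc (length as) (length bs))) (sym (length-++ as)))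

  count-unique : Count P m → Count P n → m ≡ n
  count-unique (xs , u , h , refl) (ys , v , k , refl) =
    ℕP.≤-antisym (⊆-length u (λ {x} p → from (k x) (to (h x) p))) (⊆-length v (λ {x} p →
      from (h x) (to (k x) p)))

  -- Only finiteness comes out of a list with repetitions; the number itself is determined
  -- afterwards, by the Hecke relation.
  enumerate : DecidableEquality A → (xs : List A) → (∀ x → (x ∈ xs) ⇔ P x) → ∃[ n ] Count P n
  enumerate _≟_ xs h = _ , deduplicate _≟_ xs , deduplicate-! _≟_ xs ,
    (λ x → mk⇔ (λ p → to (h x) (∈-deduplicate⁻ _≟_ xs p)) (λ p → ∈-deduplicate⁺ _≟_ (from (h x) p))) , refl

  count-filter : (Q? : Decidable Q) → Count P n → ∃[ k ] Count (λ x → P x × Q x) k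
  count-filter Q? (xs , u , h , l) = _ , filter Q? xs , filter⁺ Q? u ,
    (λ x → mk⇔ (λ p → let a , b = ∈-filter⁻ Q? {xs = xs} p in to (h x) a , b)
               (λ (p , q) → ∈-filter⁺ Q? (from (h x) p) q)) , refl

  ∑ : List A → (A → ℕ) → ℕ
  ∑ xs f = sum (map f xs)

  indicator : ∀ {X : Set} → Dec X → ℕ
  indicator (yes _) = 1
  indicator (no _) = 0

  ∑-cong : ∀ (xs : List A) {f g : A → ℕ} → (∀ x → x ∈ xs → f x ≡ g x) → ∑ xs f ≡ ∑ xs g
  ∑-cong [] eq = refl
  ∑-cong (x ∷ xs) eq = cong₂ _+_ (eq x (here refl)) (∑-cong xs (λ y y∈ → eq y (there y∈)))

  ∑-const : ∀ (xs : List A) c → ∑ xs (λ _ → c) ≡ length xs * c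
  ∑-const [] c = refl
  ∑-const (x ∷ xs) c = cong (c +_) (∑-const xs c)

  private
    shuffle : ∀ a b c d → (a + b) + (c + d) ≡ (a + c) + (b + d)
    shuffle a b c d = trans (ℕP.+-assoc a b _) (trans (cong (a +_)
      (trans (sym (ℕP.+-assoc b c d)) (trans (cong (_+ d) (ℕP.+-comm b c)) (ℕP.+-assoc c b d))))
        (sym (ℕP.+-assoc a c _)))

  ∑-+ : ∀ (xs : List A) (f g : A → ℕ) → ∑ xs (λ x → f x + g x) ≡ ∑ xs f + ∑ xs g
  ∑-+ [] f g = refl
  ∑-+ (x ∷ xs) f g = trans (cong ((f x + g x) +_) (∑-+ xs f g)) (shuffle (f x) (g x) _ _)

  ∑-* : ∀ (xs : List A) k (f : A → ℕ) → ∑ xs (λ x → k * f x) ≡ k * ∑ xs f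
  ∑-* [] k f = sym (ℕP.*-zeroʳ k)
  ∑-* (x ∷ xs) k f = trans (cong (k * f x +_) (∑-* xs k f)) (sym (ℕP.*-distribˡ-+ k (f x) _))

  ∑-swap : ∀ (xs : List A) (ys : List B) (f : A → B → ℕ) →
    ∑ xs (λ x → ∑ ys (f x)) ≡ ∑ ys (λ y → ∑ xs (λ x → f x y))
  ∑-swap [] ys f = sym (trans (∑-const ys 0) (ℕP.*-zeroʳ (length ys)))
  ∑-swap (x ∷ xs) ys f = trans (cong (∑ ys (f x) +_) (∑-swap xs ys f)) (sym (∑-+ ys (f x) _))

  ∑-indicator : ∀ (Q? : Decidable Q) xs → ∑ xs (λ x → indicator (Q? x)) ≡ length (filter Q? xs)
  ∑-indicator Q? [] = refl
  ∑-indicator Q? (x ∷ xs) with Q? x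
  ... | yes _ = cong suc (∑-indicator Q? xs)
  ... | no _ = ∑-indicator Q? xs

  count-∑ : (Q? : Decidable Q) (c : Count P n) → Count (λ x → P x × Q x) m →
    ∑ (elements c) (λ x → indicator (Q? x)) ≡ m
  count-∑ {n = n} Q? c d = trans (∑-indicator Q? (elements c))
    (count-unique (proj₂ (count-filter {n = n} Q? c)) d)

  -- Double counting of the pairs (x , s) with Q s x.
  double-count : ∀ {S : Set} (ss : List S) {R : S → A → Set} (R? : ∀ s → Decidable (R s)) (W : A →
    ℕ) (c : Count P n) →
    (∀ s → s ∈ ss → Count (λ x → P x × R s x) m) →
    (∀ x → P x → ∑ ss (λ s → indicator (R? s x)) ≡ W x) →
    ∑ (elements c) W ≡ length ss * m
  double-count {n = n} {m = m} ss R? W c@(xs , u , h , l) cs w =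
    trans (∑-cong xs (λ x x∈ → sym (w x (to (h x) x∈))))
    (trans (∑-swap xs ss (λ x s → indicator (R? s x)))
    (trans (∑-cong ss (λ s s∈ → count-∑ {n = n} (R? s) c (cs s s∈))) (∑-const ss m)))

-- The Euclidean algorithm in a ring that need not be commutative.

module EuclideanAlgorithm where
  open import Algebra.Bundles using (Ring)
  open import Level using (0ℓ)
  open import Data.Nat using (ℕ; _<_)
  open import Data.Product using (∃-syntax; _,_)
  open import Relation.Nullary using (Dec; yes; no; ¬_)

  module Euclid (R : Ring 0ℓ 0ℓ) (0? : ∀ x → Dec (Ring._≈_ R x (Ring.0# R))) (size : Ring.Carrier R → ℕ)
    (divide : ∀ a b → ¬ (Ring._≈_ R b (Ring.0# R)) → ∃[ q ] size (Ring._-_ R a (Ring._*_ R b q)) < size b) where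
    open Ring R
    open import Data.Nat.Induction using (<-wellFounded)
    open import Induction.WellFounded using (Acc; acc)
    open import Relation.Binary.Reasoning.Setoid setoid
    open import Algebra.Properties.Ring R using (-‿distribʳ-*)

    -- All multipliers and cofactors stand on the right: `g` generates the right ideal `aR + bR` and
    -- divides `a` and `b` on the left. The same record serves ℤ, `O_K` and the maximal order.
    record RightGCD (a b : Carrier) : Set where
      field
        g s t a′ b′ : Carrier
        bezout : g ≈ a * s + b * t
        dividesˡ : a ≈ g * a′
        dividesʳ : b ≈ g * b′

    private
      step : ∀ {a b q} → RightGCD b (a + - (b * q)) → RightGCD a b
      step {a} {b} {q} d = record
        { g = g ; s = t ; t = s + - (q * t) ; a′ = b′ + a′ * q ; b′ = a′
        ; bezout = begin
            g                                     ≈⟨ bezout ⟩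
            b * s + (a + - (b * q)) * t           ≈⟨ +-congˡ (distribʳ t a _) ⟩
            b * s + (a * t + - (b * q) * t)       ≈⟨ +-assoc _ _ _ ⟨
            (b * s + a * t) + - (b * q) * t       ≈⟨ +-congʳ (+-comm _ _) ⟩
            (a * t + b * s) + - (b * q) * t       ≈⟨ +-assoc _ _ _ ⟩
            a * t + (b * s + - (b * q) * t)       ≈⟨ +-congˡ (+-congˡ (*-congʳ (-‿distribʳ-* b q))) ⟩
            a * t + (b * s + b * - q * t)         ≈⟨ +-congˡ (+-congˡ (*-assoc b (- q) t)) ⟩
            a * t + (b * s + b * (- q * t))       ≈⟨ +-congˡ (distribˡ b s _) ⟨
            a * t + b * (s + - q * t)             ≈⟨ +-congˡ (*-congˡ (+-congˡ (-‿distribˡ-* q t))) ⟨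
            a * t + b * (s + - (q * t))           ∎
        ; dividesˡ = begin
            a                                     ≈⟨ +-identityʳ a ⟨
            a + 0#                                ≈⟨ +-congˡ (-‿inverseˡ (b * q)) ⟨
            a + (- (b * q) + b * q)               ≈⟨ +-assoc a _ _ ⟨
            (a + - (b * q)) + b * q               ≈⟨ +-cong dividesʳ (*-congʳ dividesˡ) ⟩
            g * b′ + g * a′ * q                   ≈⟨ +-congˡ (*-assoc g a′ q) ⟩
            g * b′ + g * (a′ * q)                 ≈⟨ distribˡ g b′ _ ⟨
            g * (b′ + a′ * q)                     ∎
        ; dividesʳ = dividesˡ }
        where
        open RightGCD d
        open import Algebra.Properties.Ring R using (-‿distribˡ-*)

      go : ∀ a b → Acc _<_ (size b) → RightGCD a b
      go a b (acc rec) with 0? b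
      ... | yes b≈0 = record
        { g = a ; s = 1# ; t = 0# ; a′ = 1# ; b′ = 0#
        ; bezout = sym (begin
            a * 1# + b * 0# ≈⟨ +-cong (*-identityʳ a) (zeroʳ b) ⟩
            a + 0#          ≈⟨ +-identityʳ a ⟩
            a               ∎)
        ; dividesˡ = sym (*-identityʳ a)
        ; dividesʳ = trans b≈0 (sym (zeroʳ a)) }
      ... | no b≉0 with divide a b b≉0
      ... | q , smaller = step (go b (a + - (b * q)) (rec smaller))

    rightGCD : ∀ a b → RightGCD a b
    rightGCD a b = go a b (<-wellFounded (size b))

-- Integer inequalities and division with nearest quotient.

module ZArith where
  open import Data.Integer
  open import Data.Integer.Properties
  open import Data.Integer.DivMod using (_/ℕ_; _%ℕ_; n%ℕd<d; a≡a%ℕn+[a/ℕn]*n)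
  open import Data.Integer.Tactic.RingSolver using (solve-∀)
  open import Data.Nat as ℕ using (ℕ; suc; zero)
  open import Data.Product using (∃-syntax; _×_; _,_)
  open import Relation.Nullary using (yes; no)
  open import Relation.Binary.PropositionalEquality
  open import Data.Empty using (⊥-elim)

  0≤+ : ∀ {x y} → 0ℤ ≤ x → 0ℤ ≤ y → 0ℤ ≤ x + y
  0≤+ = +-mono-≤

  0≤* : ∀ {x y} → 0ℤ ≤ x → 0ℤ ≤ y → 0ℤ ≤ x * y
  0≤* {+ m} {+ n} _ _ = subst (0ℤ ≤_) (pos-* m n) (+≤+ ℕ.z≤n)

  0≤² : ∀ x → 0ℤ ≤ x * x
  0≤² (+ m) = 0≤* {+ m} {+ m} (+≤+ ℕ.z≤n) (+≤+ ℕ.z≤n)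
  0≤² -[1+ m ] = +≤+ ℕ.z≤n

  0<* : ∀ {x y} → 0ℤ < x → 0ℤ < y → 0ℤ < x * y
  0<* {+[1+ m ]} {+[1+ n ]} _ _ = +<+ (ℕ.s≤s ℕ.z≤n)
  0<* {+0} (+<+ ()) _
  0<* {+[1+ _ ]} {+0} _ (+<+ ())

  -- Certificate form of an inequality: the difference is written as an expression that is visibly
  -- nonnegative, and the remaining identity is left to the ring solver.
  ≤-by : ∀ {x y} d → y ≡ x + d → 0ℤ ≤ d → x ≤ y
  ≤-by {x} d refl h = subst (_≤ x + d) (+-identityʳ x) (+-monoʳ-≤ x h)

  <-by : ∀ {x y} d → y ≡ x + d → 0ℤ < d → x < y
  <-by {x} d refl h = subst (_< x + d) (+-identityʳ x) (+-monoʳ-< x h)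

  gap : ∀ {x y} → x ≤ y → 0ℤ ≤ y - x
  gap = i≤j⇒0≤j-i

  gap< : ∀ {x y} → x < y → 0ℤ < y - x
  gap< {x} {y} h = subst (_< y - x) (+-inverseʳ x) (+-monoˡ-< (- x) h)

  ²-cancel-< : ∀ {x y} → 0ℤ ≤ y → x * x < y * y → x < y
  ²-cancel-< {x} {y} 0≤y h with x <? y
  ... | yes lt = lt
  ... | no ¬lt = ⊥-elim (<⇒≱ h (≤-by ((x - y) * (x + y)) (eq x y)
          (0≤* (gap (≮⇒≥ ¬lt)) (0≤+ (≤-trans 0≤y (≮⇒≥ ¬lt)) 0≤y))))
    where
    eq : ∀ x y → x * x ≡ y * y + (x - y) * (x + y)
    eq = solve-∀

  abs-< : ∀ {z} {k : ℕ} → - (+ k) < z → z < + k → ∣ z ∣ ℕ.< k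
  abs-< {+ n} _ (+<+ h) = h
  abs-< { -[1+ n ]} {suc k} (-<- h) _ = ℕ.s≤s h
  abs-< { -[1+ n ]} {zero} () _

  -- Division with floor of `c + n` by `2n`, shifted back by `n`. The interval for the remainder is
  -- half open, so `-n` occurs and `n` does not.
  divide-nearest : ∀ c n .{{_ : ℕ.NonZero n}} → ∃[ k ] ∃[ r ] (c ≡ r + k * (+ 2 * + n) × - (+ n) ≤ r × r < + n)
  divide-nearest c n@(suc _) = k , r , eq , lower , upper
    where
    d = 2 ℕ.* n
    k = (c + + n) /ℕ d
    ρ = (c + + n) %ℕ d
    r = + ρ - + n
    step : ∀ c n ρ kd → c + n ≡ ρ + kd → c ≡ (ρ - n) + kd
    step c n ρ kd h = trans (l c n) (trans (cong (_- n) h) (l′ ρ kd n))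
      where
      l : ∀ c n → c ≡ (c + n) - n
      l = solve-∀
      l′ : ∀ ρ kd n → (ρ + kd) - n ≡ (ρ - n) + kd
      l′ = solve-∀
    eq : c ≡ r + k * (+ 2 * + n)
    eq = trans (step c (+ n) (+ ρ) (k * + d) (a≡a%ℕn+[a/ℕn]*n (c + + n) d)) (cong (λ z → r + k * z) (pos-* 2 n))
    lower : - (+ n) ≤ r
    lower = ≤-by (+ ρ) (l (+ ρ) (+ n)) (+≤+ ℕ.z≤n)
      where
      l : ∀ ρ n → ρ - n ≡ - n + ρ
      l = solve-∀
    upper : r < + n
    upper = <-by (+ 2 * + n - + ρ) (l (+ ρ) (+ n))
      (gap< (subst (+ ρ <_) (pos-* 2 n) (+<+ (n%ℕd<d (c + + n) d))))
      where
      l : ∀ ρ n → n ≡ (ρ - n) + (+ 2 * n - ρ)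
      l = solve-∀

  -- -n ≤ r < n as a product of nonnegative factors.
  ²-bound : ∀ {r} {n : ℕ} → - (+ n) ≤ r → r < + n → r * r ≤ + n * + n
  ²-bound {r} {n} lo hi = ≤-by ((r - - (+ n)) * (+ n - r)) (l r (+ n)) (0≤* (gap lo) (gap (<⇒≤ hi)))
    where
    l : ∀ r n → n * n ≡ r * r + (r - - n) * (n - r)
    l = solve-∀

-- Norm, cancellation and Euclidean division in ℤ[√2].

module OKArith where
  open import Defs
  open OKRing
  open Solver
  open ZArith
  open import Data.Integer as ℤ using (ℤ; +_; -[1+_]; ∣_∣; 0ℤ; -_; _*_; _+_; _-_; _<_; _≟_)
  import Data.Integer.Properties as ℤP
  open import Data.Integer.Tactic.RingSolver using (solve-∀)
  open import Data.Nat as ℕ using (ℕ; zero; suc)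
  import Data.Nat.Properties as ℕP
  import Data.Nat.Divisibility as ℕD
  open import Data.Nat.Primality using (prime[2]; euclidsLemma)
  open import Data.Nat.Induction using (<-wellFounded)
  open import Data.Nat.Tactic.RingSolver using () renaming (solve-∀ to ℕsolve)
  open import Induction.WellFounded using (Acc; acc)
  open import Data.Product using (∃-syntax; _,_; proj₁; proj₂)
  open import Data.Sum using (inj₁; inj₂)
  open import Data.Empty using (⊥-elim)
  open import Relation.Nullary using (Dec; yes; no; ¬_)
  open import Relation.Nullary.Decidable using (map′; _×-dec_)
  open import Relation.Binary.PropositionalEquality
  open import Algebra.Bundles using (CommutativeRing)

  int : ℤ → OK
  int n = mkO n (+ 0)

  N̂ : OK → ℤ
  N̂ (mkO a b) = a * a - + 2 * (b * b)

  conjᴼ : OK → OK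
  conjᴼ (mkO a b) = mkO a (- b)

  OK-ext : ∀ {x y : OK} → re x ≡ re y → im x ≡ im y → x ≡ y
  OK-ext = cong₂ mkO

  _≟ᴼ_ : ∀ (x y : OK) → Dec (x ≡ y)
  mkO a b ≟ᴼ mkO c d = map′ (λ (p , q) → cong₂ mkO p q) (λ { refl → refl , refl }) ((a ≟ c) ×-dec (b ≟ d))

  N̂-* : ∀ x y → N̂ (x *ᴼ y) ≡ N̂ x * N̂ y
  N̂-* (mkO a b) (mkO c d) = eq a b c d
    where
    eq : ∀ a b c d → (a * c + + 2 * (b * d)) * (a * c + + 2 * (b * d))
       - + 2 * ((a * d + b * c) * (a * d + b * c))
       ≡ (a * a - + 2 * (b * b)) * (c * c - + 2 * (d * d))
    eq = solve-∀

  Nm-* : ∀ x y → Nm (x *ᴼ y) ≡ Nm x ℕ.* Nm y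
  Nm-* x y = trans (cong ∣_∣ (N̂-* x y)) (ℤP.abs-* (N̂ x) (N̂ y))

  int-* : ∀ n x → int n *ᴼ x ≡ mkO (n * re x) (n * im x)
  int-* n (mkO a b) = cong₂ mkO (l n a b) (r n a b)
    where
    l : ∀ n a b → n * a + + 2 * (+ 0 * b) ≡ n * a
    l = solve-∀
    r : ∀ n a b → n * b + + 0 * a ≡ n * b
    r = solve-∀

  *-conjᴼ : ∀ x → x *ᴼ conjᴼ x ≡ int (N̂ x)
  *-conjᴼ (mkO a b) = cong₂ mkO (l a b) (r a b)
    where
    l : ∀ a b → a * a + + 2 * (b * (- b)) ≡ a * a - + 2 * (b * b)
    l = solve-∀
    r : ∀ a b → a * (- b) + b * a ≡ + 0
    r = solve-∀

  conjᴼ-* : ∀ x → conjᴼ x *ᴼ x ≡ int (N̂ x)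
  conjᴼ-* x = trans (*ᴼ-comm (conjᴼ x) x) (*-conjᴼ x)

  N̂-conjᴼ : ∀ x → N̂ (conjᴼ x) ≡ N̂ x
  N̂-conjᴼ (mkO a b) = l a b
    where
    l : ∀ a b → a * a - + 2 * ((- b) * (- b)) ≡ a * a - + 2 * (b * b)
    l = solve-∀

  -- Infinite descent: `a` is even, say `a = 2c`, so `b² = 2c²` is an instance of the same equation
  -- with `b < a`.
  √2-irrational : ∀ a b → a ℕ.* a ≡ 2 ℕ.* (b ℕ.* b) → a ≡ 0
  √2-irrational a b = go a b (<-wellFounded a)
    where
    go : ∀ a b → Acc ℕ._<_ a → a ℕ.* a ≡ 2 ℕ.* (b ℕ.* b) → a ≡ 0
    go zero b _ h = refl
    go a@(suc a-1) b (acc rec) h with 2∣a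
      where
      2∣a : 2 ℕD.∣ a
      2∣a with euclidsLemma a a prime[2] (ℕD.divides (b ℕ.* b) (trans h (ℕP.*-comm 2 (b ℕ.* b))))
      ... | inj₁ d = d
      ... | inj₂ d = d
    ... | ℕD.divides c eq = ⊥-elim (a≢0 (ℕP.*-cancelʳ-≡ a 0 a {{ℕ.nonZero}} a*a≡0))
      where
      l : ∀ c → (c ℕ.* 2) ℕ.* (c ℕ.* 2) ≡ 2 ℕ.* (2 ℕ.* (c ℕ.* c))
      l = ℕsolve
      bb : b ℕ.* b ≡ 2 ℕ.* (c ℕ.* c)
      bb = ℕP.*-cancelˡ-≡ (b ℕ.* b) _ 2 (trans (sym h) (trans (cong (λ z → z ℕ.* z) eq) (l c)))
      b<a : b ℕ.< a
      b<a with b ℕ.<? a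
      ... | yes lt = lt
      ... | no ¬lt = ⊥-elim (ℕP.<⇒≢ (ℕP.<-≤-trans (ℕP.m<m*n (a ℕ.* a) 2 (ℕ.s≤s (ℕ.s≤s ℕ.z≤n)))
              (ℕP.≤-trans (ℕP.≤-reflexive (ℕP.*-comm (a ℕ.* a) 2))
                (ℕP.*-monoʳ-≤ 2 (ℕP.*-mono-≤ (ℕP.≮⇒≥ ¬lt) (ℕP.≮⇒≥ ¬lt))))) h)
      b≡0 : b ≡ 0
      b≡0 = go b c (rec b<a) bb
      a*a≡0 : a ℕ.* a ≡ 0
      a*a≡0 = trans h (cong (λ z → 2 ℕ.* (z ℕ.* z)) b≡0)
      a≢0 : ¬ a ≡ 0
      a≢0 ()

  N̂≡0⇒≡0 : ∀ x → N̂ x ≡ 0ℤ → x ≡ 0ᴼ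
  N̂≡0⇒≡0 (mkO a b) h = cong₂ mkO a≡0 b≡0
    where
    sq : a * a ≡ + 2 * (b * b)
    sq = ℤP.i-j≡0⇒i≡j _ _ h
    sqℕ : ∣ a ∣ ℕ.* ∣ a ∣ ≡ 2 ℕ.* (∣ b ∣ ℕ.* ∣ b ∣)
    sqℕ = trans (sym (ℤP.abs-* a a))
      (trans (cong ∣_∣ sq) (trans (ℤP.abs-* (+ 2) (b * b)) (cong (2 ℕ.*_) (ℤP.abs-* b b))))
    a≡0 : a ≡ + 0
    a≡0 = ℤP.∣i∣≡0⇒i≡0 (√2-irrational ∣ a ∣ ∣ b ∣ sqℕ)
    b≡0 : b ≡ + 0
    b≡0 with ℤP.i*j≡0⇒i≡0∨j≡0 b (ℤP.*-cancelˡ-≡ (+ 2) (b * b) (+ 0) (trans (sym sq) (cong (λ z → z * z) a≡0)))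
    ... | inj₁ z = z
    ... | inj₂ z = z

  Nm≡0⇒≡0 : ∀ x → Nm x ≡ 0 → x ≡ 0ᴼ
  Nm≡0⇒≡0 x h = N̂≡0⇒≡0 x (ℤP.∣i∣≡0⇒i≡0 h)

  int-cancel : ∀ n x → ¬ n ≡ 0ℤ → int n *ᴼ x ≡ 0ᴼ → x ≡ 0ᴼ
  int-cancel n x n≢0 h = OK-ext (zero-of (re x) (cong re h′)) (zero-of (im x) (cong im h′))
    where
    h′ : mkO (n * re x) (n * im x) ≡ 0ᴼ
    h′ = trans (sym (int-* n x)) h
    zero-of : ∀ a → n * a ≡ 0ℤ → a ≡ 0ℤ
    zero-of a e with ℤP.i*j≡0⇒i≡0∨j≡0 n e
    ... | inj₁ z = ⊥-elim (n≢0 z)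
    ... | inj₂ z = z

  *ᴼ-zeroʳ : ∀ x → x *ᴼ 0ᴼ ≡ 0ᴼ
  *ᴼ-zeroʳ = CommutativeRing.zeroʳ OKR

  *ᴼ-cancel-0 : ∀ x y → ¬ x ≡ 0ᴼ → x *ᴼ y ≡ 0ᴼ → y ≡ 0ᴼ
  *ᴼ-cancel-0 x y x≢0 h = int-cancel (N̂ x) y (λ e → x≢0 (N̂≡0⇒≡0 x e))
    (trans (cong (_*ᴼ y) (sym (conjᴼ-* x)))
      (trans (*ᴼ-assoc (conjᴼ x) x y) (trans (cong (conjᴼ x *ᴼ_) h) (*ᴼ-zeroʳ (conjᴼ x)))))

  -ᴼ≡0⇒≡ : ∀ {x y} → x -ᴼ y ≡ 0ᴼ → x ≡ y
  -ᴼ≡0⇒≡ {mkO a b} {mkO c d} h = cong₂ mkO (ℤP.i-j≡0⇒i≡j a c (cong re h)) (ℤP.i-j≡0⇒i≡j b d (cong im h))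

  *ᴼ-cancelˡ : ∀ x {y z} → ¬ x ≡ 0ᴼ → x *ᴼ y ≡ x *ᴼ z → y ≡ z
  *ᴼ-cancelˡ x {y} {z} x≢0 h = -ᴼ≡0⇒≡ (*ᴼ-cancel-0 x (y -ᴼ z) x≢0
    (trans (eq x y z) (trans (cong (_-ᴼ x *ᴼ z) h) (+ᴼ-invʳ (x *ᴼ z)))))
    where
    eq : ∀ x y z → x *ᴼ (y -ᴼ z) ≡ x *ᴼ y -ᴼ x *ᴼ z
    eq x y z = prove 3 (λ x y z → x ⊗ (y ⊕ (⊝ z)) ≐ (x ⊗ y) ⊕ (⊝ (x ⊗ z))) refl (x ∷ y ∷ z ∷ [])

  infix 4 _∣_
  -- Unlike the Σ-type _∣ᴼ_, the record determines its parameters up to unification.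
  record _∣_ (x y : OK) : Set where
    constructor divides
    field
      quotient : OK
      equality : y ≡ x *ᴼ quotient
  open _∣_ public

  ∣⇒∣ᴼ : ∀ {x y} → x ∣ y → x ∣ᴼ y
  ∣⇒∣ᴼ (divides c e) = c , e
  ∣ᴼ⇒∣ : ∀ {x y} → x ∣ᴼ y → x ∣ y
  ∣ᴼ⇒∣ (c , e) = divides c e

  ∣-refl : ∀ {x} → x ∣ x
  ∣-refl {x} = divides oneᴼ (sym (*ᴼ-idʳ x))

  ∣-trans : ∀ {x y z} → x ∣ y → y ∣ z → x ∣ z
  ∣-trans {x} (divides c refl) (divides d refl) = divides (c *ᴼ d) (*ᴼ-assoc x c d)

  ∣-*ʳ : ∀ {x y} z → x ∣ y → x ∣ y *ᴼ z
  ∣-*ʳ {x} z (divides c refl) = divides (c *ᴼ z) (*ᴼ-assoc x c z)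

  ∣-*ˡ : ∀ {x y} z → x ∣ y → x ∣ z *ᴼ y
  ∣-*ˡ {x} {y} z d = subst (x ∣_) (*ᴼ-comm y z) (∣-*ʳ z d)

  -- Rounding is done after multiplication by the conjugate of `b`, which keeps everything integral.
  -- The product `s` of the remainder with that conjugate has coordinates of absolute value at most
  -- `n/2`, so `4 N̂ s` lies between `-2n²` and `n²`, while `Nm s` is `n` times the norm of the
  -- remainder.
  divide : ∀ a b → ¬ b ≡ 0ᴼ → ∃[ q ] Nm (a +ᴼ -ᴼ (b *ᴼ q)) ℕ.< Nm b
  divide a b b≢0 = q , ℕP.*-cancelʳ-< n (Nm (a +ᴼ -ᴼ (b *ᴼ q))) n (subst (ℕ._< n ℕ.* n) NmS small)
    where
    n = Nm b
    instance
      n≢0 : ℕ.NonZero n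
      n≢0 = ℕ.≢-nonZero (λ e → b≢0 (Nm≡0⇒≡0 b e))
    y = a *ᴼ conjᴼ b
    R₀ = divide-nearest (+ 2 * re y) n
    R₁ = divide-nearest (+ 2 * im y) n
    k₀ = proj₁ R₀
    k₁ = proj₁ R₁
    r₀ = proj₁ (proj₂ R₀)
    r₁ = proj₁ (proj₂ R₁)
    signed : ∀ z → ∃[ σ ] z * σ ≡ + ∣ z ∣
    signed (+ m) = + 1 , ℤP.*-identityʳ (+ m)
    signed -[1+ m ] = -[1+ 0 ] , trans (ℤP.*-comm -[1+ m ] -[1+ 0 ]) (ℤP.-1*i≡-i -[1+ m ])
    -- The norm of `b` may be negative; its sign turns `b` times its conjugate into the positive
    -- integer `n`.
    σ = proj₁ (signed (N̂ b))
    k = mkO k₀ k₁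
    q = int σ *ᴼ k
    s = y -ᴼ int (+ n) *ᴼ k
    s-eq : (a +ᴼ -ᴼ (b *ᴼ q)) *ᴼ conjᴼ b ≡ s
    s-eq = trans (e₁ a b (int σ) k (conjᴼ b)) (cong (λ z → y -ᴼ z *ᴼ k)
      (trans (cong (_*ᴼ int σ) (*-conjᴼ b))
        (trans (int-* (N̂ b) (int σ)) (cong₂ mkO (proj₂ (signed (N̂ b))) (ℤP.*-zeroʳ (N̂ b))))))
      where
      e₁ : ∀ a b σ k b′ → (a +ᴼ -ᴼ (b *ᴼ (σ *ᴼ k))) *ᴼ b′ ≡ a *ᴼ b′ -ᴼ (b *ᴼ b′ *ᴼ σ) *ᴼ k
      e₁ a b σ k b′ = prove 5 (λ a b σ k b′ →
        (a ⊕ (⊝ (b ⊗ (σ ⊗ k)))) ⊗ b′ ≐ (a ⊗ b′) ⊕ (⊝ ((b ⊗ b′ ⊗ σ) ⊗ k))) refl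
        (a ∷ b ∷ σ ∷ k ∷ b′ ∷ [])
    NmS : Nm s ≡ Nm (a +ᴼ -ᴼ (b *ᴼ q)) ℕ.* n
    NmS = trans (cong Nm (sym s-eq))
      (trans (Nm-* (a +ᴼ -ᴼ (b *ᴼ q)) (conjᴼ b)) (cong (Nm (a +ᴼ -ᴼ (b *ᴼ q)) ℕ.*_) (cong ∣_∣ (N̂-conjᴼ b))))
    half : ∀ c n k r → + 2 * c ≡ r + k * (+ 2 * n) → + 2 * (c - n * k) ≡ r
    half c n k r h = trans (l c n k) (trans (cong (_- k * (+ 2 * n)) h) (l′ r (k * (+ 2 * n))))
      where
      l : ∀ c n k → + 2 * (c - n * k) ≡ + 2 * c - k * (+ 2 * n)
      l = solve-∀
      l′ : ∀ r z → (r + z) - z ≡ r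
      l′ = solve-∀
    s₀ : + 2 * re s ≡ r₀
    s₀ = trans (cong (λ z → + 2 * (re y - re z)) (int-* (+ n) k))
      (half (re y) (+ n) k₀ r₀ (proj₁ (proj₂ (proj₂ R₀))))
    s₁ : + 2 * im s ≡ r₁
    s₁ = trans (cong (λ z → + 2 * (im y - im z)) (int-* (+ n) k))
      (half (im y) (+ n) k₁ r₁ (proj₁ (proj₂ (proj₂ R₁))))
    4N : + 4 * N̂ s ≡ r₀ * r₀ - + 2 * (r₁ * r₁)
    4N = trans (l (re s) (im s)) (cong₂ (λ a b → a * a - + 2 * (b * b)) s₀ s₁)
      where
      l : ∀ a b → + 4 * (a * a - + 2 * (b * b)) ≡ (+ 2 * a) * (+ 2 * a) - + 2 * ((+ 2 * b) * (+ 2 * b))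
      l = solve-∀
    b₀ = gap (²-bound (proj₁ (proj₂ (proj₂ (proj₂ R₀)))) (proj₂ (proj₂ (proj₂ (proj₂ R₀)))))
    b₁ = gap (²-bound (proj₁ (proj₂ (proj₂ (proj₂ R₁)))) (proj₂ (proj₂ (proj₂ (proj₂ R₁)))))
    0<n : + 0 < + n
    0<n = ℤ.+<+ (ℕP.n≢0⇒n>0 (ℕ.≢-nonZero⁻¹ n))
    0<nn = 0<* 0<n 0<n
    +nn : + (n ℕ.* n) ≡ + n * + n
    +nn = ℤP.pos-* n n
    small : Nm s ℕ.< n ℕ.* n
    small = abs-< (ℤP.*-cancelˡ-<-nonNeg (+ 4) lower) (ℤP.*-cancelˡ-<-nonNeg (+ 4) upper)
      where
      l : ∀ m p q → + 4 * m ≡ (p - + 2 * q) + (+ 3 * m + (m - p) + + 2 * q)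
      l = solve-∀
      l′ : ∀ m p q → p - + 2 * q ≡ + 4 * (- m) + (+ 2 * m + p + + 2 * (m - q))
      l′ = solve-∀
      upper : + 4 * N̂ s < + 4 * + (n ℕ.* n)
      upper = subst₂ _<_ (sym 4N) (cong (+ 4 *_) (sym +nn))
        (<-by _ (l (+ n * + n) (r₀ * r₀) (r₁ * r₁))
          (ℤP.+-mono-<-≤ (ℤP.+-mono-<-≤ (0<* {+ 3} (ℤ.+<+ (ℕ.s≤s ℕ.z≤n)) 0<nn) b₀)
            (0≤* {+ 2} (ℤ.+≤+ ℕ.z≤n) (0≤² r₁))))
      lower : + 4 * - (+ (n ℕ.* n)) < + 4 * N̂ s
      lower = subst₂ _<_ (cong (λ z → + 4 * - z) (sym +nn)) (sym 4N)
        (<-by _ (l′ (+ n * + n) (r₀ * r₀) (r₁ * r₁))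
          (ℤP.+-mono-<-≤ (ℤP.+-mono-<-≤ (0<* {+ 2} (ℤ.+<+ (ℕ.s≤s ℕ.z≤n)) 0<nn) (0≤² r₀))
            (0≤* {+ 2} (ℤ.+≤+ ℕ.z≤n) b₁)))

  module GCDᴼ = EuclideanAlgorithm.Euclid (CommutativeRing.ring OKR) (_≟ᴼ 0ᴼ) Nm divide

-- Totally positive units of ℤ[√2].

module UnitsOK where
  open import Defs hiding (H; K)
  open Solver
  open ZArith
  open OKArith hiding (divide)
  open import Data.Integer as ℤ using (ℤ; +_; -[1+_]; ∣_∣; 0ℤ; -_; _*_; _+_; _-_; _<_; _≤_)
  import Data.Integer.Properties as ℤP
  open import Data.Integer.Tactic.RingSolver using (solve-∀)
  open import Data.Nat as ℕ using (ℕ; zero; suc)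
  import Data.Nat.Properties as ℕP
  open import Data.Nat.Induction using (<-wellFounded)
  open import Induction.WellFounded using (Acc; acc)
  open import Data.Product using (∃-syntax; _,_)
  open import Relation.Binary.PropositionalEquality

  conjᴼ-hom : ∀ x y → conjᴼ (x *ᴼ y) ≡ conjᴼ x *ᴼ conjᴼ y
  conjᴼ-hom (mkO a b) (mkO c d) = cong₂ mkO (l a b c d) (r a b c d)
    where
    l : ∀ a b c d → a * c + + 2 * (b * d) ≡ a * c + + 2 * (- b * - d)
    l = solve-∀
    r : ∀ a b c d → - (a * d + b * c) ≡ a * - d + - b * c
    r = solve-∀

  private
    Square : OK → Set
    Square k = ∃[ ε ] ε *ᴼ ε ≡ k

    unsign : ∀ a b → Square (mkO a (+ ∣ b ∣)) → Square (mkO a b)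
    unsign a (+ n) s = s
    unsign a -[1+ n ] (ε , e) = conjᴼ ε , trans (sym (conjᴼ-hom ε ε)) (cong conjᴼ e)

    -- Multiplication by the inverse of the fundamental square (1+√2)² = 3+2√2 decreases the irrational part.
    module Descent (a b : ℤ) (0<a : 0ℤ < a) (0<b : 0ℤ < b) (1≤b : + 1 ≤ b) (h : a * a - + 2 * (b * b)
      ≡ + 1) where
      a′ b′ : ℤ
      a′ = + 3 * a - + 4 * b
      b′ = + 3 * b - + 2 * a
      aa : a * a ≡ + 1 + + 2 * (b * b)
      aa = trans (l (a * a) (+ 2 * (b * b))) (cong (_+ + 2 * (b * b)) h)
        where
        l : ∀ x y → x ≡ (x - y) + y
        l = solve-∀
      0<bb = 0<* 0<b 0<b
      b<a : b < a
      b<a = ²-cancel-< (ℤP.<⇒≤ 0<a) (<-by (+ 1 + b * b) (trans aa (l (b * b)))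
        (ℤP.+-mono-<-≤ {0ℤ} {+ 1} {0ℤ} {b * b} (ℤ.+<+ (ℕ.s≤s ℕ.z≤n)) (ℤP.<⇒≤ 0<bb)))
        where
        l : ∀ x → + 1 + + 2 * x ≡ x + (+ 1 + x)
        l = solve-∀
      a<2b : a < + 2 * b
      a<2b = ²-cancel-< (ℤP.<⇒≤ (0<* {+ 2} (ℤ.+<+ (ℕ.s≤s ℕ.z≤n)) 0<b))
        (<-by (b * b + (b - + 1) * (b + + 1)) (trans (l b) (cong (_+ (b * b + (b - + 1) * (b + + 1))) (sym aa)))
          (ℤP.+-mono-<-≤ {0ℤ} {b * b} {0ℤ} {(b - + 1) * (b + + 1)} 0<bb
            (0≤* {b - + 1} {b + + 1} (gap {+ 1} {b} 1≤b) (0≤+ {b} {+ 1} (ℤP.<⇒≤ 0<b) (ℤ.+≤+ ℕ.z≤n)))))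
        where
        l : ∀ b → (+ 2 * b) * (+ 2 * b) ≡ (+ 1 + + 2 * (b * b)) + (b * b + (b - + 1) * (b + + 1))
        l = solve-∀
      0<a′ : 0ℤ < a′
      0<a′ = gap< (²-cancel-< {+ 4 * b} {+ 3 * a} (ℤP.<⇒≤ (0<* {+ 3} (ℤ.+<+ (ℕ.s≤s ℕ.z≤n)) 0<a))
        (<-by (+ 9 + + 2 * (b * b)) (trans (l a) (trans (cong (+ 9 *_) aa) (l′ b)))
          (ℤP.+-mono-<-≤ {0ℤ} {+ 9} {0ℤ} {+ 2 * (b * b)} (ℤ.+<+ (ℕ.s≤s ℕ.z≤n))
            (0≤* {+ 2} (ℤ.+≤+ ℕ.z≤n) (0≤² b)))))
        where
        l : ∀ a → (+ 3 * a) * (+ 3 * a) ≡ + 9 * (a * a)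
        l = solve-∀
        l′ : ∀ b → + 9 * (+ 1 + + 2 * (b * b)) ≡ (+ 4 * b) * (+ 4 * b) + (+ 9 + + 2 * (b * b))
        l′ = solve-∀
      -- From `b < a < 2b` the new irrational part `3b − 2a` lies strictly between `-b` and `b`;
      -- this is what makes the descent terminate.
      lower : - b < b′
      lower = <-by (+ 2 * (+ 2 * b - a)) (l a b) (0<* {+ 2} (ℤ.+<+ (ℕ.s≤s ℕ.z≤n)) (gap< a<2b))
        where
        l : ∀ a b → + 3 * b - + 2 * a ≡ - b + + 2 * (+ 2 * b - a)
        l = solve-∀
      upper : b′ < b
      upper = <-by (+ 2 * (a - b)) (l a b) (0<* {+ 2} (ℤ.+<+ (ℕ.s≤s ℕ.z≤n)) (gap< b<a))
        where
        l : ∀ a b → b ≡ (+ 3 * b - + 2 * a) + + 2 * (a - b)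
        l = solve-∀
      h′ : a′ * a′ - + 2 * (b′ * b′) ≡ + 1
      h′ = trans (l a b) h
        where
        l : ∀ a b → (+ 3 * a - + 4 * b) * (+ 3 * a - + 4 * b) - + 2
          * ((+ 3 * b - + 2 * a) * (+ 3 * b - + 2 * a)) ≡ a * a - + 2 * (b * b)
        l = solve-∀
      finish : Square (mkO a′ b′) → Square (mkO a b)
      finish (ε , e) = mkO (+ 1) (+ 1) *ᴼ ε , trans (assoc ε)
        (trans (cong (mkO (+ 3) (+ 2) *ᴼ_) e) (cong₂ mkO (l a b) (l′ a b)))
        where
        assoc : ∀ ε → (mkO (+ 1) (+ 1) *ᴼ ε) *ᴼ (mkO (+ 1) (+ 1) *ᴼ ε) ≡ mkO (+ 3) (+ 2) *ᴼ (ε *ᴼ ε)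
        assoc ε = prove 1 (λ ε → (Κ (mkO (+ 1) (+ 1)) ⊗ ε) ⊗ (Κ (mkO (+ 1) (+ 1)) ⊗ ε)
          ≐ Κ (mkO (+ 3) (+ 2)) ⊗ (ε ⊗ ε)) refl (ε ∷ [])
        l : ∀ a b → + 3 * (+ 3 * a - + 4 * b) + + 2 * (+ 2 * (+ 3 * b - + 2 * a)) ≡ a
        l = solve-∀
        l′ : ∀ a b → + 3 * (+ 3 * b - + 2 * a) + + 2 * (+ 3 * a - + 4 * b) ≡ b
        l′ = solve-∀

    square-abs : ∀ z → + ∣ z ∣ * + ∣ z ∣ ≡ z * z
    square-abs (+ n) = refl
    square-abs -[1+ n ] = refl

    norm-abs : ∀ a b → a * a - + 2 * (b * b) ≡ + 1 → a * a - + 2 * (+ ∣ b ∣ * + ∣ b ∣) ≡ + 1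
    norm-abs a b h = trans (cong (λ z → a * a - + 2 * z) (square-abs b)) h

    descend : ∀ n a → Acc ℕ._<_ n → 0ℤ < a → a * a - + 2 * (+ n * + n) ≡ + 1 → Square (mkO a (+ n))
    descend-by : ∀ n a b → b ≡ + n → + 1 ≤ b → Acc ℕ._<_ n → 0ℤ < a → a * a - + 2 * (b * b) ≡ + 1 →
      Square (mkO a b)

    descend zero a _ 0<a h = oneᴼ , cong (λ a →
      mkO a (+ 0)) (sym (one a 0<a (trans (sym (ℤP.+-identityʳ (a * a))) h)))
      where
      one : ∀ a → 0ℤ < a → a * a ≡ + 1 → a ≡ + 1
      one (+ n) _ e = cong +_ (ℕP.m*n≡1⇒m≡1 n n (ℤP.+-injective (trans (ℤP.pos-* n n) e)))
    descend n@(suc _) a rec 0<a h = descend-by n a (+ n) refl (ℤ.+≤+ (ℕ.s≤s ℕ.z≤n)) rec 0<a h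

    descend-by n a b b≡n 1≤b (acc rec) 0<a h = finish (unsign a′ b′ (descend ∣ b′ ∣ a′
        (rec (abs-< {b′} (subst (λ b → - b < b′) b≡n lower) (subst (b′ <_) b≡n upper))) 0<a′
          (norm-abs a′ b′ h′)))
      where open Descent a b 0<a (ℤP.<-≤-trans (ℤ.+<+ (ℕ.s≤s ℕ.z≤n)) 1≤b) 1≤b h

  -- The fundamental unit `1+√2` has norm -1, so the totally positive units are the powers of its
  -- square `3+2√2`. A generator whose norm is off by such a unit can therefore be corrected by a
  -- scalar.
  positive-unit-square : ∀ k → 0ℤ < re k → N̂ k ≡ + 1 → ∃[ ε ] ε *ᴼ ε ≡ k
  positive-unit-square (mkO a b) 0<a h = unsign a b (descend ∣ b ∣ a (<-wellFounded ∣ b ∣) 0<a (norm-abs a b h))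

-- The reduced norm in terms of positive integral forms.

module Metric where
  open import Defs hiding (H; K)
  open Solver
  open Quaternion
  open ZArith
  open OKArith
  open import Data.Integer as ℤ using (ℤ; +_; 0ℤ; -_; _*_; _+_; _-_; _≤_)
  import Data.Integer.Properties as ℤP
  open import Data.Nat as ℕ using (ℕ)
  open import Data.Product using (_,_; proj₁; proj₂)
  open import Relation.Binary.PropositionalEquality

  -- In the basis 1, i, j, (1+i+j+k)/2 of the Hurwitz quaternions.
  hurwitz : Quat ℤ → ℤ
  hurwitz ⟪ t , x , y , z ⟫ = t * t + x * x + y * y + z * z + z * (t + x + y)

  doubled : Quat ℤ → Quat ℤ
  doubled ⟪ t , x , y , z ⟫ = ⟪ + 2 * t + z , + 2 * x + z , + 2 * y + z , z ⟫

  squares : Quat ℤ → ℤ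
  squares ⟪ a , b , c , d ⟫ = a * a + b * b + c * c + d * d

  -- x = p + s(1+i)/√2 with Hurwitz quaternions p and s; the rational part of nrd x is nrd p + nrd s.
  part₀ part₁ skew : 𝒪 → Quat ℤ
  part₀ ⟪ mkO t t' , mkO x x' , mkO y y' , mkO z z' ⟫ = ⟪ t + x' + y' , x' , y' , z ⟫
  part₁ ⟪ mkO t t' , mkO x x' , mkO y y' , mkO z z' ⟫ = ⟪ t' + x , - (t' + y + z') , - z' , y + + 2 * z' ⟫
  -- the coordinates of s(1+i)
  skew ⟪ mkO t t' , mkO x x' , mkO y y' , mkO z z' ⟫ = ⟪ + 2 * t' + x + y + z' , x + z' , y + z' , z' ⟫

  fromParts : Quat ℤ → Quat ℤ → 𝒪
  fromParts ⟪ a , b , c , d ⟫ ⟪ a' , b' , c' , d' ⟫ =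
    ⟪ mkO (a - b - c) (- (b' + c' + d')) , mkO (a' + b' + c' + d') b , mkO (d' + + 2 * c') c , mkO d (- c') ⟫

  fromParts-parts : ∀ x → fromParts (part₀ x) (part₁ x) ≡ x
  fromParts-parts ⟪ mkO t t' , mkO x x' , mkO y y' , mkO z z' ⟫ = quat≡
    (OK-ext (l₁ t x' y') (l₂ t' y z')) (OK-ext (l₃ t' x y z') refl) (OK-ext (l₄ y z') refl)
      (OK-ext refl (l₅ z'))
    where
    open import Data.Integer.Tactic.RingSolver using (solve-∀)
    l₁ : ∀ t x y → (t + x + y) - x - y ≡ t
    l₁ = solve-∀
    l₂ : ∀ t y z → - (- (t + y + z) + - z + (y + + 2 * z)) ≡ t
    l₂ = solve-∀
    l₃ : ∀ t x y z → (t + x) + - (t + y + z) + - z + (y + + 2 * z) ≡ x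
    l₃ = solve-∀
    l₄ : ∀ y z → (y + + 2 * z) + + 2 * - z ≡ y
    l₄ = solve-∀
    l₅ : ∀ z → - (- z) ≡ z
    l₅ = solve-∀

  private
    module FP {n} = Formulas {Pairs.Pair {n}} Pairs._⊕²_ Pairs._⊗²_ Pairs.⊝²_ Pairs.√2²
    sq : ∀ {n} → Expr ℤ n → Expr ℤ n
    sq a = a ⊗ a

  opaque
    unfolding N
    re-N : ∀ x → re (N x) ≡ hurwitz (part₀ x) + hurwitz (part₁ x)
    re-N ⟪ mkO t t' , mkO x x' , mkO y y' , mkO z z' ⟫ = proveℤ 8 (λ t t' x x' y y' z z' →
      proj₁ (FP.form ⟪ (t , t') , (x , x') , (y , y') , (z , z') ⟫)
      ≐ hur (t ⊕ x' ⊕ y') x' y' z ⊕ hur (t' ⊕ x) (⊝ (t' ⊕ y ⊕ z')) (⊝ z') (y ⊕ Κ (+ 2) ⊗ z')) refl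
      (t ∷ t' ∷ x ∷ x' ∷ y ∷ y' ∷ z ∷ z' ∷ [])
      where
      hur : ∀ {n} (t x y z : Expr ℤ n) → Expr ℤ n
      hur t x y z = sq t ⊕ sq x ⊕ sq y ⊕ sq z ⊕ z ⊗ (t ⊕ x ⊕ y)

    4re-N : ∀ x → + 4 * re (N x) ≡ squares (doubled (part₀ x)) + + 2 * squares (skew x)
    4re-N ⟪ mkO t t' , mkO x x' , mkO y y' , mkO z z' ⟫ = proveℤ 8 (λ t t' x x' y y' z z' →
      Κ (+ 4) ⊗ proj₁ (FP.form ⟪ (t , t') , (x , x') , (y , y') , (z , z') ⟫)
      ≐ (sq (Κ (+ 2) ⊗ (t ⊕ x' ⊕ y') ⊕ z) ⊕ sq (Κ (+ 2) ⊗ x' ⊕ z) ⊕ sq (Κ (+ 2) ⊗ y' ⊕ z) ⊕ sq z)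
        ⊕ Κ (+ 2) ⊗ (sq (Κ (+ 2) ⊗ t' ⊕ x ⊕ y ⊕ z') ⊕ sq (x ⊕ z') ⊕ sq (y ⊕ z') ⊕ sq z')) refl
      (t ∷ t' ∷ x ∷ x' ∷ y ∷ y' ∷ z ∷ z' ∷ [])

    -- Expanding the norm of `p + s(1+i)/√2`, the mixed term is the trace of `p` times the conjugate
    -- of `s(1+i)`, divided by `√2`. This is `√2` times the scalar product of the two vectors, and
    -- `P` is `p` doubled.
    2im-N : ∀ x → let P = doubled (part₀ x) ; S = skew x in
      + 2 * im (N x) ≡ q₁ P * q₁ S + q₂ P * q₂ S + q₃ P * q₃ S + q₄ P * q₄ S
    2im-N ⟪ mkO t t' , mkO x x' , mkO y y' , mkO z z' ⟫ = proveℤ 8 (λ t t' x x' y y' z z' →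
      Κ (+ 2) ⊗ proj₂ (FP.form ⟪ (t , t') , (x , x') , (y , y') , (z , z') ⟫)
      ≐ (Κ (+ 2) ⊗ (t ⊕ x' ⊕ y') ⊕ z) ⊗ (Κ (+ 2) ⊗ t' ⊕ x ⊕ y ⊕ z') ⊕ (Κ (+ 2) ⊗ x' ⊕ z) ⊗ (x ⊕ z')
        ⊕ (Κ (+ 2) ⊗ y' ⊕ z) ⊗ (y ⊕ z') ⊕ z ⊗ z') refl
      (t ∷ t' ∷ x ∷ x' ∷ y ∷ y' ∷ z ∷ z' ∷ [])

  4hurwitz : ∀ v → + 4 * hurwitz v ≡ squares (doubled v)
  4hurwitz ⟪ t , x , y , z ⟫ = l t x y z
    where
    open import Data.Integer.Tactic.RingSolver using (solve-∀)
    l : ∀ t x y z → + 4 * (t * t + x * x + y * y + z * z + z * (t + x + y))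
      ≡ (+ 2 * t + z) * (+ 2 * t + z) + (+ 2 * x + z) * (+ 2 * x + z) + (+ 2 * y + z) * (+ 2 * y + z) + z * z
    l = solve-∀

  0≤squares : ∀ v → 0ℤ ≤ squares v
  0≤squares ⟪ a , b , c , d ⟫ = 0≤+ (0≤+ (0≤+ (0≤² a) (0≤² b)) (0≤² c)) (0≤² d)

  pos-4 : ∀ {z} → 0ℤ ≤ + 4 * z → 0ℤ ≤ z
  pos-4 {z} h = ℤP.*-cancelˡ-≤-pos 0ℤ z (+ 4) h

  0≤hurwitz : ∀ v → 0ℤ ≤ hurwitz v
  0≤hurwitz v = pos-4 (subst (0ℤ ≤_) (sym (4hurwitz v)) (0≤squares (doubled v)))

  -- With A = ∑P², B = ∑S², C = ∑PS this is (A+2B)² − 8C² = (A−2B)² + 8(AB−C²) and Lagrange's identity.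
  16N̂-N : ∀ x → 0ℤ ≤ + 16 * N̂ (N x)
  16N̂-N x = subst (0ℤ ≤_) (sym eq) (nonneg (A - + 2 * B)
    (minor (q₁ P) (q₂ P) (q₁ S) (q₂ S)) (minor (q₁ P) (q₃ P) (q₁ S) (q₃ S)) (minor (q₁ P) (q₄ P) (q₁ S) (q₄ S))
    (minor (q₂ P) (q₃ P) (q₂ S) (q₃ S)) (minor (q₂ P) (q₄ P) (q₂ S) (q₄ S)) (minor (q₃ P) (q₄ P) (q₃ S) (q₄ S)))
    where
    P = doubled (part₀ x)
    S = skew x
    r = re (N x)
    s = im (N x)
    A = squares P
    B = squares S
    minor : ℤ → ℤ → ℤ → ℤ → ℤ
    minor u v u' v' = u * v' - v * u'
    nonneg : ∀ u a b c d e f → 0ℤ ≤ u * u + + 8 * (a * a + b * b + c * c + d * d + e * e + f * f)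
    nonneg u a b c d e f = 0≤+ {u * u} {+ 8 * (a * a + b * b + c * c + d * d + e * e + f * f)} (0≤² u)
      (0≤* {+ 8} (ℤ.+≤+ ℕ.z≤n)
      (0≤+ (0≤+ (0≤+ (0≤+ (0≤+ (0≤² a) (0≤² b)) (0≤² c)) (0≤² d)) (0≤² e)) (0≤² f)))
    lagrange : ∀ a b c d a' b' c' d' →
      let A = a * a + b * b + c * c + d * d
          B = a' * a' + b' * b' + c' * c' + d' * d'
          C = a * a' + b * b' + c * c' + d * d'
          m = λ u v u' v' → (u * v' - v * u') * (u * v' - v * u')
      in (A + + 2 * B) * (A + + 2 * B) - + 8 * (C * C)
       ≡ (A - + 2 * B) * (A - + 2 * B) + + 8 * (m a b a' b' + m a c a' c' + m a d a' d' + m b c b' c' + m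
         b d b' d' + m c d c' d')
    lagrange a b c d a' b' c' d' = proveℤ 8 (λ a b c d a' b' c' d' →
      let A = sq a ⊕ sq b ⊕ sq c ⊕ sq d
          B = sq a' ⊕ sq b' ⊕ sq c' ⊕ sq d'
          C = a ⊗ a' ⊕ b ⊗ b' ⊕ c ⊗ c' ⊕ d ⊗ d'
          m = λ u v u' v' → sq (u ⊗ v' ⊕ (⊝ (v ⊗ u')))
      in sq (A ⊕ Κ (+ 2) ⊗ B) ⊕ (⊝ (Κ (+ 8) ⊗ sq C))
        ≐ sq (A ⊕ (⊝ (Κ (+ 2) ⊗ B))) ⊕ Κ (+ 8) ⊗ (m a b a' b' ⊕ m a c a' c' ⊕ m a d a' d' ⊕ m b c b'
        c' ⊕ m b d b' d' ⊕ m c d c' d')) refl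
      (a ∷ b ∷ c ∷ d ∷ a' ∷ b' ∷ c' ∷ d' ∷ [])
    expand : ∀ r s → + 16 * (r * r - + 2 * (s * s)) ≡ (+ 4 * r) * (+ 4 * r) - + 8 * ((+ 2 * s) * (+ 2 * s))
    expand r s = proveℤ 2 (λ r s →
      Κ (+ 16) ⊗ (sq r ⊕ (⊝ (Κ (+ 2) ⊗ sq s))) ≐ sq (Κ (+ 4) ⊗ r) ⊕ (⊝ (Κ (+ 8) ⊗ sq (Κ (+ 2) ⊗ s)))) refl
      (r ∷ s ∷ [])
    eq = trans (expand r s) (trans (cong₂ (λ u v → u * u - + 8 * (v * v)) (4re-N x) (2im-N x))
      (lagrange (q₁ P) (q₂ P) (q₃ P) (q₄ P) (q₁ S) (q₂ S) (q₃ S) (q₄ S)))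

  0≤N̂-N : ∀ x → 0ℤ ≤ N̂ (N x)
  0≤N̂-N x = ℤP.*-cancelˡ-≤-pos 0ℤ (N̂ (N x)) (+ 16) (16N̂-N x)

  0≤re-N : ∀ x → 0ℤ ≤ re (N x)
  0≤re-N x = subst (0ℤ ≤_) (sym (re-N x)) (0≤+ (0≤hurwitz (part₀ x)) (0≤hurwitz (part₁ x)))

-- Covering of the rational quaternions by the Hurwitz lattice.

module Reduction where
  open import Defs hiding (H; K)
  open Solver
  open ZArith
  open OKArith
  open Metric
  open import Data.Integer as ℤ using (ℤ; +_; -[1+_]; 0ℤ; -_; _*_; _+_; _-_; _<_; _≤_)
  import Data.Integer.Properties as ℤP
  open import Data.Integer.Tactic.RingSolver using (solve-∀)
  open import Data.Nat as ℕ using (ℕ)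
  open import Data.Bool using (Bool; true; false)
  open import Data.Product using (∃-syntax; _×_; _,_; proj₁; proj₂)
  open import Data.Sum using (_⊎_; inj₁; inj₂)
  open import Relation.Binary.PropositionalEquality
  open import Relation.Nullary using (¬_; yes; no)
  open import Data.Empty using (⊥-elim)

  infixl 6 _-ᵛ_
  infixl 7 _⊛_
  _-ᵛ_ : Quat ℤ → Quat ℤ → Quat ℤ
  ⟪ a , b , c , d ⟫ -ᵛ ⟪ a' , b' , c' , d' ⟫ = ⟪ a - a' , b - b' , c - c' , d - d' ⟫
  _⊛_ : ℤ → Quat ℤ → Quat ℤ
  k ⊛ ⟪ a , b , c , d ⟫ = ⟪ k * a , k * b , k * c , k * d ⟫

  -- Representatives of the deep holes (1+i)/2, (1+j)/2, (i+j)/2 of the Hurwitz lattice, times 2.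
  data Hole : Set where
    1i 1j ij : Hole

  hole : Hole → Quat ℤ
  hole 1i = ⟪ + 1 , + 1 , + 0 , + 0 ⟫
  hole 1j = ⟪ + 1 , + 0 , + 1 , + 0 ⟫
  hole ij = ⟪ + 0 , + 1 , + 1 , + 0 ⟫

  -- Division of a Hurwitz quaternion by an integer leaves a remainder of norm at most `n²/2`. The
  -- second alternative is the case of equality: the quotient is then a deep hole, translated to one
  -- of three representatives, and `n` is even.
  record Reduced (v : Quat ℤ) (n : ℤ) : Set where
    constructor reduced
    field
      q r : Quat ℤ
      remainder : r ≡ v -ᵛ n ⊛ q
      bound : (+ 2 * hurwitz r < n * n) ⊎ (∃[ k ] ∃[ h ] (n ≡ + 2 * k × r ≡ k ⊛ hole h))

  private
    0or : ∀ {a b} → a * b ≡ 0ℤ → a ≡ 0ℤ ⊎ b ≡ 0ℤ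
    0or {a} = ℤP.i*j≡0⇒i≡0∨j≡0 a

    sign-bit : ∀ c → ∃[ b ] let s = + 1 - + 2 * b in (0ℤ ≤ s * c × s * s ≡ + 1 × (s ≡ + 1 ⊎ s ≡ -[1+ 0 ]))
    sign-bit (+ n) = + 0 , subst (0ℤ ≤_) (sym (ℤP.*-identityˡ (+ n))) (ℤ.+≤+ ℕ.z≤n) , refl , inj₁ refl
    sign-bit -[1+ n ] = + 1 , ℤ.+≤+ ℕ.z≤n , refl , inj₂ refl

    flag : Bool → ℤ
    flag true = + 1
    flag false = + 0

    zero-of-sum : ∀ {a b} → 0ℤ ≤ a → 0ℤ ≤ b → a + b ≤ 0ℤ → a ≡ 0ℤ × b ≡ 0ℤ
    zero-of-sum {a} {b} 0≤a 0≤b h =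
      ℤP.≤-antisym (ℤP.≤-trans (≤-by b refl 0≤b) h) 0≤a ,
        ℤP.≤-antisym (ℤP.≤-trans (≤-by a (ℤP.+-comm a b) 0≤a) h) 0≤b

    half-< : ∀ v {m} → squares (doubled v) < + 2 * m → + 2 * hurwitz v < m
    half-< v {m} h = ℤP.*-cancelˡ-<-nonNeg (+ 2)
      (subst (_< + 2 * m) (trans (sym (4hurwitz v)) (l (hurwitz v))) h)
      where
      l : ∀ h → + 4 * h ≡ + 2 * (+ 2 * h)
      l = solve-∀

  -- Signs have the form `1 − 2b` because half the difference of two signs, that is a difference of
  -- two values `b`, enters the coordinates of `q²`.
  sgn : ℤ → ℤ
  sgn b = + 1 - + 2 * b

  -- With `b` encoding the sign of `c` this is `|c|(n − |c|)`. It vanishes exactly at the ends of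
  -- the range, and `c² + (n − |c|)² = n²` minus twice it.
  defect : ℤ → ℤ → ℤ → ℤ
  defect n c b = sgn b * c * (n - sgn b * c)

  -- c₀ is reduced modulo 2n to c, or to c′ = c ∓ n modulo n.
  record Rounding (c₀ n : ℤ) : Set where
    field
      k c b : ℤ
      eq : c₀ ≡ c + k * (+ 2 * n)
      0≤δ : 0ℤ ≤ defect n c b
      c′² : (c - n * sgn b) * (c - n * sgn b) ≡ n * n - (+ 2 * defect n c b + c * c)
      extreme : defect n c b ≡ 0ℤ → ∃[ e ] c ≡ - (flag e * n)
    s δ c′ : ℤ
    s = sgn b
    δ = defect n c b
    c′ = c - n * s

  rounding : ∀ c₀ (m : ℕ) .{{_ : ℕ.NonZero m}} → Rounding c₀ (+ m)
  rounding c₀ m = record { k = k ; c = c ; b = b ; eq = eq ; 0≤δ = 0≤δ ; c′² = c′² ; extreme = extreme }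
    where
    n = + m
    d = divide-nearest c₀ m
    k = proj₁ d
    c = proj₁ (proj₂ d)
    eq : c₀ ≡ c + k * (+ 2 * n)
    eq = proj₁ (proj₂ (proj₂ d))
    lo : - n ≤ c
    lo = proj₁ (proj₂ (proj₂ (proj₂ d)))
    hi : c < n
    hi = proj₂ (proj₂ (proj₂ (proj₂ d)))
    b = proj₁ (sign-bit c)
    s = + 1 - + 2 * b
    0≤sc : 0ℤ ≤ s * c
    0≤sc = proj₁ (proj₂ (sign-bit c))
    ss≡1 : s * s ≡ + 1
    ss≡1 = proj₁ (proj₂ (proj₂ (sign-bit c)))
    0≤n-sc : 0ℤ ≤ n - s * c
    0≤n-sc with proj₂ (proj₂ (proj₂ (sign-bit c)))
    ... | inj₁ s≡1 = subst (λ s → 0ℤ ≤ n - s * c) (sym s≡1) (subst (λ z →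
      0ℤ ≤ n - z) (sym (ℤP.*-identityˡ c)) (gap (ℤP.<⇒≤ hi)))
    ... | inj₂ s≡-1 = subst (λ s → 0ℤ ≤ n - s * c) (sym s≡-1) (subst (0ℤ ≤_) (l n c) (gap lo))
      where
      l : ∀ n c → c - (- n) ≡ n - -[1+ 0 ] * c
      l = solve-∀
    δ = s * c * (n - s * c)
    0≤δ : 0ℤ ≤ δ
    0≤δ = 0≤* 0≤sc 0≤n-sc
    c′ = c - n * s
    c′² : c′ * c′ ≡ n * n - (+ 2 * δ + c * c)
    c′² = trans (l n s c) (trans (cong (λ z → z * (n * n) - (+ 2 * δ + (+ 2 * z - + 1) * (c * c))) ss≡1)
      (l′ n δ c))
      where
      l : ∀ n s c → (c - n * s) * (c - n * s)
        ≡ (s * s) * (n * n) - (+ 2 * (s * c * (n - s * c)) + (+ 2 * (s * s) - + 1) * (c * c))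
      l = solve-∀
      l′ : ∀ n δ c → + 1 * (n * n) - (+ 2 * δ + (+ 2 * + 1 - + 1) * (c * c)) ≡ n * n - (+ 2 * δ + c * c)
      l′ = solve-∀
    extreme : δ ≡ 0ℤ → ∃[ e ] c ≡ - (flag e * n)
    extreme δ≡0 with proj₂ (proj₂ (proj₂ (sign-bit c))) | 0or {s * c} δ≡0
    ... | inj₁ s≡1 | inj₁ z = false ,
      trans (trans (sym (ℤP.*-identityˡ c)) (trans (cong (_* c) (sym s≡1)) z)) (l n)
      where
      l : ∀ n → 0ℤ ≡ - (+ 0 * n)
      l = solve-∀
    ... | inj₂ s≡-1 | inj₁ z = false ,
      trans (l c) (trans (cong (λ s → - (s * c)) (sym s≡-1)) (trans (cong -_ z) (l′ n)))
      where
      l : ∀ c → c ≡ - (-[1+ 0 ] * c)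
      l = solve-∀
      l′ : ∀ n → - 0ℤ ≡ - (+ 0 * n)
      l′ = solve-∀
    -- Here `c = n`, which the half-open range of the remainder excludes; hence the only nonzero
    -- extreme value is `-n`.
    ... | inj₁ s≡1 | inj₂ z = ⊥-elim
      (ℤP.<-irrefl (sym (trans (ℤP.i-j≡0⇒i≡j n (s * c) z) (trans (cong (_* c) s≡1) (ℤP.*-identityˡ c)))) hi)
    ... | inj₂ s≡-1 | inj₂ z = true ,
      trans (l c n) (trans (cong (λ s → (n - s * c) + - (+ 1 * n)) (sym s≡-1))
      (trans (cong (_+ - (+ 1 * n)) z) (ℤP.+-identityˡ _)))
      where
      l : ∀ c n → c ≡ (n - -[1+ 0 ] * c) + - (+ 1 * n)
      l = solve-∀

  module _ (v : Quat ℤ) (n : ℤ) (q¹ : Quat ℤ) where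
    private
      r¹ = v -ᵛ n ⊛ q¹
      finish : ∀ (k : ℤ) h (u f : Quat ℤ) → n ≡ + 2 * k →
        doubled r¹ ≡ ⟪ - (q₁ f * n) , - (q₂ f * n) , - (q₃ f * n) , - (q₄ f * n) ⟫ →
        ⟪ + 0 , + 0 , + 0 , + 0 ⟫ -ᵛ + 2 ⊛ f -ᵛ + 2 ⊛ doubled u ≡ doubled (hole h) → Reduced v n
      finish k h u f n≡2k d pattern-eq = reduced (q¹ +ᵛ u) (r¹ -ᵛ n ⊛ u)
        (quat≡ (l (q₁ v) n (q₁ q¹) (q₁ u)) (l (q₂ v) n (q₂ q¹) (q₂ u)) (l (q₃ v) n (q₃ q¹) (q₃ u))
          (l (q₄ v) n (q₄ q¹) (q₄ u)))
        (inj₂ (k , h , n≡2k , doubled-injective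
          (trans (shifted u) (trans (cong (_-ᵛ n ⊛ doubled u) d) scaled))))
        where
        _+ᵛ_ : Quat ℤ → Quat ℤ → Quat ℤ
        ⟪ a , b , c , d ⟫ +ᵛ ⟪ a' , b' , c' , d' ⟫ = ⟪ a + a' , b + b' , c + c' , d + d' ⟫
        l : ∀ v n q u → (v - n * q) - n * u ≡ v - n * (q + u)
        l = solve-∀
        doubled-injective : ∀ {a b} → doubled a ≡ doubled b → a ≡ b
        doubled-injective {⟪ t , x , y , z ⟫} {⟪ t' , x' , y' , z' ⟫} e =
          quat≡ (half t t' (cong q₁ e)) (half x x' (cong q₂ e)) (half y y' (cong q₃ e)) (cong q₄ e)
          where
          half : ∀ t t' → + 2 * t + z ≡ + 2 * t' + z' → t ≡ t'
          half t t' h = ℤP.*-cancelˡ-≡ (+ 2) t t'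
            (trans (e₁ t z) (trans (cong₂ _-_ h (cong q₄ e)) (sym (e₁ t' z'))))
            where
            e₁ : ∀ t z → + 2 * t ≡ (+ 2 * t + z) - z
            e₁ = solve-∀
        shifted : ∀ u → doubled (r¹ -ᵛ n ⊛ u) ≡ doubled r¹ -ᵛ n ⊛ doubled u
        shifted u = quat≡ (l′ (q₁ r¹) (q₄ r¹) n (q₁ u) (q₄ u)) (l′ (q₂ r¹) (q₄ r¹) n (q₂ u) (q₄ u))
          (l′ (q₃ r¹) (q₄ r¹) n (q₃ u) (q₄ u)) refl
          where
          l′ : ∀ t z n a d → + 2 * (t - n * a) + (z - n * d) ≡ (+ 2 * t + z) - n * (+ 2 * a + d)
          l′ = solve-∀
        component : ∀ f U a → + 0 - + 2 * f - + 2 * U ≡ a → - (f * n) - n * U ≡ k * a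
        component f U a refl = trans (cong (λ n → - (f * n) - n * U) n≡2k) (e f U k)
          where
          e : ∀ f U k → - (f * (+ 2 * k)) - (+ 2 * k) * U ≡ k * (+ 0 - + 2 * f - + 2 * U)
          e = solve-∀
        distribute : ∀ k a d → k * (+ 2 * a + d) ≡ + 2 * (k * a) + k * d
        distribute = solve-∀
        H = hole h
        scaled : ⟪ - (q₁ f * n) , - (q₂ f * n) , - (q₃ f * n) , - (q₄ f * n) ⟫ -ᵛ n ⊛ doubled u
          ≡ doubled (k ⊛ H)
        scaled = quat≡
          (trans (component (q₁ f) (q₁ (doubled u)) (q₁ (doubled H)) (cong q₁ pattern-eq))
            (distribute k (q₁ H) (q₄ H)))
          (trans (component (q₂ f) (q₂ (doubled u)) (q₂ (doubled H)) (cong q₂ pattern-eq))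
            (distribute k (q₂ H) (q₄ H)))
          (trans (component (q₃ f) (q₃ (doubled u)) (q₃ (doubled H)) (cong q₃ pattern-eq))
            (distribute k (q₃ H) (q₄ H)))
          (component (q₄ f) (q₄ u) (q₄ H) (cong q₄ pattern-eq))
      halve : ∀ t z → - (+ 1 * n) ≡ + 2 * t + z → z ≡ - (+ 0 * n) → n ≡ + 2 * - t
      halve t z h h′ = trans (l n) (trans (cong -_ (trans h (cong (λ z → + 2 * t + z) h′))) (l′ t n))
        where
        l : ∀ n → n ≡ - - (+ 1 * n)
        l = solve-∀
        l′ : ∀ t n → - (+ 2 * t + - (+ 0 * n)) ≡ + 2 * - t
        l′ = solve-∀
      halve′ : ∀ t z → - (+ 0 * n) ≡ + 2 * t + z → z ≡ - (+ 1 * n) → n ≡ + 2 * t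
      halve′ t z h h′ = trans (l n) (trans (cong (_+ n) h) (trans (cong (λ z → + 2 * t + z + n) h′) (l′ t n)))
        where
        l : ∀ n → n ≡ - (+ 0 * n) + n
        l = solve-∀
        l′ : ∀ t n → + 2 * t + - (+ 1 * n) + n ≡ + 2 * t
        l′ = solve-∀

    -- Two of the doubled coordinates are `-n` and the others vanish. A pair without the last
    -- coordinate only needs its signs changed. Translation by the unit with all coordinates `−1/2`
    -- replaces a pair containing the last coordinate by the complementary pair. All other patterns
    -- contradict the count 2.
    extremal : ∀ e₁ e₂ e₃ e₄ → doubled r¹
      ≡ ⟪ - (flag e₁ * n) , - (flag e₂ * n) , - (flag e₃ * n) , - (flag e₄ * n) ⟫ →
      squares ⟪ flag e₁ , flag e₂ , flag e₃ , flag e₄ ⟫ ≡ + 2 → Reduced v n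
    extremal true true false false d _ =
      finish (- q₁ r¹) 1i ⟪ -[1+ 0 ] , -[1+ 0 ] , + 0 , + 0 ⟫ ⟪ + 1 , + 1 , + 0 , + 0 ⟫
        (halve (q₁ r¹) (q₄ r¹) (sym (cong q₁ d)) (cong q₄ d)) d refl
    extremal true false true false d _ =
      finish (- q₁ r¹) 1j ⟪ -[1+ 0 ] , + 0 , -[1+ 0 ] , + 0 ⟫ ⟪ + 1 , + 0 , + 1 , + 0 ⟫
        (halve (q₁ r¹) (q₄ r¹) (sym (cong q₁ d)) (cong q₄ d)) d refl
    extremal false true true false d _ =
      finish (- q₂ r¹) ij ⟪ + 0 , -[1+ 0 ] , -[1+ 0 ] , + 0 ⟫ ⟪ + 0 , + 1 , + 1 , + 0 ⟫
        (halve (q₂ r¹) (q₄ r¹) (sym (cong q₂ d)) (cong q₄ d)) d refl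
    extremal true false false true d _ =
      finish (q₂ r¹) ij ⟪ + 0 , + 0 , + 0 , -[1+ 0 ] ⟫ ⟪ + 1 , + 0 , + 0 , + 1 ⟫
        (halve′ (q₂ r¹) (q₄ r¹) (sym (cong q₂ d)) (cong q₄ d)) d refl
    extremal false true false true d _ =
      finish (q₁ r¹) 1j ⟪ + 0 , + 0 , + 0 , -[1+ 0 ] ⟫ ⟪ + 0 , + 1 , + 0 , + 1 ⟫
        (halve′ (q₁ r¹) (q₄ r¹) (sym (cong q₁ d)) (cong q₄ d)) d refl
    extremal false false true true d _ =
      finish (q₁ r¹) 1i ⟪ + 0 , + 0 , + 0 , -[1+ 0 ] ⟫ ⟪ + 0 , + 0 , + 1 , + 1 ⟫
        (halve′ (q₁ r¹) (q₄ r¹) (sym (cong q₁ d)) (cong q₄ d)) d refl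
    extremal false false false false _ ()
    extremal true false false false _ ()
    extremal false true false false _ ()
    extremal false false true false _ ()
    extremal false false false true _ ()
    extremal true true true false _ ()
    extremal true true false true _ ()
    extremal true false true true _ ()
    extremal false true true true _ ()
    extremal true true true true _ ()

  module _ (n vt vx vy vz : ℤ) (n≢0 : ¬ n ≡ 0ℤ)
    (T : Rounding (+ 2 * vt + vz) n) (X : Rounding (+ 2 * vx + vz) n)
    (Y : Rounding (+ 2 * vy + vz) n) (Z : Rounding vz n) where
    private
      module T = Rounding T
      module X = Rounding X
      module Y = Rounding Y
      module Z = Rounding Z
      v = ⟪ vt , vx , vy , vz ⟫
    -- Two candidates for the quotient: `q¹` is the nearest quaternion with integral coordinates on
    -- `1, i, j, k`, and `q²` the nearest one with all four coordinates in `1/2 + ℤ`. These are the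
    -- two cosets that make up the Hurwitz ring.
    q¹ q² r¹ r² : Quat ℤ
    q¹ = ⟪ T.k - Z.k , X.k - Z.k , Y.k - Z.k , + 2 * Z.k ⟫
    q² = ⟪ T.k - Z.k + (Z.b - T.b) , X.k - Z.k + (Z.b - X.b) , Y.k - Z.k + (Z.b - Y.b) , + 2 * Z.k + Z.s ⟫
    r¹ = v -ᵛ n ⊛ q¹
    r² = v -ᵛ n ⊛ q²
    remove : ∀ c₀ c k → c₀ ≡ c + k * (+ 2 * n) → c₀ - k * (+ 2 * n) ≡ c
    remove c₀ c k h = trans (cong (_- k * (+ 2 * n)) h) (l c (k * (+ 2 * n)))
      where
      l : ∀ c y → (c + y) - y ≡ c
      l = solve-∀
    side : ∀ vt vz n k kz → + 2 * (vt - n * (k - kz)) + (vz - n * (+ 2 * kz)) ≡ (+ 2 * vt + vz) - k * (+ 2 * n)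
    side = solve-∀
    last : ∀ vz n kz → vz - n * (+ 2 * kz) ≡ vz - kz * (+ 2 * n)
    last = solve-∀
    doubled-r¹ : doubled r¹ ≡ ⟪ T.c , X.c , Y.c , Z.c ⟫
    doubled-r¹ = quat≡
      (trans (side vt vz n T.k Z.k) (remove (+ 2 * vt + vz) T.c T.k T.eq))
        (trans (side vx vz n X.k Z.k) (remove (+ 2 * vx + vz) X.c X.k X.eq))
      (trans (side vy vz n Y.k Z.k) (remove (+ 2 * vy + vz) Y.c Y.k Y.eq))
        (trans (last vz n Z.k) (remove vz Z.c Z.k Z.eq))
    side² : ∀ vt vz n k kz b bz → + 2 * (vt - n * (k - kz + (bz - b)))
      + (vz - n * (+ 2 * kz + (+ 1 - + 2 * bz)))
      ≡ ((+ 2 * vt + vz) - k * (+ 2 * n)) - n * (+ 1 - + 2 * b)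
    side² = solve-∀
    last² : ∀ vz n kz s → vz - n * (+ 2 * kz + s) ≡ (vz - kz * (+ 2 * n)) - n * s
    last² = solve-∀
    doubled-r² : doubled r² ≡ ⟪ T.c′ , X.c′ , Y.c′ , Z.c′ ⟫
    doubled-r² = quat≡
      (trans (side² vt vz n T.k Z.k T.b Z.b) (cong (_- n * T.s) (remove (+ 2 * vt + vz) T.c T.k T.eq)))
      (trans (side² vx vz n X.k Z.k X.b Z.b) (cong (_- n * X.s) (remove (+ 2 * vx + vz) X.c X.k X.eq)))
      (trans (side² vy vz n Y.k Z.k Y.b Z.b) (cong (_- n * Y.s) (remove (+ 2 * vy + vz) Y.c Y.k Y.eq)))
      (trans (last² vz n Z.k Z.s) (cong (_- n * Z.s) (remove vz Z.c Z.k Z.eq)))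
    S S′ Δ nn : ℤ
    nn = n * n
    S = squares ⟪ T.c , X.c , Y.c , Z.c ⟫
    S′ = squares ⟪ T.c′ , X.c′ , Y.c′ , Z.c′ ⟫
    Δ = T.δ + X.δ + Y.δ + Z.δ
    -- In each coordinate the two candidates leave `|c|` and `n − |c|`, whose squares add up to at
    -- most `n²`. So one of `S` and `S′` is at most `2n²`, which is the bound `n²/2` for the norm.
    S+S′ : S + S′ ≡ + 4 * nn - + 2 * Δ
    S+S′ = trans (cong (λ z → S + z) (cong₂ _+_ (cong₂ _+_ (cong₂ _+_ T.c′² X.c′²) Y.c′²) Z.c′²))
      (l nn T.δ X.δ Y.δ Z.δ (T.c * T.c) (X.c * X.c) (Y.c * Y.c) (Z.c * Z.c))
      where
      l : ∀ m a b c d a' b' c' d' → (a' + b' + c' + d')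
        + ((m - (+ 2 * a + a')) + (m - (+ 2 * b + b')) + (m - (+ 2 * c + c')) + (m - (+ 2 * d + d')))
        ≡ + 4 * m - + 2 * (a + b + c + d)
      l = solve-∀
    -- If neither candidate is strictly below `2n²`, the nonnegative defects must all vanish. Then
    -- every `c` is 0 or `-n`, and `S = 2n²` says that exactly two of them are `-n`.
    module Extremal (S≥ : + 2 * nn ≤ S) (S′≥ : + 2 * nn ≤ S′) where
      Δ≤0 : Δ ≤ 0ℤ
      Δ≤0 = ℤP.*-cancelˡ-≤-pos Δ 0ℤ (+ 2) (≤-by ((S - + 2 * nn) + (S′ - + 2 * nn)) (l Δ S S′ nn S+S′)
        (0≤+ (gap S≥) (gap S′≥)))
        where
        l : ∀ Δ S S′ m → S + S′ ≡ + 4 * m - + 2 * Δ → + 2 * 0ℤ ≡ + 2 * Δ + ((S - + 2 * m) + (S′ - + 2 * m))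
        l Δ S S′ m h = trans (e m Δ) (trans (cong (λ z → + 2 * Δ + (z - + 4 * m)) (sym h)) (e′ Δ S S′ m))
          where
          e : ∀ m Δ → + 2 * 0ℤ ≡ + 2 * Δ + ((+ 4 * m - + 2 * Δ) - + 4 * m)
          e = solve-∀
          e′ : ∀ Δ S S′ m → + 2 * Δ + ((S + S′) - + 4 * m) ≡ + 2 * Δ + ((S - + 2 * m) + (S′ - + 2 * m))
          e′ = solve-∀
      z₁ = zero-of-sum (0≤+ (0≤+ T.0≤δ X.0≤δ) Y.0≤δ) Z.0≤δ Δ≤0
      z₂ = zero-of-sum (0≤+ T.0≤δ X.0≤δ) Y.0≤δ (ℤP.≤-reflexive (proj₁ z₁))
      z₃ = zero-of-sum T.0≤δ X.0≤δ (ℤP.≤-reflexive (proj₁ z₂))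
      S≤ : S ≤ + 2 * nn
      S≤ = ≤-by ((S′ - + 2 * nn) + + 2 * Δ) (l Δ S S′ nn S+S′)
        (0≤+ (gap S′≥) (0≤* {+ 2} (ℤ.+≤+ ℕ.z≤n) (0≤+ (0≤+ (0≤+ T.0≤δ X.0≤δ) Y.0≤δ) Z.0≤δ)))
        where
        l : ∀ Δ S S′ m → S + S′ ≡ + 4 * m - + 2 * Δ → + 2 * m ≡ S + ((S′ - + 2 * m) + + 2 * Δ)
        l Δ S S′ m h = trans (e m Δ) (trans (cong (λ z → z - + 2 * m + + 2 * Δ) (sym h)) (e′ Δ S S′ m))
          where
          e : ∀ m Δ → + 2 * m ≡ (+ 4 * m - + 2 * Δ) - + 2 * m + + 2 * Δ
          e = solve-∀
          e′ : ∀ Δ S S′ m → (S + S′) - + 2 * m + + 2 * Δ ≡ S + ((S′ - + 2 * m) + + 2 * Δ)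
          e′ = solve-∀
      S≡ : S ≡ + 2 * nn
      S≡ = ℤP.≤-antisym S≤ S≥
      fT = T.extreme (proj₁ z₃)
      fX = X.extreme (proj₂ z₃)
      fY = Y.extreme (proj₂ z₂)
      fZ = Z.extreme (proj₂ z₁)
      instance
        nn≢0 : ℤ.NonZero nn
        nn≢0 = ℤ.≢-nonZero (λ e → n≢0 (n0 (0or {n} e)))
          where
          n0 : ∀ {a : ℤ} → a ≡ 0ℤ ⊎ a ≡ 0ℤ → a ≡ 0ℤ
          n0 (inj₁ z) = z
          n0 (inj₂ z) = z
      count : squares ⟪ flag (proj₁ fT) , flag (proj₁ fX) , flag (proj₁ fY) , flag (proj₁ fZ) ⟫ ≡ + 2
      count = ℤP.*-cancelʳ-≡ _ (+ 2) nn
        (trans (sym (trans (cong squares (quat≡ (proj₂ fT) (proj₂ fX) (proj₂ fY) (proj₂ fZ)))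
          (l n (flag (proj₁ fT)) (flag (proj₁ fX)) (flag (proj₁ fY)) (flag (proj₁ fZ))))) S≡)
        where
        l : ∀ n a b c d → - (a * n) * - (a * n) + - (b * n) * - (b * n) + - (c * n) * - (c * n)
          + - (d * n) * - (d * n)
          ≡ (a * a + b * b + c * c + d * d) * (n * n)
        l = solve-∀
      conclusion : Reduced v n
      conclusion = extremal v n q¹ (proj₁ fT) (proj₁ fX) (proj₁ fY) (proj₁ fZ)
        (trans doubled-r¹ (quat≡ (proj₂ fT) (proj₂ fX) (proj₂ fY) (proj₂ fZ))) count

    reduce-with : Reduced v n
    reduce-with with squares (doubled r¹) ℤ.<? + 2 * nn | squares (doubled r²) ℤ.<? + 2 * nn
    ... | yes lt | _ = reduced q¹ r¹ refl (inj₁ (half-< r¹ lt))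
    ... | no _ | yes lt = reduced q² r² refl (inj₁ (half-< r² lt))
    ... | no ¬lt | no ¬lt′ = Extremal.conclusion (subst (λ d → + 2 * nn ≤ squares d) doubled-r¹ (ℤP.≮⇒≥ ¬lt))
                                                 (subst (λ d → + 2 * nn ≤ squares d) doubled-r² (ℤP.≮⇒≥ ¬lt′))

  hurwitz-reduce : ∀ v (m : ℕ) .{{_ : ℕ.NonZero m}} → Reduced v (+ m)
  hurwitz-reduce ⟪ vt , vx , vy , vz ⟫ m =
    reduce-with (+ m) vt vx vy vz (λ e → ℕ.≢-nonZero⁻¹ m (ℤP.+-injective e))
    (rounding _ m) (rounding _ m) (rounding _ m) (rounding _ m)

-- The maximal order is norm-Euclidean and has 48 units of norm 1.

module Order where
  open import Defs hiding (H; K)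
  open OKRing hiding (ring)
  open Solver
  open Quaternion
  open ZArith
  open OKArith hiding (divide)
  open Metric
  open Reduction using (_-ᵛ_; _⊛_; Hole; 1i; 1j; ij; hole; Reduced; reduced; hurwitz-reduce)
  open Counting
  open import Data.Integer as ℤ using (ℤ; +_; -[1+_]; 0ℤ; -_; _*_; _+_; _-_; _<_; _≤_; _≟_)
  import Data.Integer.Properties as ℤP
  open import Data.Integer.Tactic.RingSolver using (solve-∀)
  open import Data.Nat as ℕ using (ℕ; suc)
  import Data.Nat.Properties as ℕP
  open import Data.List using (List; []; _∷_; filter; length; cartesianProductWith)
  open import Data.List.Membership.Propositional using (_∈_)
  open import Data.List.Membership.Propositional.Properties using (∈-filter⁺; ∈-filter⁻;
    ∈-cartesianProductWith⁺)
  open import Data.List.Relation.Unary.Any using (here; there)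
  open import Data.List.Relation.Unary.Unique.Propositional using (Unique)
  open import Data.List.Relation.Unary.Unique.Propositional.Properties using (filter⁺; cartesianProductWith⁺)
  import Data.List.Relation.Unary.Unique.DecPropositional as UniqueDec
  open import Data.Product using (∃-syntax; _×_; _,_; proj₁; proj₂)
  import Data.Sum
  open import Data.Sum using (_⊎_; inj₁; inj₂; [_,_]′)
  open import Function.Bundles using (_⇔_; mk⇔)
  open import Relation.Binary.PropositionalEquality hiding ([_])
  open import Relation.Nullary using (¬_; Dec)
  open import Relation.Nullary.Decidable using (map′; _×-dec_; from-yes)
  open import Data.Empty using (⊥; ⊥-elim)

  _≟ᵠ_ : ∀ (x y : 𝒪) → Dec (x ≡ y)
  ⟪ a , b , c , d ⟫ ≟ᵠ ⟪ a' , b' , c' , d' ⟫ =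
    map′ (λ (p , q , r , s) → quat≡ p q r s) (λ { refl → refl , refl , refl , refl })
    ((a ≟ᴼ a') ×-dec (b ≟ᴼ b') ×-dec (c ≟ᴼ c') ×-dec (d ≟ᴼ d'))

  0ᵛ : Quat ℤ
  0ᵛ = ⟪ + 0 , + 0 , + 0 , + 0 ⟫

  part₀-fromParts : ∀ p s → part₀ (fromParts p s) ≡ p
  part₀-fromParts ⟪ a , b , c , d ⟫ s = quat≡ (l a b c) refl refl refl
    where
    l : ∀ a b c → (a - b - c) + b + c ≡ a
    l = solve-∀

  part₁-fromParts : ∀ p s → part₁ (fromParts p s) ≡ s
  part₁-fromParts p ⟪ a , b , c , d ⟫ = quat≡ (l₁ a b c d) (l₂ b c d) (l₃ c) (l₄ c d)
    where
    l₁ : ∀ a b c d → - (b + c + d) + (a + b + c + d) ≡ a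
    l₁ = solve-∀
    l₂ : ∀ b c d → - (- (b + c + d) + (d + + 2 * c) + - c) ≡ b
    l₂ = solve-∀
    l₃ : ∀ c → - - c ≡ c
    l₃ = solve-∀
    l₄ : ∀ c d → (d + + 2 * c) + + 2 * - c ≡ d
    l₄ = solve-∀

  private
    -ᴼ-int : ∀ x n y → x -ᴼ int n *ᴼ y ≡ mkO (re x - n * re y) (im x - n * im y)
    -ᴼ-int x n y = cong (λ z → x -ᴼ z) (int-* n y)

    lin : ∀ x n y → x -ᵠ int n • y ≡ ⟪ mkO (re (q₁ x) - n * re (q₁ y)) (im (q₁ x) - n * im (q₁ y))
                                     , mkO (re (q₂ x) - n * re (q₂ y)) (im (q₂ x) - n * im (q₂ y))
                                     , mkO (re (q₃ x) - n * re (q₃ y)) (im (q₃ x) - n * im (q₃ y))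
                                     , mkO (re (q₄ x) - n * re (q₄ y)) (im (q₄ x) - n * im (q₄ y)) ⟫
    lin x n y = quat≡ (-ᴼ-int (q₁ x) n (q₁ y)) (-ᴼ-int (q₂ x) n (q₂ y)) (-ᴼ-int (q₃ x) n (q₃ y))
      (-ᴼ-int (q₄ x) n (q₄ y))

  part₀-lin : ∀ x n y → part₀ (x -ᵠ int n • y) ≡ part₀ x -ᵛ n ⊛ part₀ y
  part₀-lin x n y = trans (cong part₀ (lin x n y))
    (quat≡ (l n (re (q₁ x)) (im (q₂ x)) (im (q₃ x)) (re (q₁ y)) (im (q₂ y)) (im (q₃ y))) refl refl refl)
    where
    l : ∀ n a b c a' b' c' → (a - n * a') + (b - n * b') + (c - n * c') ≡ (a + b + c) - n * (a' + b' + c')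
    l = solve-∀

  part₁-lin : ∀ x n y → part₁ (x -ᵠ int n • y) ≡ part₁ x -ᵛ n ⊛ part₁ y
  part₁-lin x n y = trans (cong part₁ (lin x n y)) (quat≡
    (l₁ n (im (q₁ x)) (re (q₂ x)) (im (q₁ y)) (re (q₂ y)))
    (l₂ n (im (q₁ x)) (re (q₃ x)) (im (q₄ x)) (im (q₁ y)) (re (q₃ y)) (im (q₄ y)))
    (l₃ n (im (q₄ x)) (im (q₄ y))) (l₄ n (re (q₃ x)) (im (q₄ x)) (re (q₃ y)) (im (q₄ y))))
    where
    l₁ : ∀ n a b a' b' → (a - n * a') + (b - n * b') ≡ (a + b) - n * (a' + b')
    l₁ = solve-∀
    l₂ : ∀ n a b c a' b' c' → - ((a - n * a') + (b - n * b') + (c - n * c'))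
      ≡ - (a + b + c) - n * - (a' + b' + c')
    l₂ = solve-∀
    l₃ : ∀ n a a' → - (a - n * a') ≡ - a - n * - a'
    l₃ = solve-∀
    l₄ : ∀ n a b a' b' → (a - n * a') + + 2 * (b - n * b') ≡ (a + + 2 * b) - n * (a' + + 2 * b')
    l₄ = solve-∀

  private
    parts-inj : ∀ {x y} → part₀ x ≡ part₀ y → part₁ x ≡ part₁ y → x ≡ y
    parts-inj {x} {y} e e' = trans (sym (fromParts-parts x)) (trans (cong₂ fromParts e e') (fromParts-parts y))

    N̂-bound : ∀ x {m} → 0ℤ ≤ m → re (N x) < m → N̂ (N x) < m * m
    N̂-bound x {m} 0≤m lt = <-by ((m - r) * (m + r) + + 2 * (s * s)) (l m r s)
      (ℤP.+-mono-<-≤ (0<* (gap< lt) (ℤP.+-mono-<-≤ (ℤP.≤-<-trans (0≤re-N x) lt) (0≤re-N x)))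
        (0≤* {+ 2} (ℤ.+≤+ ℕ.z≤n) (0≤² s)))
      where
      r = re (N x)
      s = im (N x)
      l : ∀ m r s → m * m ≡ (r * r - + 2 * (s * s)) + ((m - r) * (m + r) + + 2 * (s * s))
      l = solve-∀

    hurwitz-hole : ∀ k h → + 2 * hurwitz (k ⊛ hole h) ≡ (+ 2 * k) * (+ 2 * k)
    hurwitz-hole k h = trans (cong (+ 2 *_)
      (trans (scale k (q₁ (hole h)) (q₂ (hole h)) (q₃ (hole h)) (q₄ (hole h))) (cong (k * k *_) (two h)))) (l k)
      where
      scale : ∀ k a b c d → k * a * (k * a) + k * b * (k * b) + k * c * (k * c) + k * d * (k * d)
        + k * d * (k * a + k * b + k * c)
        ≡ k * k * (a * a + b * b + c * c + d * d + d * (a + b + c))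
      scale = solve-∀
      two : ∀ h → hurwitz (hole h) ≡ + 2
      two 1i = refl
      two 1j = refl
      two ij = refl
      l : ∀ k → + 2 * (k * k * + 2) ≡ (+ 2 * k) * (+ 2 * k)
      l = solve-∀

    -- Moving between the representatives of a pair of deep holes makes the irrational part of the
    -- reduced norm nonzero.
    adjust : Hole → Hole → 𝒪
    adjust 1i ij = fromParts 0ᵛ ⟪ + 0 , + 0 , + 0 , + 1 ⟫
    adjust 1j 1i = fromParts 0ᵛ ⟪ + 0 , + 0 , + 0 , + 1 ⟫
    adjust 1j ij = fromParts 0ᵛ ⟪ + 0 , + 0 , + 0 , + 1 ⟫
    adjust _ _ = 0ᵠ

    corner : Hole → Hole → 𝒪
    corner h h' = fromParts (hole h) (hole h') -ᵠ int (+ 2) • adjust h h'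

    opaque
      unfolding N
      corner-norm : ∀ h h' → N̂ (N (corner h h')) ≡ + 8
      corner-norm 1i 1i = refl
      corner-norm 1i 1j = refl
      corner-norm 1i ij = refl
      corner-norm 1j 1i = refl
      corner-norm 1j 1j = refl
      corner-norm 1j ij = refl
      corner-norm ij 1i = refl
      corner-norm ij 1j = refl
      corner-norm ij ij = refl

    two-mul : ∀ k k' (n : ℤ) → n ≡ + 2 * k → n ≡ + 2 * k' → k ≡ k'
    two-mul k k' n e e' = ℤP.*-cancelˡ-≡ (+ 2) k k' (trans (sym e) e')

    0<n : ∀ (m : ℕ) .{{_ : ℕ.NonZero m}} → 0ℤ < + m
    0<n (suc m) = ℤ.+<+ (ℕ.s≤s ℕ.z≤n)

  -- After the adjustment the remainder is `k` times one of nine fixed elements, whose reduced norms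
  -- all have field norm 8; and `8k⁴` is smaller than `n⁴ = 16k⁴`.
  hole-hole : ∀ y Q n k h h' → 0ℤ < n → n ≡ + 2 * k → part₀ (y -ᵠ int n • Q) ≡ k ⊛ hole h →
    part₁ (y -ᵠ int n • Q) ≡ k ⊛ hole h' →
    ∃[ q ] N̂ (N (y -ᵠ int n • q)) < (n * n) * (n * n)
  hole-hole y Q n k h h' 0<n e e₀ e₁ = Q +ᵠ A , subst (_< (n * n) * (n * n)) (sym norm-eq) final
    where
    R = y -ᵠ int n • Q
    A = adjust h h'
    split : ∀ y n Q A → y -ᵠ n • (Q +ᵠ A) ≡ (y -ᵠ n • Q) -ᵠ n • A
    split y n Q A = quat≡ (l (q₁ y) n (q₁ Q) (q₁ A)) (l (q₂ y) n (q₂ Q) (q₂ A)) (l (q₃ y) n (q₃ Q) (q₃ A))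
      (l (q₄ y) n (q₄ Q) (q₄ A))
      where
      l : ∀ y n q a → y -ᴼ n *ᴼ (q +ᴼ a) ≡ y -ᴼ n *ᴼ q -ᴼ n *ᴼ a
      l y n q a = prove 4 (λ y n q a → y ⊕ (⊝ (n ⊗ (q ⊕ a))) ≐ (y ⊕ (⊝ (n ⊗ q))) ⊕ (⊝ (n ⊗ a))) refl
        (y ∷ n ∷ q ∷ a ∷ [])
    scaled-part : ∀ h (v : Quat ℤ) → k ⊛ h -ᵛ n ⊛ v ≡ k ⊛ (h -ᵛ + 2 ⊛ v)
    scaled-part h v = quat≡ (c (q₁ h) (q₁ v)) (c (q₂ h) (q₂ v)) (c (q₃ h) (q₃ v)) (c (q₄ h) (q₄ v))
      where
      l : ∀ k h v → k * h - (+ 2 * k) * v ≡ k * (h - + 2 * v)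
      l = solve-∀
      c : ∀ h v → k * h - n * v ≡ k * (h - + 2 * v)
      c h v = trans (cong (λ n → k * h - n * v) e) (l k h v)
    part-• : ∀ k x → part₀ (int k • x) ≡ k ⊛ part₀ x × part₁ (int k • x) ≡ k ⊛ part₁ x
    part-• k x = trans (cong part₀ i) (quat≡ (l₃ k (re (q₁ x)) (im (q₂ x)) (im (q₃ x))) refl refl refl)
      , trans (cong part₁ i) (quat≡ (l₂ k (im (q₁ x)) (re (q₂ x)))
        (l₃′ k (im (q₁ x)) (re (q₃ x)) (im (q₄ x))) (l₁ k (im (q₄ x))) (l₂′ k (re (q₃ x)) (im (q₄ x))))
      where
      i : int k • x ≡ ⟪ mkO (k * re (q₁ x)) (k * im (q₁ x)) , mkO (k * re (q₂ x)) (k * im (q₂ x)) ,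
        mkO (k * re (q₃ x)) (k * im (q₃ x)) , mkO (k * re (q₄ x)) (k * im (q₄ x)) ⟫
      i = quat≡ (int-* k (q₁ x)) (int-* k (q₂ x)) (int-* k (q₃ x)) (int-* k (q₄ x))
      l₁ : ∀ k a → - (k * a) ≡ k * - a
      l₁ = solve-∀
      l₂ : ∀ k a b → k * a + k * b ≡ k * (a + b)
      l₂ = solve-∀
      l₂′ : ∀ k a b → k * a + + 2 * (k * b) ≡ k * (a + + 2 * b)
      l₂′ = solve-∀
      l₃ : ∀ k a b c → k * a + k * b + k * c ≡ k * (a + b + c)
      l₃ = solve-∀
      l₃′ : ∀ k a b c → - (k * a + k * b + k * c) ≡ k * - (a + b + c)
      l₃′ = solve-∀
    corner₀ : part₀ (corner h h') ≡ hole h -ᵛ + 2 ⊛ part₀ A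
    corner₀ = trans (part₀-lin (fromParts (hole h) (hole h')) (+ 2) A)
      (cong (_-ᵛ + 2 ⊛ part₀ A) (part₀-fromParts (hole h) (hole h')))
    corner₁ : part₁ (corner h h') ≡ hole h' -ᵛ + 2 ⊛ part₁ A
    corner₁ = trans (part₁-lin (fromParts (hole h) (hole h')) (+ 2) A)
      (cong (_-ᵛ + 2 ⊛ part₁ A) (part₁-fromParts (hole h) (hole h')))
    shape : y -ᵠ int n • (Q +ᵠ A) ≡ int k • corner h h'
    shape = trans (split y (int n) Q A) (parts-inj
      (trans (part₀-lin R n A) (trans (cong (_-ᵛ n ⊛ part₀ A) e₀)
        (trans (scaled-part (hole h) (part₀ A))
        (trans (cong (k ⊛_) (sym corner₀)) (sym (proj₁ (part-• k (corner h h'))))))))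
      (trans (part₁-lin R n A) (trans (cong (_-ᵛ n ⊛ part₁ A) e₁)
        (trans (scaled-part (hole h') (part₁ A))
        (trans (cong (k ⊛_) (sym corner₁)) (sym (proj₂ (part-• k (corner h h')))))))))
    N̂-int : ∀ k → N̂ (int k) ≡ k * k
    N̂-int k = l k
      where
      l : ∀ k → k * k - + 2 * (+ 0 * + 0) ≡ k * k
      l = solve-∀
    norm-eq : N̂ (N (y -ᵠ int n • (Q +ᵠ A))) ≡ (k * k) * (k * k) * + 8
    norm-eq = trans (cong (λ z → N̂ (N z)) shape)
      (trans (cong N̂ (N-• (int k) (corner h h'))) (trans (N̂-* (int k *ᴼ int k) (N (corner h h')))
      (cong₂ _*_ (trans (N̂-* (int k) (int k)) (cong₂ _*_ (N̂-int k) (N̂-int k))) (corner-norm h h'))))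
    final : (k * k) * (k * k) * + 8 < (n * n) * (n * n)
    final = subst (λ n → (k * k) * (k * k) * + 8 < (n * n) * (n * n)) (sym e)
      (<-by ((k * k) * (k * k) * + 8) (l k) (0<* (0<* 0<kk 0<kk) (ℤ.+<+ (ℕ.s≤s ℕ.z≤n))))
      where
      l : ∀ k → (+ 2 * k) * (+ 2 * k) * ((+ 2 * k) * (+ 2 * k))
        ≡ (k * k) * (k * k) * + 8 + (k * k) * (k * k) * + 8
      l = solve-∀
      0<k : 0ℤ < k
      0<k = ℤP.*-cancelˡ-<-nonNeg (+ 2) (subst (0ℤ <_) e 0<n)
      0<kk = 0<* 0<k 0<k

  -- The field norm of `N R` is at most the square of its rational part, and that part is the sum of
  -- two Hurwitz norms, each at most `n²/2`. The inequality can fail to be strict only if both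
  -- remainders are deep holes.
  combine : ∀ y (m : ℕ) .{{_ : ℕ.NonZero m}} → Reduced (part₀ y) (+ m) → Reduced (part₁ y) (+ m) →
    ∃[ q ] N̂ (N (y -ᵠ int (+ m) • q)) < (+ m * + m) * (+ m * + m)
  combine y m (reduced q r er b) (reduced q' r' er' b') = go b b'
    where
    n = + m
    Q = fromParts q q'
    R = y -ᵠ int n • Q
    e₀ : part₀ R ≡ r
    e₀ = trans (part₀-lin y n Q) (trans (cong (λ z → part₀ y -ᵛ n ⊛ z) (part₀-fromParts q q')) (sym er))
    e₁ : part₁ R ≡ r'
    e₁ = trans (part₁-lin y n Q) (trans (cong (λ z → part₁ y -ᵛ n ⊛ z) (part₁-fromParts q q')) (sym er'))
    reR : re (N R) ≡ hurwitz r + hurwitz r'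
    reR = trans (re-N R) (cong₂ _+_ (cong hurwitz e₀) (cong hurwitz e₁))
    le : ∀ {r} → (+ 2 * hurwitz r < n * n) ⊎ (∃[ k ] ∃[ h ] (n ≡ + 2 * k × r ≡ k ⊛ hole h)) →
      + 2 * hurwitz r ≤ n * n
    le (inj₁ lt) = ℤP.<⇒≤ lt
    le (inj₂ (k , h , e , refl)) = ℤP.≤-reflexive (trans (hurwitz-hole k h) (cong₂ _*_ (sym e) (sym e)))
    double : ∀ a b → + 2 * a + + 2 * b ≡ + 2 * (a + b)
    double = solve-∀
    double′ : ∀ a → a + a ≡ + 2 * a
    double′ = solve-∀
    small : + 2 * hurwitz r + + 2 * hurwitz r' < n * n + n * n →
      ∃[ q ] N̂ (N (y -ᵠ int n • q)) < (n * n) * (n * n)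
    small h = Q , N̂-bound R (0≤² n) (ℤP.*-cancelˡ-<-nonNeg (+ 2)
      (subst₂ _<_ (trans (double (hurwitz r) (hurwitz r')) (cong (+ 2 *_) (sym reR))) (double′ (n * n)) h))
    go : (+ 2 * hurwitz r < n * n) ⊎ (∃[ k ] ∃[ h ] (n ≡ + 2 * k × r ≡ k ⊛ hole h)) →
         (+ 2 * hurwitz r' < n * n) ⊎ (∃[ k ] ∃[ h ] (n ≡ + 2 * k × r' ≡ k ⊛ hole h)) →
           ∃[ q ] N̂ (N (y -ᵠ int n • q)) < (n * n) * (n * n)
    go (inj₁ lt) b' = small (ℤP.+-mono-<-≤ lt (le b'))
    go (inj₂ b) (inj₁ lt) = small (ℤP.+-mono-≤-< (le (inj₂ b)) lt)
    go (inj₂ (k , h , e , eh)) (inj₂ (k' , h' , e' , eh')) =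
      hole-hole y Q n k h h' (0<n m) e (trans e₀ eh)
        (trans e₁ (trans eh' (cong (_⊛ hole h') (two-mul k' k n e' e))))

  nearest : ∀ y (m : ℕ) .{{_ : ℕ.NonZero m}} → ∃[ q ] N̂ (N (y -ᵠ int (+ m) • q)) < (+ m * + m) * (+ m * + m)
  nearest y m = combine y m (hurwitz-reduce (part₀ y) m) (hurwitz-reduce (part₁ y) m)

  hurwitz≡0 : ∀ v → hurwitz v ≡ 0ℤ → v ≡ 0ᵛ
  hurwitz≡0 v@(⟪ t , x , y , z ⟫) h = quat≡ (half t T≡0) (half x X≡0) (half y Y≡0) z≡0
    where
    nonpos : squares (doubled v) ≤ 0ℤ
    nonpos = ℤP.≤-reflexive (trans (sym (4hurwitz v)) (cong (+ 4 *_) h))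
    sq0 : ∀ a → a * a ≡ 0ℤ → a ≡ 0ℤ
    sq0 a e = [ (λ z → z) , (λ z → z) ]′ (ℤP.i*j≡0⇒i≡0∨j≡0 a e)
    split : ∀ {a b} → 0ℤ ≤ a → 0ℤ ≤ b → a + b ≤ 0ℤ → a ≤ 0ℤ × b ≡ 0ℤ
    split {a} {b} 0≤a 0≤b h = ℤP.≤-trans (≤-by b refl 0≤b) h ,
      ℤP.≤-antisym (ℤP.≤-trans (≤-by a (ℤP.+-comm a b) 0≤a) h) 0≤b
    T = + 2 * t + z
    X = + 2 * x + z
    Y = + 2 * y + z
    d₄ = split (0≤+ (0≤+ (0≤² T) (0≤² X)) (0≤² Y)) (0≤² z) nonpos
    d₃ = split (0≤+ (0≤² T) (0≤² X)) (0≤² Y) (proj₁ d₄)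
    d₂ = split (0≤² T) (0≤² X) (proj₁ d₃)
    T≡0 : T ≡ 0ℤ
    T≡0 = sq0 T (ℤP.≤-antisym (proj₁ d₂) (0≤² T))
    X≡0 : X ≡ 0ℤ
    X≡0 = sq0 X (proj₂ d₂)
    Y≡0 : Y ≡ 0ℤ
    Y≡0 = sq0 Y (proj₂ d₃)
    z≡0 = sq0 z (proj₂ d₄)
    half : ∀ t → + 2 * t + z ≡ 0ℤ → t ≡ 0ℤ
    half t e = ℤP.*-cancelˡ-≡ (+ 2) t 0ℤ
      (trans (sym (trans (cong (λ z → + 2 * t + z) z≡0) (ℤP.+-identityʳ _))) e)

  N≡0⇒≡0 : ∀ x → N x ≡ 0ᴼ → x ≡ 0ᵠ
  N≡0⇒≡0 x h = parts-inj {x} {0ᵠ} (hurwitz≡0 (part₀ x) p≡0) (hurwitz≡0 (part₁ x) s≡0)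
    where
    sum≡0 : hurwitz (part₀ x) + hurwitz (part₁ x) ≡ 0ℤ
    sum≡0 = trans (sym (re-N x)) (cong re h)
    p≡0 : hurwitz (part₀ x) ≡ 0ℤ
    p≡0 = ℤP.≤-antisym (ℤP.≤-trans (≤-by (hurwitz (part₁ x)) refl (0≤hurwitz (part₁ x)))
      (ℤP.≤-reflexive sum≡0)) (0≤hurwitz (part₀ x))
    s≡0 : hurwitz (part₁ x) ≡ 0ℤ
    s≡0 = trans (sym (trans (cong (_+ hurwitz (part₁ x)) p≡0) (ℤP.+-identityˡ _))) sum≡0

  size : 𝒪 → ℕ
  size x = Nm (N x)

  N̂-N≡size : ∀ x → N̂ (N x) ≡ + size x
  N̂-N≡size x = sym (ℤP.0≤i⇒+∣i∣≡i (0≤N̂-N x))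

  -- Multiplication on the left by the conjugate of `b` and by the conjugate of `N b` turns the
  -- divisor `b` into the integer `m`. The same factor multiplies the field norm of the reduced norm
  -- by `m³`, which is cancelled from the bound `m⁴`.
  divide-by : ∀ a b q m .{{_ : ℕ.NonZero m}} → N̂ (N b) ≡ + m →
    N̂ (N (conjᴼ (N b) • (conj b · a) -ᵠ int (+ m) • q)) < (+ m * + m) * (+ m * + m) →
      size (a +ᵠ negᵠ (b · q)) ℕ.< m
  divide-by a b q m sizeb near =
    ℤP.drop‿+<+ (ℤP.*-cancelˡ-<-nonNeg (n * n * n) {{ℤ.nonNegative (0≤* (0≤² n) (ℤ.+≤+ ℕ.z≤n))}}
    (subst₂ _<_ norm-eq (l n) near))
    where
    n = + m
    ν = N b
    ν′ = conjᴼ ν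
    y = ν′ • (conj b · a)
    z = a +ᵠ negᵠ (b · q)
    ·-sub : ∀ c a b → c · (a +ᵠ negᵠ b) ≡ c · a +ᵠ negᵠ (c · b)
    ·-sub c a b = trans (·-distribˡ c a (negᵠ b)) (cong (c · a +ᵠ_) (sym (-‿distribʳ-* c b)))
      where open import Algebra.Properties.Ring 𝒪R using (-‿distribʳ-*)
    shape : y -ᵠ int n • q ≡ ν′ • (conj b · z)
    shape = sym (trans (cong (ν′ •_) (·-sub (conj b) a (b · q)))
      (trans (•-distribˡ ν′ (conj b · a) (negᵠ (conj b · (b · q)))) (cong (y +ᵠ_) tail)))
      where
      neg• : ∀ k x → k • negᵠ x ≡ negᵠ (k • x)
      neg• k x = quat≡ (l′ (q₁ x)) (l′ (q₂ x)) (l′ (q₃ x)) (l′ (q₄ x))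
        where
        l′ : ∀ a → k *ᴼ -ᴼ a ≡ -ᴼ (k *ᴼ a)
        l′ a = prove 2 (λ k a → k ⊗ (⊝ a) ≐ ⊝ (k ⊗ a)) refl (k ∷ a ∷ [])
      tail : ν′ • negᵠ (conj b · (b · q)) ≡ negᵠ (int n • q)
      tail = trans (neg• ν′ _) (cong negᵠ
        (trans (cong (ν′ •_) (trans (sym (·-assoc (conj b) b q))
        (trans (cong (_· q) (conj-· b)) (trans (•-·-assoc ν 1ᵠ q) (cong (ν •_) (·-identityˡ q))))))
        (trans (•-assoc ν′ ν q) (cong (_• q) (trans (conjᴼ-* ν) (cong int sizeb))))))
    norm-eq : N̂ (N (y -ᵠ int n • q)) ≡ (n * n * n) * + size z
    norm-eq = trans (cong (λ x → N̂ (N x)) shape)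
      (trans (cong N̂ (trans (N-• ν′ (conj b · z))
      (cong (ν′ *ᴼ ν′ *ᴼ_) (trans (N-· (conj b) z) (cong (_*ᴼ N z) (N-conj b))))))
      (trans (N̂-* (ν′ *ᴼ ν′) (ν *ᴼ N z))
        (trans (cong₂ _*_ (trans (N̂-* ν′ ν′) (cong₂ _*_ e′ e′))
        (trans (N̂-* ν (N z)) (cong₂ _*_ sizeb (N̂-N≡size z))))
        (sym (ℤP.*-assoc (n * n) n (+ size z))))))
      where
      e′ : N̂ ν′ ≡ n
      e′ = trans (N̂-conjᴼ ν) sizeb
    l : ∀ n → (n * n) * (n * n) ≡ (n * n * n) * n
    l = solve-∀

  divide : ∀ a b → ¬ b ≡ 0ᵠ → ∃[ q ] size (a +ᵠ negᵠ (b · q)) ℕ.< size b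
  divide a b b≢0 = proj₁ near , divide-by a b (proj₁ near) (size b) {{m≢0}} (N̂-N≡size b) (proj₂ near)
    where
    m≢0 : ℕ.NonZero (size b)
    m≢0 = ℕ.≢-nonZero (λ e → b≢0 (N≡0⇒≡0 b (Nm≡0⇒≡0 (N b) e)))
    near = nearest (conjᴼ (N b) • (conj b · a)) (size b) {{m≢0}}

  module GCDᵠ = EuclideanAlgorithm.Euclid 𝒪R (_≟ᵠ 0ᵠ) size divide

  -- The units of norm 1: p and s are Hurwitz quaternions with nrd p + nrd s = 1.
  private
    range : List ℤ
    range = -[1+ 1 ] ∷ -[1+ 0 ] ∷ + 0 ∷ + 1 ∷ + 2 ∷ []

    join : ℤ × ℤ → ℤ × ℤ → Quat ℤ
    join (a , b) (c , d) = ⟪ a , b , c , d ⟫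

    pairs : List (ℤ × ℤ)
    pairs = cartesianProductWith _,_ range range

    pairs-unique : Unique pairs
    pairs-unique = cartesianProductWith⁺ _,_ (λ { refl → refl , refl }) u u
      where u = from-yes (UniqueDec.unique? ℤ._≟_ range)

    ∈pairs : ∀ {a b} → a ∈ range → b ∈ range → (a , b) ∈ pairs
    ∈pairs = ∈-cartesianProductWith⁺ _,_ {range} {range}

    opaque
      box : List (Quat ℤ)
      box = cartesianProductWith join pairs pairs

      box-unique : Unique box
      box-unique = cartesianProductWith⁺ join (λ { refl → refl , refl }) pairs-unique pairs-unique

      ∈-box : ∀ {a b c d} → a ∈ range → b ∈ range → c ∈ range → d ∈ range → ⟪ a , b , c , d ⟫ ∈ box
      ∈-box a∈ b∈ c∈ d∈ = ∈-cartesianProductWith⁺ join {pairs} {pairs} (∈pairs a∈ b∈) (∈pairs c∈ d∈)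

    norm-one? : ∀ v → Dec (hurwitz v ≡ + 1)
    norm-one? v = hurwitz v ≟ + 1

    ∈range : ∀ {a} → -[1+ 1 ] ≤ a → a ≤ + 2 → a ∈ range
    ∈range { -[1+ 0 ]} _ _ = there (here refl)
    ∈range { -[1+ 1 ]} _ _ = here refl
    ∈range { -[1+ suc (suc n) ]} (ℤ.-≤- (ℕ.s≤s ())) _
    ∈range {+ 0} _ _ = there (there (here refl))
    ∈range {+ 1} _ _ = there (there (there (here refl)))
    ∈range {+ 2} _ _ = there (there (there (there (here refl))))
    ∈range {+ suc (suc (suc n))} _ (ℤ.+≤+ (ℕ.s≤s (ℕ.s≤s ())))

    abs≤2 : ∀ a → a * a ≤ + 4 → -[1+ 1 ] ≤ a × a ≤ + 2
    abs≤2 a h = lo , hi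
      where
      hi : a ≤ + 2
      hi = ℤP.≮⇒≥ (λ lt → ℤP.<⇒≱ {+ 4} {a * a}
        (<-by ((a - + 2) * (a + + 2)) (l a)
        (0<* (gap< lt) (ℤP.+-mono-<-≤ (ℤP.<-trans (ℤ.+<+ (ℕ.s≤s ℕ.z≤n)) lt) (ℤ.+≤+ ℕ.z≤n)))) h)
        where
        l : ∀ a → a * a ≡ + 4 + (a - + 2) * (a + + 2)
        l = solve-∀
      lo : -[1+ 1 ] ≤ a
      lo = ℤP.≮⇒≥ (λ lt → ℤP.<⇒≱ {+ 4} {a * a}
        (<-by ((-[1+ 1 ] - a) * (+ 2 - a)) (l a) (0<* (gap< lt) (gap< (ℤP.<-trans lt ℤ.-<+)))) h)
        where
        l : ∀ a → a * a ≡ + 4 + (-[1+ 1 ] - a) * (+ 2 - a)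
        l = solve-∀

    -- The doubled coordinates have squares with sum 4, so each is at most 2 in absolute value;
    -- since `z` is one of them, the same bound follows for `t`, `x` and `y`.
    ∈box : ∀ v → hurwitz v ≡ + 1 → v ∈ box
    ∈box v@(⟪ t , x , y , z ⟫) h = ∈-box (side t T≤) (side x X≤) (side y Y≤) (∈range (proj₁ Z≤) (proj₂ Z≤))
      where
      T = + 2 * t + z
      X = + 2 * x + z
      Y = + 2 * y + z
      four : squares (doubled v) ≡ + 4
      four = trans (sym (4hurwitz v)) (cong (+ 4 *_) h)
      l₁ : ∀ a b c d → a + b + c + d ≡ a + (b + c + d)
      l₁ = solve-∀
      l₂ : ∀ a b c d → a + b + c + d ≡ b + (a + c + d)
      l₂ = solve-∀
      l₃ : ∀ a b c d → a + b + c + d ≡ c + (a + b + d)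
      l₃ = solve-∀
      l₄ : ∀ a b c d → a + b + c + d ≡ d + (a + b + c)
      l₄ = solve-∀
      T≤ = abs≤2 T (≤-by _ (trans (sym four) (l₁ (T * T) (X * X) (Y * Y) (z * z)))
        (0≤+ (0≤+ (0≤² X) (0≤² Y)) (0≤² z)))
      X≤ = abs≤2 X (≤-by _ (trans (sym four) (l₂ (T * T) (X * X) (Y * Y) (z * z)))
        (0≤+ (0≤+ (0≤² T) (0≤² Y)) (0≤² z)))
      Y≤ = abs≤2 Y (≤-by _ (trans (sym four) (l₃ (T * T) (X * X) (Y * Y) (z * z)))
        (0≤+ (0≤+ (0≤² T) (0≤² X)) (0≤² z)))
      Z≤ = abs≤2 z (≤-by _ (trans (sym four) (l₄ (T * T) (X * X) (Y * Y) (z * z)))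
        (0≤+ (0≤+ (0≤² T) (0≤² X)) (0≤² Y)))
      side : ∀ t → -[1+ 1 ] ≤ + 2 * t + z × + 2 * t + z ≤ + 2 → t ∈ range
      side t (lo , hi) = ∈range (ℤP.*-cancelˡ-≤-pos -[1+ 1 ] t (+ 2)
        (≤-by _ (e t z) (0≤+ (gap lo) (gap (proj₂ Z≤)))))
                                (ℤP.*-cancelˡ-≤-pos t (+ 2) (+ 2)
                                  (≤-by _ (e′ t z) (0≤+ (gap hi) (gap (proj₁ Z≤)))))
        where
        e : ∀ t z → + 2 * t ≡ + 2 * -[1+ 1 ] + (((+ 2 * t + z) - -[1+ 1 ]) + (+ 2 - z))
        e = solve-∀
        e′ : ∀ t z → + 2 * + 2 ≡ + 2 * t + ((+ 2 - (+ 2 * t + z)) + (z - -[1+ 1 ]))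
        e′ = solve-∀

    opaque
      unfolding box
      hurwitz-unit-list : List (Quat ℤ)
      hurwitz-unit-list = filter norm-one? box

      hurwitz-unit-list-length : length hurwitz-unit-list ≡ 24
      hurwitz-unit-list-length = refl

    opaque
      unfolding hurwitz-unit-list
      hurwitz-unit-list-spec : Unique hurwitz-unit-list × (∀ v → (v ∈ hurwitz-unit-list) ⇔ (hurwitz v ≡ + 1))
      hurwitz-unit-list-spec = filter⁺ norm-one? box-unique ,
        (λ v → mk⇔ (λ v∈ → proj₂ (∈-filter⁻ norm-one? {xs = box} v∈)) (λ h →
          ∈-filter⁺ norm-one? {xs = box} (∈box v h) h))

    hurwitz-units : Count (λ v → hurwitz v ≡ + 1) 24
    hurwitz-units = hurwitz-unit-list , proj₁ hurwitz-unit-list-spec , proj₂ hurwitz-unit-list-spec ,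
      hurwitz-unit-list-length

    im-zero : ∀ x → (doubled (part₀ x) ≡ 0ᵛ ⊎ skew x ≡ 0ᵛ) → im (N x) ≡ 0ℤ
    im-zero x h = ℤP.*-cancelˡ-≡ (+ 2) (im (N x)) 0ℤ (trans (2im-N x) (go h))
      where
      P = doubled (part₀ x)
      S = skew x
      go : (P ≡ 0ᵛ ⊎ S ≡ 0ᵛ) → q₁ P * q₁ S + q₂ P * q₂ S + q₃ P * q₃ S + q₄ P * q₄ S ≡ 0ℤ
      go (inj₁ e) = trans (cong (λ P → q₁ P * q₁ S + q₂ P * q₂ S + q₃ P * q₃ S + q₄ P * q₄ S) e)
        (l (q₁ S) (q₂ S) (q₃ S) (q₄ S))
        where
        l : ∀ a b c d → + 0 * a + + 0 * b + + 0 * c + + 0 * d ≡ 0ℤ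
        l = solve-∀
      go (inj₂ e) = trans (cong (λ S → q₁ P * q₁ S + q₂ P * q₂ S + q₃ P * q₃ S + q₄ P * q₄ S) e)
        (l (q₁ P) (q₂ P) (q₃ P) (q₄ P))
        where
        l : ∀ a b c d → a * + 0 + b * + 0 + c * + 0 + d * + 0 ≡ 0ℤ
        l = solve-∀

    -- When one part is zero, the scalar product that gives the irrational coordinate vanishes too,
    -- so that coordinate imposes no condition and each choice of the nonzero part contributes all
    -- 24 Hurwitz units.
    norm-one : ∀ p s → (s ≡ 0ᵛ × hurwitz p ≡ + 1) ⊎ (p ≡ 0ᵛ × hurwitz s ≡ + 1) → N (fromParts p s) ≡ oneᴼ
    norm-one p s h = OK-ext (trans (re-N (fromParts p s))
      (trans (cong₂ _+_ (cong hurwitz (part₀-fromParts p s)) (cong hurwitz (part₁-fromParts p s))) (sum h)))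
      (im-zero (fromParts p s) (vanishing h))
      where
      sum : (s ≡ 0ᵛ × hurwitz p ≡ + 1) ⊎ (p ≡ 0ᵛ × hurwitz s ≡ + 1) → hurwitz p + hurwitz s ≡ + 1
      sum (inj₁ (refl , e)) = cong (_+ + 0) e
      sum (inj₂ (refl , e)) = cong (λ z → + 0 + z) e
      vanishing : (s ≡ 0ᵛ × hurwitz p ≡ + 1) ⊎ (p ≡ 0ᵛ × hurwitz s ≡ + 1) →
        doubled (part₀ (fromParts p s)) ≡ 0ᵛ ⊎ skew (fromParts p s) ≡ 0ᵛ
      vanishing (inj₁ (refl , e)) = inj₂ refl
      vanishing (inj₂ (refl , e)) = inj₁ refl

    sum-one : ∀ {a b} → 0ℤ ≤ a → 0ℤ ≤ b → a + b ≡ + 1 → (b ≡ 0ℤ × a ≡ + 1) ⊎ (a ≡ 0ℤ × b ≡ + 1)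
    sum-one {+ 0} {+ b} _ _ h = inj₂ (refl , h)
    sum-one {+ 1} {+ 0} _ _ h = inj₁ (refl , refl)
    sum-one {+ 1} {+ suc b} _ _ h = ⊥-elim (ℕP.1+n≢0 (ℕP.suc-injective (ℤP.+-injective h)))
    sum-one {+ suc (suc a)} {+ b} _ _ h = ⊥-elim (ℕP.1+n≢0 (ℕP.suc-injective (ℤP.+-injective h)))

  private
    P₀ P₁ : 𝒪 → Set
    P₀ x = part₁ x ≡ 0ᵛ × hurwitz (part₀ x) ≡ + 1
    P₁ x = part₀ x ≡ 0ᵛ × hurwitz (part₁ x) ≡ + 1

    units₀ : Count P₀ 24
    units₀ = count-map {P = λ v → hurwitz v ≡ + 1} {Q = P₀} (λ p → fromParts p 0ᵛ)
      (λ {p} {p'} e → trans (sym (part₀-fromParts p 0ᵛ)) (trans (cong part₀ e) (part₀-fromParts p' 0ᵛ)))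
      (λ p h → part₁-fromParts p 0ᵛ , trans (cong hurwitz (part₀-fromParts p 0ᵛ)) h)
      (λ x (e , h) → part₀ x , h , trans (sym (fromParts-parts x)) (cong (fromParts (part₀ x)) e)) hurwitz-units

    units₁ : Count P₁ 24
    units₁ = count-map {P = λ v → hurwitz v ≡ + 1} {Q = P₁} (fromParts 0ᵛ)
      (λ {s} {s'} e → trans (sym (part₁-fromParts 0ᵛ s)) (trans (cong part₁ e) (part₁-fromParts 0ᵛ s')))
      (λ s h → part₀-fromParts 0ᵛ s , trans (cong hurwitz (part₁-fromParts 0ᵛ s)) h)
      (λ x (e , h) → part₁ x , h , trans (sym (fromParts-parts x)) (cong (λ p → fromParts p (part₁ x)) e))
        hurwitz-units

    0≢1 : ∀ {v} → v ≡ 0ᵛ → hurwitz v ≡ + 1 → ⊥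
    0≢1 refl ()

    units-disjoint : ∀ x → P₀ x → P₁ x → ⊥
    units-disjoint x (_ , h) (e , _) = 0≢1 e h

    units-merge : ∀ x → (P₀ x ⊎ P₁ x) ⇔ (N x ≡ oneᴼ)
    units-merge x = mk⇔ there′ back
      where
      there′ : P₀ x ⊎ P₁ x → N x ≡ oneᴼ
      there′ h = trans (cong N (sym (fromParts-parts x))) (norm-one (part₀ x) (part₁ x) h)
      back : N x ≡ oneᴼ → P₀ x ⊎ P₁ x
      back h = Data.Sum.map (λ (e , e') → hurwitz≡0 (part₁ x) e , e') (λ (e , e') → hurwitz≡0 (part₀ x) e , e')
        (sum-one {hurwitz (part₀ x)} {hurwitz (part₁ x)} (0≤hurwitz (part₀ x)) (0≤hurwitz (part₁ x))
          (trans (sym (re-N x)) (cong re h)))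

  units : Count (λ x → N x ≡ oneᴼ) 48
  units = count-resp {P = λ x → P₀ x ⊎ P₁ x} {Q = λ x → N x ≡ oneᴼ} {n = 48} units-merge
    (count-⊎ {P = P₀} {Q = P₁} {m = 24} {n = 24} units-disjoint units₀ units₁)

  ·-cancelˡ : ∀ γ {x y} → ¬ N γ ≡ 0ᴼ → γ · x ≡ γ · y → x ≡ y
  ·-cancelˡ γ {x} {y} Nγ≢0 h = quat≡ (c {q₁ x} {q₁ y} (cong q₁ scaled)) (c {q₂ x} {q₂ y} (cong q₂ scaled))
    (c {q₃ x} {q₃ y} (cong q₃ scaled)) (c {q₄ x} {q₄ y} (cong q₄ scaled))
    where
    un : ∀ x → conj γ · (γ · x) ≡ N γ • x
    un x = trans (sym (·-assoc (conj γ) γ x))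
      (trans (cong (_· x) (conj-· γ)) (trans (•-·-assoc (N γ) 1ᵠ x) (cong (N γ •_) (·-identityˡ x))))
    scaled : N γ • x ≡ N γ • y
    scaled = trans (sym (un x)) (trans (cong (conj γ ·_) h) (un y))
    c : ∀ {a b} → N γ *ᴼ a ≡ N γ *ᴼ b → a ≡ b
    c {a} {b} = *ᴼ-cancelˡ (N γ) {a} {b} Nγ≢0

-- Two-by-two matrices and the map from the order to matrices modulo `ρ`.

module Matrices where
  open import Defs hiding (H; K)
  open OKRing hiding (ring)
  open Solver
  open Quaternion
  open import Data.Nat using (ℕ)
  open import Data.Integer using (+_)
  open import Relation.Binary.PropositionalEquality

  -- The matrix (a b ; c d) is ⟪ a , b , c , d ⟫.
  module Mat2Formulas {A : Set} (_+_ _*_ : A → A → A) (-_ : A → A) where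
    private
      infixl 6 _⊹_
      infixl 7 _✶_
      _⊹_ = _+_
      _✶_ = _*_
    mm : Quat A → Quat A → Quat A
    mm ⟪ a , b , c , d ⟫ ⟪ a' , b' , c' , d' ⟫ =
      ⟪ a ✶ a' ⊹ b ✶ c' , a ✶ b' ⊹ b ✶ d' , c ✶ a' ⊹ d ✶ c' , c ✶ b' ⊹ d ✶ d' ⟫
    det : Quat A → A
    det ⟪ a , b , c , d ⟫ = a ✶ d ⊹ (- (b ✶ c))
    adj : Quat A → Quat A
    adj ⟪ a , b , c , d ⟫ = ⟪ d , - b , - c , a ⟫
    -- det (x + k•y) = det x + k * det-change k x y
    det-change : A → Quat A → Quat A → A
    det-change k ⟪ a , b , c , d ⟫ ⟪ a' , b' , c' , d' ⟫ =
      a ✶ d' ⊹ a' ✶ d ⊹ (- (b ✶ c' ⊹ b' ✶ c)) ⊹ k ✶ (a' ✶ d' ⊹ (- (b' ✶ c')))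

  private
    module GM = Mat2Formulas _+ᴼ_ _*ᴼ_ -ᴼ_
    module M {n : ℕ} = Mat2Formulas {Expr OK n} _⊕_ _⊗_ ⊝_

  idᵐ : Quat OK
  idᵐ = ⟪ oneᴼ , 0ᴼ , 0ᴼ , oneᴼ ⟫

  opaque
    mm : Quat OK → Quat OK → Quat OK
    mm = GM.mm
    det : Quat OK → OK
    det = GM.det
    adj : Quat OK → Quat OK
    adj = GM.adj
    det-change : OK → Quat OK → Quat OK → OK
    det-change = GM.det-change

    mm-assoc : ∀ x y z → mm (mm x y) z ≡ mm x (mm y z)
    mm-assoc ⟪ a , b , c , d ⟫ ⟪ a' , b' , c' , d' ⟫ ⟪ x , y , z , t ⟫ =
      proveQ 12 (λ a b c d a' b' c' d' x y z t →
      M.mm (M.mm ⟪ a , b , c , d ⟫ ⟪ a' , b' , c' , d' ⟫) ⟪ x , y , z , t ⟫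
        ≐ M.mm ⟪ a , b , c , d ⟫ (M.mm ⟪ a' , b' , c' , d' ⟫ ⟪ x , y , z , t ⟫)) refl
      (a ∷ b ∷ c ∷ d ∷ a' ∷ b' ∷ c' ∷ d' ∷ x ∷ y ∷ z ∷ t ∷ [])

    mm-distribˡ : ∀ x y z → mm x (y +ᵠ z) ≡ mm x y +ᵠ mm x z
    mm-distribˡ ⟪ a , b , c , d ⟫ ⟪ a' , b' , c' , d' ⟫ ⟪ x , y , z , t ⟫ =
      proveQ 12 (λ a b c d a' b' c' d' x y z t →
      M.mm ⟪ a , b , c , d ⟫ (E.add ⟪ a' , b' , c' , d' ⟫ ⟪ x , y , z , t ⟫)
        ≐ E.add (M.mm ⟪ a , b , c , d ⟫ ⟪ a' , b' , c' , d' ⟫) (M.mm ⟪ a , b , c , d ⟫ ⟪ x , y , z , t ⟫)) refl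
      (a ∷ b ∷ c ∷ d ∷ a' ∷ b' ∷ c' ∷ d' ∷ x ∷ y ∷ z ∷ t ∷ [])

    mm-distribʳ : ∀ x y z → mm (y +ᵠ z) x ≡ mm y x +ᵠ mm z x
    mm-distribʳ ⟪ a , b , c , d ⟫ ⟪ a' , b' , c' , d' ⟫ ⟪ x , y , z , t ⟫ =
      proveQ 12 (λ a b c d a' b' c' d' x y z t →
      M.mm (E.add ⟪ a' , b' , c' , d' ⟫ ⟪ x , y , z , t ⟫) ⟪ a , b , c , d ⟫
        ≐ E.add (M.mm ⟪ a' , b' , c' , d' ⟫ ⟪ a , b , c , d ⟫) (M.mm ⟪ x , y , z , t ⟫ ⟪ a , b , c , d ⟫)) refl
      (a ∷ b ∷ c ∷ d ∷ a' ∷ b' ∷ c' ∷ d' ∷ x ∷ y ∷ z ∷ t ∷ [])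

    mm-•ʳ : ∀ k x y → mm x (k • y) ≡ k • mm x y
    mm-•ʳ k ⟪ a , b , c , d ⟫ ⟪ x , y , z , t ⟫ = proveQ 9 (λ k a b c d x y z t →
      M.mm ⟪ a , b , c , d ⟫ (E.scale k ⟪ x , y , z , t ⟫)
        ≐ E.scale k (M.mm ⟪ a , b , c , d ⟫ ⟪ x , y , z , t ⟫)) refl
      (k ∷ a ∷ b ∷ c ∷ d ∷ x ∷ y ∷ z ∷ t ∷ [])

    mm-•ˡ : ∀ k x y → mm (k • x) y ≡ k • mm x y
    mm-•ˡ k ⟪ a , b , c , d ⟫ ⟪ x , y , z , t ⟫ = proveQ 9 (λ k a b c d x y z t →
      M.mm (E.scale k ⟪ a , b , c , d ⟫) ⟪ x , y , z , t ⟫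
        ≐ E.scale k (M.mm ⟪ a , b , c , d ⟫ ⟪ x , y , z , t ⟫)) refl
      (k ∷ a ∷ b ∷ c ∷ d ∷ x ∷ y ∷ z ∷ t ∷ [])

    mm-identityʳ : ∀ x → mm x idᵐ ≡ x
    mm-identityʳ ⟪ a , b , c , d ⟫ =
      proveQ 4 (λ a b c d → M.mm ⟪ a , b , c , d ⟫ ⟪ Κ oneᴼ , Κ 0ᴼ , Κ 0ᴼ , Κ oneᴼ ⟫ ≐ ⟪ a , b , c , d ⟫)
      refl (a ∷ b ∷ c ∷ d ∷ [])

    mm-adjˡ : ∀ x y → mm x (mm (adj x) y) ≡ det x • y
    mm-adjˡ ⟪ a , b , c , d ⟫ ⟪ x , y , z , t ⟫ = proveQ 8 (λ a b c d x y z t →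
      M.mm ⟪ a , b , c , d ⟫ (M.mm (M.adj ⟪ a , b , c , d ⟫) ⟪ x , y , z , t ⟫)
        ≐ E.scale (M.det ⟪ a , b , c , d ⟫) ⟪ x , y , z , t ⟫) refl
      (a ∷ b ∷ c ∷ d ∷ x ∷ y ∷ z ∷ t ∷ [])

    mm-adjʳ : ∀ x y → mm (mm y x) (adj x) ≡ det x • y
    mm-adjʳ ⟪ a , b , c , d ⟫ ⟪ x , y , z , t ⟫ = proveQ 8 (λ a b c d x y z t →
      M.mm (M.mm ⟪ x , y , z , t ⟫ ⟪ a , b , c , d ⟫) (M.adj ⟪ a , b , c , d ⟫)
        ≐ E.scale (M.det ⟪ a , b , c , d ⟫) ⟪ x , y , z , t ⟫) refl
      (a ∷ b ∷ c ∷ d ∷ x ∷ y ∷ z ∷ t ∷ [])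

    det-mm : ∀ x y → det (mm x y) ≡ det x *ᴼ det y
    det-mm ⟪ a , b , c , d ⟫ ⟪ x , y , z , t ⟫ = prove 8 (λ a b c d x y z t →
      M.det (M.mm ⟪ a , b , c , d ⟫ ⟪ x , y , z , t ⟫) ≐ M.det ⟪ a , b , c , d ⟫ ⊗ M.det ⟪ x , y , z , t ⟫) refl
      (a ∷ b ∷ c ∷ d ∷ x ∷ y ∷ z ∷ t ∷ [])

    det-+• : ∀ k x y → det (x +ᵠ k • y) ≡ det x +ᴼ k *ᴼ det-change k x y
    det-+• k ⟪ a , b , c , d ⟫ ⟪ x , y , z , t ⟫ = prove 9 (λ k a b c d x y z t →
      M.det (E.add ⟪ a , b , c , d ⟫ (E.scale k ⟪ x , y , z , t ⟫))
        ≐ M.det ⟪ a , b , c , d ⟫ ⊕ k ⊗ M.det-change k ⟪ a , b , c , d ⟫ ⟪ x , y , z , t ⟫) refl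
      (k ∷ a ∷ b ∷ c ∷ d ∷ x ∷ y ∷ z ∷ t ∷ [])

    det-entries : ∀ a b c d → det ⟪ a , b , c , d ⟫ ≡ a *ᴼ d -ᴼ b *ᴼ c
    det-entries a b c d = refl

    upper-mm : ∀ d b d' x → mm ⟪ d , b , 0ᴼ , d' ⟫ x ≡ ⟪ d *ᴼ q₁ x +ᴼ b *ᴼ q₃ x , d *ᴼ q₂ x +ᴼ b *ᴼ q₄ x ,
      d' *ᴼ q₃ x , d' *ᴼ q₄ x ⟫
    upper-mm d b d' ⟪ x , y , z , t ⟫ = proveQ 7 (λ d b d' x y z t →
      M.mm ⟪ d , b , Κ 0ᴼ , d' ⟫ ⟪ x , y , z , t ⟫ ≐ ⟪ d ⊗ x ⊕ b ⊗ z , d ⊗ y ⊕ b ⊗ t , d' ⊗ z , d' ⊗ t ⟫) refl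
      (d ∷ b ∷ d' ∷ x ∷ y ∷ z ∷ t ∷ [])

    upper-det : ∀ d b d' → det ⟪ d , b , 0ᴼ , d' ⟫ ≡ d *ᴼ d'
    upper-det d b d' = prove 3 (λ d b d' → M.det ⟪ d , b , Κ 0ᴼ , d' ⟫ ≐ d ⊗ d') refl (d ∷ b ∷ d' ∷ [])

  -- A solution of p² + q² + q + 1 = √2p(1+q) modulo M gives e ↦ (0 −1 ; 1 √2), f ↦ (p q ; r √2−p) with
  -- r = 1 + q − √2p, an isomorphism from the order modulo M to 2×2 matrices modulo M;
  -- ρ measures the defect of the homomorphism property.
  module MatrixFormulas {A : Set} (_+_ _*_ : A → A → A) (-_ : A → A) (w 1# 2# : A) (p q : A) where
    private
      infixl 6 _⊹_
      infixl 7 _✶_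
      _⊹_ = _+_
      _✶_ = _*_
    r ρ : A
    r = 1# ⊹ q ⊹ (- (w ✶ p))
    ρ = p ✶ p ⊹ q ✶ q ⊹ q ⊹ 1# ⊹ (- (w ✶ p ✶ (1# ⊹ q)))
    φ : Quat A → Quat A
    φ ⟪ t , x , y , z ⟫ =
      ⟪ t ⊹ y ✶ p ⊹ (- (z ✶ r)) , (- x) ⊹ y ✶ q ⊹ z ✶ (p ⊹ (- w))
      , x ⊹ y ✶ r ⊹ z ✶ (p ⊹ w ✶ r) , t ⊹ w ✶ x ⊹ y ✶ (w ⊹ (- p)) ⊹ z ✶ (q ⊹ 2# ⊹ (- (w ✶ p))) ⟫
    -- The `vᵢ` are the traces of the matrix against the adjugates of the images of `1, e, f, g`.
    -- The Gram matrix of the trace form of this basis has an integral inverse, and applying that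
    -- inverse to the `vᵢ` recovers coordinates without any division.
    ψ : Quat A → Quat A
    ψ ⟪ a , b , c , d ⟫ =
      ⟪ 2# ✶ v₁ ⊹ v₄ ⊹ (- (w ✶ (v₂ ⊹ v₃))) , 2# ✶ v₂ ⊹ v₃ ⊹ (- (w ✶ (v₁ ⊹ v₄)))
      , v₂ ⊹ 2# ✶ v₃ ⊹ (- (w ✶ (v₁ ⊹ v₄))) , v₁ ⊹ 2# ✶ v₄ ⊹ (- (w ✶ (v₂ ⊹ v₃))) ⟫
      where
      v₁ = a ⊹ d
      v₂ = w ✶ a ⊹ (- b) ⊹ c
      v₃ = a ✶ (w ⊹ (- p)) ⊹ (- (b ✶ r)) ⊹ (- (c ✶ q)) ⊹ d ✶ p
      v₄ = a ✶ (q ⊹ 2# ⊹ (- (w ✶ p))) ⊹ (- (b ✶ (p ⊹ w ✶ r))) ⊹ c ✶ (w ⊹ (- p)) ⊹ (- (d ✶ r))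
    φ-defect : Quat A → Quat A → Quat A
    φ-defect ⟪ t , x , y , z ⟫ ⟪ t' , x' , y' , z' ⟫ =
      ⟪ s ⊹ w ✶ (y ✶ z') , y ✶ z' ⊹ (- (z ✶ y')) , z ✶ y' ⊹ (- (y ✶ z')) , s ⊹ w ✶ (z ✶ y') ⟫
      where s = y ✶ y' ⊹ z ✶ z'
    det-defect : Quat A → A
    det-defect ⟪ t , x , y , z ⟫ = - (y ✶ y ⊹ z ✶ z ⊹ w ✶ (y ✶ z))
    φψ-defect : Quat A → Quat A
    φψ-defect ⟪ a , b , c , d ⟫ = ⟪ s , w ✶ (d ⊹ (- a)) ⊹ (- (2# ✶ c)) , w ✶ (a ⊹ (- d)) ⊹ (- (2# ✶ b)) , - s ⟫
      where s = 2# ✶ (d ⊹ (- a)) ⊹ w ✶ (b ⊹ (- c))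
    ψφ-defect : Quat A → Quat A
    ψφ-defect ⟪ t , x , y , z ⟫ = ⟪ w ✶ y , w ✶ z , - (2# ✶ y) , - (2# ✶ z) ⟫

  module Representation (p q : OK) where
    private
      module G = MatrixFormulas _+ᴼ_ _*ᴼ_ -ᴼ_ √2ᴼ oneᴼ (mkO (+ 2) (+ 0)) p q
      module GE {n : ℕ} (p q : Expr OK n) =
        MatrixFormulas {Expr OK n} _⊕_ _⊗_ ⊝_ (Κ √2ᴼ) (Κ oneᴼ) (Κ (mkO (+ 2) (+ 0))) p q

    opaque
      ρ : OK
      ρ = G.ρ
      φ ψ : 𝒪 → Quat OK
      φ = G.φ
      ψ = G.ψ
      φ-defect : 𝒪 → 𝒪 → Quat OK
      φ-defect = G.φ-defect
      det-defect : 𝒪 → OK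
      det-defect = G.det-defect
      φψ-defect ψφ-defect : 𝒪 → 𝒪
      φψ-defect = G.φψ-defect
      ψφ-defect = G.ψφ-defect
      ρ-def : ρ ≡ p *ᴼ p +ᴼ q *ᴼ q +ᴼ q +ᴼ oneᴼ +ᴼ -ᴼ (√2ᴼ *ᴼ p *ᴼ (oneᴼ +ᴼ q))
      ρ-def = refl

    opaque
      unfolding ρ _·_ mm
      -- An identity in the polynomial ring in `p`, `q` and all coordinates. Since the error is an
      -- explicit multiple of `ρ`, congruences can be handled as equations in `O_K`.
      φ-· : ∀ x y → mm (φ x) (φ y) ≡ φ (x · y) +ᵠ ρ • φ-defect x y
      φ-· ⟪ t , x , y , z ⟫ ⟪ a , b , c , d ⟫ = proveQ 10 (λ p q t x y z a b c d →
        M.mm (GE.φ p q ⟪ t , x , y , z ⟫) (GE.φ p q ⟪ a , b , c , d ⟫)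
        ≐ E.add (GE.φ p q (E.mul ⟪ t , x , y , z ⟫ ⟪ a , b , c , d ⟫))
          (E.scale (GE.ρ p q) (GE.φ-defect p q ⟪ t , x , y , z ⟫ ⟪ a , b , c , d ⟫))) refl
        (p ∷ q ∷ t ∷ x ∷ y ∷ z ∷ a ∷ b ∷ c ∷ d ∷ [])

      φ-det : ∀ x → det (φ x) ≡ N x +ᴼ ρ *ᴼ det-defect x
      φ-det ⟪ t , x , y , z ⟫ = prove 6 (λ p q t x y z →
        M.det (GE.φ p q ⟪ t , x , y , z ⟫)
          ≐ E.form ⟪ t , x , y , z ⟫ ⊕ GE.ρ p q ⊗ GE.det-defect p q ⟪ t , x , y , z ⟫) refl
        (p ∷ q ∷ t ∷ x ∷ y ∷ z ∷ [])

      φ-+ : ∀ x y → φ (x +ᵠ y) ≡ φ x +ᵠ φ y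
      φ-+ ⟪ t , x , y , z ⟫ ⟪ a , b , c , d ⟫ = proveQ 10 (λ p q t x y z a b c d →
        GE.φ p q (E.add ⟪ t , x , y , z ⟫ ⟪ a , b , c , d ⟫)
          ≐ E.add (GE.φ p q ⟪ t , x , y , z ⟫) (GE.φ p q ⟪ a , b , c , d ⟫)) refl
        (p ∷ q ∷ t ∷ x ∷ y ∷ z ∷ a ∷ b ∷ c ∷ d ∷ [])

      φ-• : ∀ k x → φ (k • x) ≡ k • φ x
      φ-• k ⟪ t , x , y , z ⟫ = proveQ 7 (λ p q k t x y z →
        GE.φ p q (E.scale k ⟪ t , x , y , z ⟫) ≐ E.scale k (GE.φ p q ⟪ t , x , y , z ⟫)) refl
        (p ∷ q ∷ k ∷ t ∷ x ∷ y ∷ z ∷ [])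

      ψ-+ : ∀ x y → ψ (x +ᵠ y) ≡ ψ x +ᵠ ψ y
      ψ-+ ⟪ t , x , y , z ⟫ ⟪ a , b , c , d ⟫ = proveQ 10 (λ p q t x y z a b c d →
        GE.ψ p q (E.add ⟪ t , x , y , z ⟫ ⟪ a , b , c , d ⟫)
          ≐ E.add (GE.ψ p q ⟪ t , x , y , z ⟫) (GE.ψ p q ⟪ a , b , c , d ⟫)) refl
        (p ∷ q ∷ t ∷ x ∷ y ∷ z ∷ a ∷ b ∷ c ∷ d ∷ [])

      ψ-• : ∀ k x → ψ (k • x) ≡ k • ψ x
      ψ-• k ⟪ t , x , y , z ⟫ = proveQ 7 (λ p q k t x y z →
        GE.ψ p q (E.scale k ⟪ t , x , y , z ⟫) ≐ E.scale k (GE.ψ p q ⟪ t , x , y , z ⟫)) refl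
        (p ∷ q ∷ k ∷ t ∷ x ∷ y ∷ z ∷ [])

      φ-ψ : ∀ x → φ (ψ x) ≡ x +ᵠ ρ • φψ-defect x
      φ-ψ ⟪ t , x , y , z ⟫ = proveQ 6 (λ p q t x y z →
        GE.φ p q (GE.ψ p q ⟪ t , x , y , z ⟫)
          ≐ E.add ⟪ t , x , y , z ⟫ (E.scale (GE.ρ p q) (GE.φψ-defect p q ⟪ t , x , y , z ⟫))) refl
        (p ∷ q ∷ t ∷ x ∷ y ∷ z ∷ [])

      ψ-φ : ∀ x → ψ (φ x) ≡ x +ᵠ ρ • ψφ-defect x
      ψ-φ ⟪ t , x , y , z ⟫ = proveQ 6 (λ p q t x y z →
        GE.ψ p q (GE.φ p q ⟪ t , x , y , z ⟫)
          ≐ E.add ⟪ t , x , y , z ⟫ (E.scale (GE.ρ p q) (GE.ψφ-defect p q ⟪ t , x , y , z ⟫))) refl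
        (p ∷ q ∷ t ∷ x ∷ y ∷ z ∷ [])

-- Right ideals attached to sublattices are principal.

module Ideals where
  open import Defs hiding (H; K)
  open OKRing hiding (ring)
  open Solver
  open Quaternion
  open ZArith
  open OKArith hiding (divide)
  open UnitsOK
  open Metric
  open Order hiding (divide)
  open Matrices
  open Counting
  open import Data.Integer as ℤ using (ℤ; +_; ∣_∣; 0ℤ; -_; _*_; _+_; _-_; _<_; _≤_)
  import Data.Integer.Properties as ℤP
  open import Data.Integer.Tactic.RingSolver using (solve-∀)
  open import Data.Nat as ℕ using (ℕ)
  import Data.Nat.Properties as ℕP
  open import Data.Product using (∃-syntax; _×_; _,_; proj₁; proj₂)
  open import Data.Empty using (⊥; ⊥-elim)
  open import Relation.Binary.PropositionalEquality hiding ([_])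
  open import Relation.Nullary using (¬_)
  open import Relation.Binary.Definitions using (tri<; tri≈; tri>)

  -- Membership in the right ideal generated by `A`; equivalently, the columns of `X` lie in the
  -- lattice spanned by the columns of `A`.
  record Im (A X : Quat OK) : Set where
    constructor im-by
    field
      preimage : Quat OK
      image-eq : X ≡ mm A preimage

  Im-+ : ∀ {A X Y} → Im A X → Im A Y → Im A (X +ᵠ Y)
  Im-+ {A} (im-by U refl) (im-by V refl) = im-by (U +ᵠ V) (sym (mm-distribˡ A U V))

  Im-• : ∀ {A X} k → Im A X → Im A (k • X)
  Im-• {A} k (im-by U refl) = im-by (k • U) (sym (mm-•ʳ k A U))

  Im-mm : ∀ {A X} Y → Im A X → Im A (mm X Y)
  Im-mm {A} Y (im-by U refl) = im-by (mm U Y) (mm-assoc A U Y)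

  Im-det : ∀ A X → Im A (det A • X)
  Im-det A X = im-by (mm (adj A) X) (sym (mm-adjˡ A X))

  +ᵠ-assoc : ∀ x y z → (x +ᵠ y) +ᵠ z ≡ x +ᵠ (y +ᵠ z)
  +ᵠ-assoc x y z = quat≡ (+ᴼ-assoc (q₁ x) (q₁ y) (q₁ z)) (+ᴼ-assoc (q₂ x) (q₂ y) (q₂ z))
    (+ᴼ-assoc (q₃ x) (q₃ y) (q₃ z)) (+ᴼ-assoc (q₄ x) (q₄ y) (q₄ z))

  move : ∀ {a} b c d → a ≡ b +ᵠ c • d → b ≡ a +ᵠ c • negᵠ d
  move b c d refl = quat≡ (l (q₁ b) (q₁ d)) (l (q₂ b) (q₂ d)) (l (q₃ b) (q₃ d)) (l (q₄ b) (q₄ d))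
    where
    l : ∀ b d → b ≡ (b +ᴼ c *ᴼ d) +ᴼ c *ᴼ -ᴼ d
    l b d = prove 3 (λ b c d → b ≐ (b ⊕ c ⊗ d) ⊕ c ⊗ (⊝ d)) refl (b ∷ c ∷ d ∷ [])

  -- With `X = nx` one has `1 = (1 + X)(1 − X + X² − X³) + X⁴`, and `k` divides both `1 + X` and
  -- `n⁴`.
  unit-by : ∀ k a n x c → k *ᴼ a ≡ oneᴼ +ᴼ n *ᴼ x → n *ᴼ n *ᴼ (n *ᴼ n) ≡ k *ᴼ c → ∃[ u ] k *ᴼ u ≡ oneᴼ
  unit-by k a n x c e e' = a *ᴼ s +ᴼ c *ᴼ (x *ᴼ x *ᴼ (x *ᴼ x)) ,
    trans (l₁ k a s c (x *ᴼ x *ᴼ (x *ᴼ x)))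
      (trans (cong₂ (λ y z → y *ᴼ s +ᴼ z *ᴼ (x *ᴼ x *ᴼ (x *ᴼ x))) e (sym e')) (l₂ n x))
    where
    X = n *ᴼ x
    s = oneᴼ +ᴼ -ᴼ X +ᴼ X *ᴼ X +ᴼ -ᴼ (X *ᴼ X *ᴼ X)
    l₁ : ∀ k a s c y → k *ᴼ (a *ᴼ s +ᴼ c *ᴼ y) ≡ k *ᴼ a *ᴼ s +ᴼ k *ᴼ c *ᴼ y
    l₁ k a s c y = prove 5 (λ k a s c y → k ⊗ (a ⊗ s ⊕ c ⊗ y) ≐ k ⊗ a ⊗ s ⊕ k ⊗ c ⊗ y) refl
      (k ∷ a ∷ s ∷ c ∷ y ∷ [])
    l₂ : ∀ n x → (oneᴼ +ᴼ n *ᴼ x) *ᴼ (oneᴼ +ᴼ -ᴼ (n *ᴼ x) +ᴼ n *ᴼ x *ᴼ (n *ᴼ x) +ᴼ -ᴼ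
      (n *ᴼ x *ᴼ (n *ᴼ x) *ᴼ (n *ᴼ x))) +ᴼ n *ᴼ n *ᴼ (n *ᴼ n) *ᴼ (x *ᴼ x *ᴼ (x *ᴼ x)) ≡ oneᴼ
    l₂ n x = prove 2 (λ n x → (Κ oneᴼ ⊕ n ⊗ x) ⊗ (Κ oneᴼ ⊕ (⊝ (n ⊗ x)) ⊕ n ⊗ x ⊗ (n ⊗ x)
      ⊕ (⊝ (n ⊗ x ⊗ (n ⊗ x) ⊗ (n ⊗ x)))) ⊕ n ⊗ n ⊗ (n ⊗ n) ⊗ (x ⊗ x ⊗ (x ⊗ x)) ≐ Κ oneᴼ) refl (n ∷ x ∷ [])

  -- x is totally positive when 0 < re x and 0 < N̂ x.
  positive-product : ∀ m k → 0ℤ < re m → 0ℤ < N̂ m → 0ℤ < re k → 0ℤ < N̂ k → 0ℤ < re (m *ᴼ k)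
  positive-product (mkO a b) (mkO c d) 0<a 0<m 0<c 0<k = subst (0ℤ <_) (l₀ (a * c) (+ 2 * (b * d)))
    (gap< (²-cancel-< { - (+ 2 * (b * d))} {a * c} (ℤP.<⇒≤ (0<* 0<a 0<c))
      (<-by ((a * a - + 2 * (b * b)) * (c * c) + + 2 * (b * b) * (c * c - + 2 * (d * d))) (l₁ a b c d)
        (ℤP.+-mono-<-≤ {0ℤ} {(a * a - + 2 * (b * b)) * (c * c)} {0ℤ}
          {+ 2 * (b * b) * (c * c - + 2 * (d * d))}
          (0<* {a * a - + 2 * (b * b)} {c * c} 0<m (0<* {c} {c} 0<c 0<c))
          (0≤* {+ 2 * (b * b)} {c * c - + 2 * (d * d)} (0≤* {+ 2} {b * b} (ℤ.+≤+ ℕ.z≤n) (0≤² b))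
          (ℤP.<⇒≤ 0<k))))))
    where
    l₀ : ∀ x y → x - - y ≡ x + y
    l₀ = solve-∀
    l₁ : ∀ a b c d → (a * c) * (a * c)
      ≡ - (+ 2 * (b * d)) * - (+ 2 * (b * d))
      + ((a * a - + 2 * (b * b)) * (c * c) + + 2 * (b * b) * (c * c - + 2 * (d * d)))
    l₁ = solve-∀

  -- An element of positive norm is totally positive or totally negative, and in the second case the
  -- product with `m` would be totally negative.
  positive-cofactor : ∀ m k → 0ℤ < re m → 0ℤ < N̂ m → 0ℤ ≤ re (m *ᴼ k) → 0ℤ < N̂ k → 0ℤ < re k
  positive-cofactor m k 0<m 0<Nm 0≤mk 0<Nk with ℤP.<-cmp 0ℤ (re k)
  ... | tri< lt _ _ = lt
  ... | tri≈ _ eq _ = ⊥-elim (absurd (re k) (im k) (sym eq) 0<Nk)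
    where
    absurd : ∀ a b → a ≡ 0ℤ → 0ℤ < a * a - + 2 * (b * b) → ⊥
    absurd a b refl h = ℤP.<⇒≱ h (≤-by (+ 2 * (b * b)) (l b) (0≤* {+ 2} {b * b} (ℤ.+≤+ ℕ.z≤n) (0≤² b)))
      where
      l : ∀ b → 0ℤ ≡ 0ℤ * 0ℤ - + 2 * (b * b) + + 2 * (b * b)
      l = solve-∀
  ... | tri> _ _ gt = ⊥-elim (ℤP.<⇒≱ (ℤP.neg-mono-< neg) (subst (λ z → 0ℤ ≤ re z) (l m k) 0≤mk))
    where
    l : ∀ m k → m *ᴼ k ≡ -ᴼ (m *ᴼ -ᴼ k)
    l m k = prove 2 (λ m k → m ⊗ k ≐ ⊝ (m ⊗ (⊝ k))) refl (m ∷ k ∷ [])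
    neg : 0ℤ < re (m *ᴼ -ᴼ k)
    neg = positive-product m (-ᴼ k) 0<m 0<Nm (ℤP.neg-mono-< gt) (subst (0ℤ <_) (sym (l′ (re k) (im k))) 0<Nk)
      where
      l′ : ∀ a b → (- a) * (- a) - + 2 * ((- b) * (- b)) ≡ a * a - + 2 * (b * b)
      l′ = solve-∀

  private
    unit-norm : ∀ x y → 0ℤ ≤ x → x * y ≡ + 1 → x ≡ + 1
    unit-norm (+ x) y _ h = cong +_ (ℕP.m*n≡1⇒m≡1 x ∣ y ∣ (trans (sym (ℤP.abs-* (+ x) y)) (cong ∣_∣ h)))

    0<cancel : ∀ {x y} → 0ℤ < x → 0ℤ ≤ x * y → 0ℤ ≤ y
    0<cancel {x} {y} 0<x h = ℤP.*-cancelˡ-≤-pos 0ℤ y x {{ℤ.positive 0<x}}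
      (subst (_≤ x * y) (sym (ℤP.*-zeroʳ x)) h)

  -- A reduced norm m·k with k a unit has k totally positive, so k is a square.
  cofactor-square : ∀ m k u γ → 0ℤ < re m → 0ℤ < N̂ m → N γ ≡ m *ᴼ k → k *ᴼ u ≡ oneᴼ →
    N̂ k ≡ + 1 × ∃[ ε ] ε *ᴼ ε ≡ k
  cofactor-square m k u γ 0<m 0<Nm e ku = N̂k , positive-unit-square k 0<k N̂k
    where
    0≤N̂k : 0ℤ ≤ N̂ k
    0≤N̂k = 0<cancel {N̂ m} {N̂ k} 0<Nm (subst (0ℤ ≤_) (trans (cong N̂ e) (N̂-* m k)) (0≤N̂-N γ))
    N̂k : N̂ k ≡ + 1
    N̂k = unit-norm (N̂ k) (N̂ u) 0≤N̂k (trans (sym (N̂-* k u)) (cong N̂ ku))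
    0<k : 0ℤ < re k
    0<k = positive-cofactor m k 0<m 0<Nm (subst (λ z → 0ℤ ≤ re z) e (0≤re-N γ))
      (subst (0ℤ <_) (sym N̂k) (ℤ.+<+ (ℕ.s≤s ℕ.z≤n)))

  -- The defect `ρ` is taken divisible by `n²`, although `m` would suffice for a homomorphism modulo
  -- `m`. The second factor `n` makes the norm of `x₀` equal to `m` times an element congruent to 1
  -- modulo `n`, and this excludes unwanted common factors in the gcd.
  module Generators (m p q ρ' : OK) (0<m : 0ℤ < re m) (0<Nm : 0ℤ < N̂ m) where
    open Representation p q
    n m̄ : OK
    n = int (N̂ m)
    m̄ = conjᴼ m

    module _ (ρ≡ : ρ ≡ n *ᴼ n *ᴼ ρ') where
      m≢0 : ¬ m ≡ 0ᴼ
      m≢0 refl = ℤP.<-irrefl refl 0<m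

      ρm : OK
      ρm = n *ᴼ (m̄ *ᴼ ρ')

      ρ≡m : ρ ≡ m *ᴼ ρm
      ρ≡m = trans ρ≡ (trans (cong (λ z → z *ᴼ n *ᴼ ρ') (sym (*-conjᴼ m))) (l m m̄ n ρ'))
        where
        l : ∀ m m̄ n r → m *ᴼ m̄ *ᴼ n *ᴼ r ≡ m *ᴼ (n *ᴼ (m̄ *ᴼ r))
        l m m̄ n r = prove 4 (λ m m̄ n r → m ⊗ m̄ ⊗ n ⊗ r ≐ m ⊗ (n ⊗ (m̄ ⊗ r))) refl (m ∷ m̄ ∷ n ∷ r ∷ [])

      φ-·′ : ∀ x y → φ (x · y) ≡ mm (φ x) (φ y) +ᵠ ρ • negᵠ (φ-defect x y)
      φ-·′ x y = move (φ (x · y)) ρ (φ-defect x y) (φ-· x y)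

      Im-ρ : ∀ {A} → det A ≡ m → ∀ X → Im A (ρ • X)
      Im-ρ {A} dA X = subst (Im A) (trans (cong (_• (ρm • X)) dA)
        (trans (•-assoc m ρm X) (cong (_• X) (sym ρ≡m)))) (Im-det A (ρm • X))

      Im-right : ∀ {A} → det A ≡ m → ∀ x y → Im A (φ x) → Im A (φ (x · y))
      Im-right {A} dA x y i = subst (Im A) (sym (φ-·′ x y))
        (Im-+ {A} (Im-mm {A} (φ y) i) (Im-ρ dA (negᵠ (φ-defect x y))))

      record Generator (A : Quat OK) : Set where
        field
          γ : 𝒪
          norm-γ : N γ ≡ m
          inside : Im A (φ γ)
          generates : ∀ x → Im A (φ x) → ∃[ y ] x ≡ γ · y

      -- The right ideal of all x with φ(x) in A·M₂ is generated by any x₀ with φ(x₀) ≡ A and by n².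
      μ : OK
      μ = n *ᴼ n

      module FromGCD (A : Quat OK) (dA : det A ≡ m) (gcd : GCDᵠ.RightGCD (ψ A) (μ • 1ᵠ)) where
        x₀ : 𝒪
        x₀ = ψ A
        module GCD = GCDᵠ.RightGCD gcd
        g : 𝒪
        g = GCD.g

        μ•1 : ∀ x → (μ • 1ᵠ) · x ≡ μ • x
        μ•1 x = trans (•-·-assoc μ 1ᵠ x) (cong (μ •_) (·-identityˡ x))

        Im-x₀ : Im A (φ x₀)
        Im-x₀ = subst (Im A) (sym (φ-ψ A)) (Im-+ {A} (im-by idᵐ (sym (mm-identityʳ A))) (Im-ρ dA (φψ-defect A)))

        Im-μ : ∀ x → Im A (φ (μ • x))
        Im-μ x = subst (Im A) (trans (cong (_• ((m̄ *ᴼ n) • φ x)) dA)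
          (trans (•-assoc m (m̄ *ᴼ n) (φ x)) (trans (cong (_• φ x) e) (sym (φ-• μ x)))))
          (Im-det A ((m̄ *ᴼ n) • φ x))
          where
          e : m *ᴼ (m̄ *ᴼ n) ≡ μ
          e = trans (sym (*ᴼ-assoc m m̄ n)) (cong (_*ᴼ n) (*-conjᴼ m))

        Im-g : Im A (φ g)
        Im-g = subst (Im A) (sym (trans (cong φ GCD.bezout) (φ-+ (x₀ · GCD.s) ((μ • 1ᵠ) · GCD.t))))
          (Im-+ {A} (Im-right dA x₀ GCD.s Im-x₀) (subst (λ z → Im A (φ z)) (sym (μ•1 GCD.t)) (Im-μ GCD.t)))

        -- If `φ x = A U`, then `x₀ · ψ U` and `x` have the same image up to multiples of `ρ`.
        -- Applying `ψ` gives `x = x₀ · ψ U` up to such a multiple, and `ρ` is a multiple of `μ`;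
        -- both `x₀` and `μ` lie in the ideal of `g`.
        g-generates : ∀ x → Im A (φ x) → ∃[ y ] x ≡ g · y
        g-generates x (im-by U eU) = GCD.a′ · y₀ +ᵠ GCD.b′ · (ρ' • Z₃) ,
          trans x-eq (trans (cong₂ _+ᵠ_ left right) (sym (·-distribˡ g (GCD.a′ · y₀) (GCD.b′ · (ρ' • Z₃)))))
          where
          y₀ = ψ U
          D = φψ-defect A
          D' = φψ-defect U
          Z₁ = mm A D' +ᵠ mm D (U +ᵠ ρ • D')
          Z₂ = Z₁ +ᵠ negᵠ (φ-defect x₀ y₀)
          Z₃ = ψφ-defect (x₀ · y₀) +ᵠ negᵠ (ψφ-defect x +ᵠ ψ Z₂)
          distrib• : ∀ c a b → c • a +ᵠ c • b ≡ c • (a +ᵠ b)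
          distrib• c a b = sym (•-distribˡ c a b)
          product : mm (φ x₀) (φ y₀) ≡ φ x +ᵠ ρ • Z₁
          product = trans (cong₂ mm (φ-ψ A) (φ-ψ U)) (trans (mm-distribʳ (U +ᵠ ρ • D') A (ρ • D))
            (trans (cong₂ _+ᵠ_ (trans (mm-distribˡ A U (ρ • D')) (cong₂ _+ᵠ_ (sym eU) (mm-•ʳ ρ A D')))
              (mm-•ˡ ρ D (U +ᵠ ρ • D')))
            (trans (+ᵠ-assoc (φ x) (ρ • mm A D') (ρ • mm D (U +ᵠ ρ • D')))
              (cong (φ x +ᵠ_) (distrib• ρ (mm A D') (mm D (U +ᵠ ρ • D')))))))
          φ-eq : φ (x₀ · y₀) ≡ φ x +ᵠ ρ • Z₂
          φ-eq = trans (φ-·′ x₀ y₀) (trans (cong (_+ᵠ ρ • negᵠ (φ-defect x₀ y₀)) product)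
            (trans (+ᵠ-assoc (φ x) (ρ • Z₁) (ρ • negᵠ (φ-defect x₀ y₀)))
            (cong (φ x +ᵠ_) (distrib• ρ Z₁ (negᵠ (φ-defect x₀ y₀))))))
          ψ-eq : x₀ · y₀ +ᵠ ρ • ψφ-defect (x₀ · y₀) ≡ x +ᵠ ρ • (ψφ-defect x +ᵠ ψ Z₂)
          ψ-eq = trans (sym (ψ-φ (x₀ · y₀)))
            (trans (cong ψ φ-eq) (trans (ψ-+ (φ x) (ρ • Z₂)) (trans (cong₂ _+ᵠ_ (ψ-φ x) (ψ-• ρ Z₂))
            (trans (+ᵠ-assoc x (ρ • ψφ-defect x) (ρ • ψ Z₂))
              (cong (x +ᵠ_) (distrib• ρ (ψφ-defect x) (ψ Z₂)))))))
          x-eq : x ≡ x₀ · y₀ +ᵠ ρ • Z₃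
          x-eq = trans (move x ρ (ψφ-defect x +ᵠ ψ Z₂) ψ-eq)
            (trans (+ᵠ-assoc (x₀ · y₀) (ρ • ψφ-defect (x₀ · y₀)) (ρ • negᵠ (ψφ-defect x +ᵠ ψ Z₂)))
            (cong (x₀ · y₀ +ᵠ_) (distrib• ρ (ψφ-defect (x₀ · y₀)) (negᵠ (ψφ-defect x +ᵠ ψ Z₂)))))
          left : x₀ · y₀ ≡ g · (GCD.a′ · y₀)
          left = trans (cong (_· y₀) GCD.dividesˡ) (·-assoc g GCD.a′ y₀)
          right : ρ • Z₃ ≡ g · (GCD.b′ · (ρ' • Z₃))
          right = trans (cong (_• Z₃) ρ≡)
            (trans (sym (•-assoc μ ρ' Z₃))
            (trans (sym (μ•1 (ρ' • Z₃))) (trans (cong (_· (ρ' • Z₃)) GCD.dividesʳ)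
            (·-assoc g GCD.b′ (ρ' • Z₃)))))

        private
          solve-for : ∀ {x} y r z → x ≡ y +ᴼ r *ᴼ z → y ≡ x +ᴼ -ᴼ (r *ᴼ z)
          solve-for y r z refl = prove 3 (λ y r z → y ≐ (y ⊕ r ⊗ z) ⊕ (⊝ (r ⊗ z))) refl (y ∷ r ∷ z ∷ [])

        N-g : ∀ U → φ g ≡ mm A U → N g ≡ m *ᴼ (det U +ᴼ -ᴼ (ρm *ᴼ det-defect g))
        N-g U eU = trans (solve-for (N g) ρ (det-defect g) (sym (trans (sym (φ-det g)) refl)))
            (trans (cong₂ (λ x r → x +ᴼ -ᴼ (r *ᴼ det-defect g))
              (trans (cong det eU) (trans (det-mm A U) (cong (_*ᴼ det U) dA))) ρ≡m)
              (l m (det U) ρm (det-defect g)))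
          where
          l : ∀ m d r z → m *ᴼ d +ᴼ -ᴼ (m *ᴼ r *ᴼ z) ≡ m *ᴼ (d +ᴼ -ᴼ (r *ᴼ z))
          l m d r z = prove 4 (λ m d r z → m ⊗ d ⊕ (⊝ (m ⊗ r ⊗ z)) ≐ m ⊗ (d ⊕ (⊝ (r ⊗ z)))) refl
            (m ∷ d ∷ r ∷ z ∷ [])

        dc : OK
        dc = det-change ρ A (φψ-defect A)
        N-x₀ : N x₀ ≡ m *ᴼ (oneᴼ +ᴼ n *ᴼ (m̄ *ᴼ ρ' *ᴼ (dc -ᴼ det-defect x₀)))
        N-x₀ = trans (solve-for (N x₀) ρ (det-defect x₀) (sym (trans (sym (φ-det x₀)) refl)))
          (trans (cong (_+ᴼ -ᴼ (ρ *ᴼ det-defect x₀))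
            (trans (cong det (φ-ψ A)) (trans (det-+• ρ A (φψ-defect A)) (cong (_+ᴼ ρ *ᴼ dc) dA))))
          (trans (cong (λ r → m +ᴼ r *ᴼ dc +ᴼ -ᴼ (r *ᴼ det-defect x₀)) ρ≡m) (l m n m̄ ρ' dc (det-defect x₀))))
          where
          l : ∀ m n m̄ r d z → m +ᴼ m *ᴼ (n *ᴼ (m̄ *ᴼ r)) *ᴼ d +ᴼ -ᴼ (m *ᴼ (n *ᴼ (m̄ *ᴼ r)) *ᴼ z)
            ≡ m *ᴼ (oneᴼ +ᴼ n *ᴼ (m̄ *ᴼ r *ᴼ (d +ᴼ -ᴼ z)))
          l m n m̄ r d z = prove 6 (λ m n m̄ r d z →
            m ⊕ m ⊗ (n ⊗ (m̄ ⊗ r)) ⊗ d ⊕ (⊝ (m ⊗ (n ⊗ (m̄ ⊗ r)) ⊗ z))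
            ≐ m ⊗ (Κ oneᴼ ⊕ n ⊗ (m̄ ⊗ r ⊗ (d ⊕ (⊝ z))))) refl (m ∷ n ∷ m̄ ∷ r ∷ d ∷ z ∷ [])

        -- Taking norms in `x₀ = g a′` and `μ = g b′`: the cofactor `k` divides `N x₀ / m`, which is
        -- 1 modulo `n`, and it divides `n⁴`.
        k-unit : ∀ k → N g ≡ m *ᴼ k → ∃[ u ] k *ᴼ u ≡ oneᴼ
        k-unit k N-g = unit-by k (N GCD.a′) n (m̄ *ᴼ ρ' *ᴼ (dc -ᴼ det-defect x₀)) (m *ᴼ N GCD.b′)
          (*ᴼ-cancelˡ m m≢0 (trans (sym (*ᴼ-assoc m k (N GCD.a′)))
            (trans (cong (_*ᴼ N GCD.a′) (sym N-g))
            (trans (sym (trans (cong N GCD.dividesˡ) (N-· g GCD.a′))) N-x₀))))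
          (trans (sym (trans (N-• μ 1ᵠ) (trans (cong (μ *ᴼ μ *ᴼ_) N-1ᵠ) (*ᴼ-idʳ (μ *ᴼ μ)))))
            (trans (cong N GCD.dividesʳ) (trans (N-· g GCD.b′)
              (trans (cong (_*ᴼ N GCD.b′) N-g) (l m k (N GCD.b′))))))
          where
          l : ∀ m k b → m *ᴼ k *ᴼ b ≡ k *ᴼ (m *ᴼ b)
          l m k b = prove 3 (λ m k b → m ⊗ k ⊗ b ≐ k ⊗ (m ⊗ b)) refl (m ∷ k ∷ b ∷ [])

        generator-by : ∀ k u → N g ≡ m *ᴼ k → k *ᴼ u ≡ oneᴼ → N̂ k ≡ + 1 × ∃[ ε ] ε *ᴼ ε ≡ k → Generator A
        generator-by k u N-g ku (N̂k , ε , εε) =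
          record { γ = e • g ; norm-γ = norm-γ ; inside =
          subst (Im A) (sym (φ-• e g)) (Im-• {A} e Im-g) ; generates = gen }
          where
          -- The inverse of `ε`, since `ε² = k` and `k` has norm 1; scaling by it removes `k` from
          -- the norm of `g`.
          e = ε *ᴼ conjᴼ k
          kk : k *ᴼ conjᴼ k ≡ oneᴼ
          kk = trans (*-conjᴼ k) (cong int N̂k)
          εe : e *ᴼ ε ≡ oneᴼ
          εe = trans (l ε (conjᴼ k)) (trans (cong (_*ᴼ conjᴼ k) εε) kk)
            where
            l : ∀ e c → e *ᴼ c *ᴼ e ≡ e *ᴼ e *ᴼ c
            l e c = prove 2 (λ e c → e ⊗ c ⊗ e ≐ e ⊗ e ⊗ c) refl (e ∷ c ∷ [])
          norm-γ : N (e • g) ≡ m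
          norm-γ = trans (N-• e g) (trans (cong (e *ᴼ e *ᴼ_) (trans N-g (cong (m *ᴼ_) (sym εε))))
            (trans (l e m ε) (trans (cong (λ z → z *ᴼ z *ᴼ m) εe) (*ᴼ-idˡ m))))
            where
            l : ∀ e m ε → e *ᴼ e *ᴼ (m *ᴼ (ε *ᴼ ε)) ≡ e *ᴼ ε *ᴼ (e *ᴼ ε) *ᴼ m
            l e m ε = prove 3 (λ e m ε → e ⊗ e ⊗ (m ⊗ (ε ⊗ ε)) ≐ e ⊗ ε ⊗ (e ⊗ ε) ⊗ m) refl (e ∷ m ∷ ε ∷ [])
          gen : ∀ x → Im A (φ x) → ∃[ y ] x ≡ (e • g) · y
          gen x i = ε • proj₁ gx , trans (proj₂ gx)
            (sym (trans (·-•-comm ε (e • g) (proj₁ gx))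
            (trans (cong (ε •_) (•-·-assoc e g (proj₁ gx))) (trans (•-assoc ε e (g · proj₁ gx))
              (trans (cong (_• (g · proj₁ gx)) (trans (*ᴼ-comm ε e) εe)) (•-identityˡ (g · proj₁ gx)))))))
            where gx = g-generates x i

        generator-from : ∀ k → N g ≡ m *ᴼ k → Generator A
        generator-from k e = go (k-unit k e)
          where
          go : ∃[ u ] k *ᴼ u ≡ oneᴼ → Generator A
          go (u , ku) = generator-by k u e ku (cofactor-square m k u g 0<m 0<Nm e ku)

        generator : Im A (φ g) → Generator A
        generator (im-by U eU) = generator-from (det U +ᴼ -ᴼ (ρm *ᴼ det-defect g)) (N-g U eU)

      -- The elements of norm `m` in the ideal are the products of its generator with an element of
      -- norm 1, and there are 48 of these.
      count-by : ∀ A → det A ≡ m → Generator A → Count (λ x → N x ≡ m × Im A (φ x)) 48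
      count-by A dA gen = count-map {P = λ x → N x ≡ oneᴼ} {Q = λ x → N x ≡ m × Im A (φ x)} (γ ·_)
        (·-cancelˡ γ (λ e → m≢0 (trans (sym norm-γ) e)))
        (λ y e → trans (N-· γ y) (trans (cong₂ _*ᴼ_ norm-γ e) (*ᴼ-idʳ m)) , Im-right dA γ y inside)
        (λ x (e , i) → proj₁ (generates x i) ,
          *ᴼ-cancelˡ m m≢0 (trans (sym (trans (N-· γ (proj₁ (generates x i)))
            (cong (_*ᴼ N (proj₁ (generates x i))) norm-γ)))
            (trans (cong N (sym (proj₂ (generates x i)))) (trans e (sym (*ᴼ-idʳ m))))) ,
          proj₂ (generates x i)) units
        where open Generator gen

      ideal-count : ∀ A → det A ≡ m → Count (λ x → N x ≡ m × Im A (φ x)) 48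
      ideal-count A dA = count-by A dA (generator Im-g)
        where open FromGCD A dA (GCDᵠ.rightGCD (ψ A) (μ • 1ᵠ))

-- Minus one as a sum of two squares modulo an odd integer.

module TwoSquares where
  open ZArith
  open import Data.Integer using (ℤ; +_; ∣_∣; -_; _*_; _+_; _-_)
  import Data.Integer.Properties as ℤP
  open import Data.Integer.Tactic.RingSolver using (solve-∀)
  open import Data.Nat as ℕ using (ℕ; zero; suc)
  import Data.Nat.Properties as ℕP
  open import Data.Nat.DivMod using (_%_; _/_; m%n<n; m≡m%n+[m/n]*n)
  open import Data.Nat.Divisibility as ℕD using (_∣_; _∤_; divides)
  open import Data.Nat.Primality using (Prime; euclidsLemma; prime⇒irreducible; prime⇒nonZero)
  open import Data.Nat.Primality.Factorisation using (factorise; PrimeFactorisation)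
  open import Data.Nat.Coprimality using (coprime-Bézout)
  open import Data.Nat.GCD using (module Bézout)
  open import Data.Nat.ListAction using (product)
  open import Data.Fin as Fin using (Fin; toℕ; fromℕ<; splitAt; join)
  import Data.Fin.Properties as FinP
  open import Data.List using (List; []; _∷_)
  open import Data.List.Relation.Unary.All using (All; []; _∷_)
  open import Data.Product using (∃; ∃-syntax; _×_; _,_; proj₁; proj₂)
  open import Data.Sum using (_⊎_; inj₁; inj₂; [_,_]′)
  open import Data.Empty using (⊥-elim)
  open import Relation.Binary.PropositionalEquality hiding ([_])
  open import Relation.Nullary using (¬_; yes; no)

  Solvable : ℤ → Set
  Solvable m = ∃[ a ] ∃[ b ] ∃[ k ] a * a + b * b + + 1 ≡ k * m

  solvable-÷ : ∀ m d → Solvable (m * d) → Solvable m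
  solvable-÷ m d (a , b , k , e) = a , b , k * d , trans e (l k m d)
    where
    l : ∀ k m d → k * (m * d) ≡ k * d * m
    l = solve-∀

  -- Since a·a + b·b ≡ −1, the correction (a,b) ↦ (1+mκ)(a,b) with 2κ ≡ k is Hensel's.
  solvable-² : ∀ h → let m = + 2 * h + + 1 in Solvable m → Solvable (m * m)
  solvable-² h (a , b , k , e) = a * c , b * c , (+ 2 * (k * κ) - k - κ * κ + k * m * (κ * κ)) ,
    trans (l₁ a b c) (trans (cong (λ z → z * (c * c) - c * c + + 1) e) (l₂ h k))
    where
    m = + 2 * h + + 1
    κ = k * (h + + 1)
    c = + 1 + m * κ
    l₁ : ∀ a b c → a * c * (a * c) + b * c * (b * c) + + 1 ≡ (a * a + b * b + + 1) * (c * c) - c * c + + 1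
    l₁ = solve-∀
    l₂ : ∀ h k → let m = + 2 * h + + 1 ; κ = k * (h + + 1) ; c = + 1 + m * κ in
      k * m * (c * c) - c * c + + 1 ≡ (+ 2 * (k * κ) - k - κ * κ + k * m * (κ * κ)) * (m * m)
    l₂ = solve-∀

  -- Chinese remainder theorem: the combined solution is congruent to `(a, b)` modulo `m` and to
  -- `(a′, b′)` modulo `n`.
  solvable-* : ∀ m n u v → u * m + v * n ≡ + 1 → Solvable m → Solvable n → Solvable (m * n)
  solvable-* m n u v bez (a , b , k , e) (a' , b' , k' , e') = A , B , K ,
    trans (l₁ m n u v a b a' b')
    (trans (cong₂ (λ x y → x * (v * v * (n * n)) + y * (u * u * (m * m))
      + + 2 * (u * v) * (a * a' + b * b' + + 1) * (m * n) + + 1 - (u * m + v * n) * (u * m + v * n)) e e')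
    (trans (cong (λ z → k * m * (v * v * (n * n)) + k' * n * (u * u * (m * m))
      + + 2 * (u * v) * (a * a' + b * b' + + 1) * (m * n) + + 1 - z * z) bez)
    (l₂ m n u v (a * a' + b * b' + + 1) k k')))
    where
    A = a * (v * n) + a' * (u * m)
    B = b * (v * n) + b' * (u * m)
    K = k * (v * v) * n + k' * (u * u) * m + + 2 * (u * v) * (a * a' + b * b' + + 1)
    l₁ : ∀ m n u v a b a' b' →
      (a * (v * n) + a' * (u * m)) * (a * (v * n) + a' * (u * m))
        + (b * (v * n) + b' * (u * m)) * (b * (v * n) + b' * (u * m)) + + 1
      ≡ (a * a + b * b + + 1) * (v * v * (n * n)) + (a' * a' + b' * b' + + 1) * (u * u * (m * m))
        + + 2 * (u * v) * (a * a' + b * b' + + 1) * (m * n) + + 1 - (u * m + v * n) * (u * m + v * n)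
    l₁ = solve-∀
    l₂ : ∀ m n u v t k k' → k * m * (v * v * (n * n)) + k' * n * (u * u * (m * m))
      + + 2 * (u * v) * t * (m * n) + + 1 - + 1 * + 1
      ≡ (k * (v * v) * n + k' * (u * u) * m + + 2 * (u * v) * t) * (m * n)
    l₂ = solve-∀

  odd-form : ∀ n → 2 ∤ n → ∃[ h ] n ≡ 2 ℕ.* h ℕ.+ 1
  odd-form n 2∤n = go (n % 2) (n / 2) (m%n<n n 2) (m≡m%n+[m/n]*n n 2)
    where
    go : ∀ r q → r ℕ.< 2 → n ≡ r ℕ.+ q ℕ.* 2 → ∃[ h ] n ≡ 2 ℕ.* h ℕ.+ 1
    go 0 q _ e = ⊥-elim (2∤n (divides q e))
    go 1 q _ e = q , trans e (trans (ℕP.+-comm 1 (q ℕ.* 2)) (cong (ℕ._+ 1) (ℕP.*-comm q 2)))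
    go (suc (suc r)) q (ℕ.s≤s (ℕ.s≤s ())) _

  module PrimeCase (p h : ℕ) (pp : Prime p) (p≡ : p ≡ 2 ℕ.* h ℕ.+ 1) where
    instance
      p≢0 : ℕ.NonZero p
      p≢0 = prime⇒nonZero pp

    decompose : ∀ x → + x * + x ≡ + ((x ℕ.* x) % p) + + ((x ℕ.* x) / p) * + p
    decompose x = trans (sym (ℤP.pos-* x x)) (trans (cong +_ (m≡m%n+[m/n]*n (x ℕ.* x) p))
      (trans (ℤP.pos-+ ((x ℕ.* x) % p) _) (cong (λ z → + ((x ℕ.* x) % p) + z) (ℤP.pos-* ((x ℕ.* x) / p) p))))

    h+h<p : h ℕ.+ h ℕ.< p
    h+h<p = ℕP.≤-reflexive (trans (ℕP.+-comm 1 (h ℕ.+ h))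
      (trans (cong (λ z → h ℕ.+ z ℕ.+ 1) (sym (ℕP.+-identityʳ h))) (sym p≡)))

    collision : ∀ x y → x ℕ.≤ h → y ℕ.≤ h → (x ℕ.* x) % p ≡ (y ℕ.* y) % p → x ≡ y
    collision x y x≤h y≤h e = [ (λ d → from-difference d) , (λ d →
      from-sum d) ]′ (euclidsLemma ∣ + x - + y ∣ ∣ + x + + y ∣ pp p∣)
      where
      qx = (x ℕ.* x) / p
      qy = (y ℕ.* y) / p
      eq : (+ x - + y) * (+ x + + y) ≡ (+ qx - + qy) * + p
      eq = trans (l₁ (+ x) (+ y)) (trans (cong₂ _-_ (decompose x) (decompose y))
        (trans (cong (λ r → (+ ((x ℕ.* x) % p) + + qx * + p) - (+ r + + qy * + p)) (sym e))
        (l₂ (+ ((x ℕ.* x) % p)) (+ qx) (+ qy) (+ p))))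
        where
        l₁ : ∀ x y → (x - y) * (x + y) ≡ x * x - y * y
        l₁ = solve-∀
        l₂ : ∀ r a b p → (r + a * p) - (r + b * p) ≡ (a - b) * p
        l₂ = solve-∀
      p∣ : p ∣ ∣ + x - + y ∣ ℕ.* ∣ + x + + y ∣
      p∣ = divides ∣ + qx - + qy ∣ (trans (sym (ℤP.abs-* (+ x - + y) (+ x + + y)))
        (trans (cong ∣_∣ eq) (ℤP.abs-* (+ qx - + qy) (+ p))))
      small : ∀ {n} → n ℕ.< p → p ∣ n → n ≡ 0
      small {zero} _ _ = refl
      small {suc n} n<p d = ⊥-elim (ℕP.<⇒≱ n<p (ℕD.∣⇒≤ d))
      from-difference : p ∣ ∣ + x - + y ∣ → x ≡ y
      from-difference d = ℤP.+-injective (ℤP.i-j≡0⇒i≡j (+ x) (+ y) (ℤP.∣i∣≡0⇒i≡0 (small bound d)))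
        where
        bound : ∣ + x - + y ∣ ℕ.< p
        bound = subst (λ z → ∣ z ∣ ℕ.< p) (sym (ℤP.m-n≡m⊖n x y)) (ℕP.≤-<-trans (ℤP.∣m⊝n∣≤m⊔n x y)
          (ℕP.≤-<-trans (ℕP.⊔-lub x≤h y≤h) (ℕP.≤-<-trans (ℕP.m≤m+n h h) h+h<p)))
      from-sum : p ∣ x ℕ.+ y → x ≡ y
      from-sum d = trans (ℕP.m+n≡0⇒m≡0 x z) (sym (ℕP.m+n≡0⇒n≡0 x z))
        where z = small (ℕP.≤-<-trans (ℕP.+-mono-≤ x≤h y≤h) h+h<p) d

    -- The residues of `x²` and of `−1 − y²` for `x` and `y` from 0 to `h`. Each family is injective
    -- by `collision`, and together they have `2(h + 1) > p` members, so a common value exists.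
    left right : Fin (suc h) → ℕ
    left x = (toℕ x ℕ.* toℕ x) % p
    right y = p ℕ.∸ suc ((toℕ y ℕ.* toℕ y) % p)

    left< : ∀ x → left x ℕ.< p
    left< x = m%n<n (toℕ x ℕ.* toℕ x) p
    right< : ∀ y → right y ℕ.< p
    right< y = ℕP.≤-<-trans (ℕP.∸-monoʳ-≤ p (ℕ.s≤s (ℕ.z≤n {(toℕ y ℕ.* toℕ y) % p})))
      (ℕP.≤-reflexive (ℕP.suc-pred p))

    box : Fin (suc h) ⊎ Fin (suc h) → Fin p
    box = [ (λ x → fromℕ< (left< x)) , (λ y → fromℕ< (right< y)) ]′

    size : p ℕ.< suc h ℕ.+ suc h
    size = ℕP.≤-reflexive (trans (cong suc (trans p≡ (l h))) (sym (ℕP.+-suc (suc h) h)))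
      where
      l : ∀ h → 2 ℕ.* h ℕ.+ 1 ≡ suc (h ℕ.+ h)
      l h = trans (ℕP.+-comm (2 ℕ.* h) 1) (cong (λ z → suc (h ℕ.+ z)) (ℕP.+-identityʳ h))

    ≤h : ∀ (x : Fin (suc h)) → toℕ x ℕ.≤ h
    ≤h x = ℕ.s≤s⁻¹ (FinP.toℕ<n x)

    values : ∀ {m n} (m< : m ℕ.< p) (n< : n ℕ.< p) → fromℕ< m< ≡ fromℕ< n< → m ≡ n
    values m< n< e = trans (sym (FinP.toℕ-fromℕ< m<)) (trans (cong toℕ e) (FinP.toℕ-fromℕ< n<))

    mixed : ∀ x y → left x ≡ right y → Solvable (+ p)
    mixed x y e = + X , + Y , + qx + + qy + + 1 ,
      trans (cong₂ (λ a b → a + b + + 1) (decompose X) (decompose Y))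
      (trans (l (+ left x) (+ qx) (+ ry) (+ qy) (+ p))
        (trans (cong (λ z → z + (+ qx + + qy) * + p) sum) (l′ (+ qx) (+ qy) (+ p))))
      where
      X = toℕ x
      Y = toℕ y
      qx = (X ℕ.* X) / p
      qy = (Y ℕ.* Y) / p
      ry = (Y ℕ.* Y) % p
      sum : + left x + (+ 1 + + ry) ≡ + p
      sum = cong +_ (trans (cong (ℕ._+ suc ry) e) (ℕP.m∸n+n≡m (m%n<n (Y ℕ.* Y) p)))
      l : ∀ r a s b p → (r + a * p) + (s + b * p) + + 1 ≡ (r + (+ 1 + s)) + (a + b) * p
      l = solve-∀
      l′ : ∀ a b p → p + (a + b) * p ≡ (a + b + + 1) * p
      l′ = solve-∀

    cases : ∀ s t → ¬ s ≡ t → box s ≡ box t → Solvable (+ p)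
    cases (inj₁ x) (inj₁ y) ne e =
      ⊥-elim (ne (cong inj₁ (FinP.toℕ-injective
      (collision (toℕ x) (toℕ y) (≤h x) (≤h y) (values (left< x) (left< y) e)))))
    cases (inj₁ x) (inj₂ y) ne e = mixed x y (values (left< x) (right< y) e)
    cases (inj₂ y) (inj₁ x) ne e = mixed x y (sym (values (right< y) (left< x) e))
    cases (inj₂ x) (inj₂ y) ne e =
      ⊥-elim (ne (cong inj₂ (FinP.toℕ-injective (collision (toℕ x) (toℕ y) (≤h x) (≤h y)
      (ℕP.suc-injective (ℕP.∸-cancelˡ-≡ (m%n<n (toℕ x ℕ.* toℕ x) p) (m%n<n (toℕ y ℕ.* toℕ y) p)
        (values (right< x) (right< y) e)))))))

    solvable-prime : Solvable (+ p)
    solvable-prime = found (FinP.pigeonhole size (λ i → box (splitAt (suc h) i)))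
      where
      found : ∃ (λ i → ∃ λ j → i Fin.< j × box (splitAt (suc h) i) ≡ box (splitAt (suc h) j)) → Solvable (+ p)
      found (i , j , i<j , e) = cases (splitAt (suc h) i) (splitAt (suc h) j) (λ eq → FinP.<⇒≢ i<j
        (trans (sym (FinP.join-splitAt (suc h) (suc h) i))
          (trans (cong (join (suc h) (suc h)) eq) (FinP.join-splitAt (suc h) (suc h) j)))) e

  -- Let `n` be the product of the remaining primes. If `p` divides `n`, then `pn` divides `n²` and
  -- lifting from `n` to `n²` is enough; otherwise `p` and `n` are coprime.
  solvable-product : ∀ ps → All Prime ps → 2 ∤ product ps → Solvable (+ product ps)
  solvable-product [] _ _ = + 0 , + 0 , + 1 , refl
  solvable-product (p ∷ ps) (pp ∷ pps) odd = result
    where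
    n = product ps
    oddₚ : 2 ∤ p
    oddₚ d = odd (ℕD.∣m⇒∣m*n n d)
    oddₙ : 2 ∤ n
    oddₙ d = odd (ℕD.∣n⇒∣m*n p d)
    rec : Solvable (+ n)
    rec = solvable-product ps pps oddₙ
    pos : ∀ h → + (2 ℕ.* h ℕ.+ 1) ≡ + 2 * + h + + 1
    pos h = cong (λ z → z + + 1) (ℤP.pos-* 2 h)
    square : Solvable (+ n * + n)
    square = subst (λ z → Solvable (z * z)) (sym eq) (solvable-² (+ proj₁ o) (subst Solvable eq rec))
      where
      o = odd-form n oddₙ
      eq : + n ≡ + 2 * + proj₁ o + + 1
      eq = trans (cong +_ (proj₂ o)) (pos (proj₁ o))
    result : Solvable (+ (p ℕ.* n))
    result with p ℕD.∣? n
    ... | yes (divides c e) = solvable-÷ (+ (p ℕ.* n)) (+ c) (subst Solvable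
        (trans (cong (λ z → + n * + z) e)
          (trans (cong (λ z → + n * z) (ℤP.pos-* c p))
          (trans (l (+ n) (+ c) (+ p)) (cong (_* + c) (sym (ℤP.pos-* p n)))))) square)
      where
      l : ∀ n c p → n * (c * p) ≡ (p * n) * c
      l = solve-∀
    ... | no p∤n = subst Solvable (sym (ℤP.pos-* p n)) (bez (coprime-Bézout coprime))
      where
      coprime : ∀ {d} → (d ∣ p) × (d ∣ n) → d ≡ 1
      coprime (d∣p , d∣n) = [ (λ e → e) , (λ { refl → ⊥-elim (p∤n d∣n) }) ]′ (prime⇒irreducible pp d∣p)
      o = odd-form p oddₚ
      prime-case : Solvable (+ p)
      prime-case = PrimeCase.solvable-prime p (proj₁ o) pp (proj₂ o)
      cast : ∀ a b c d → 1 ℕ.+ a ℕ.* b ≡ c ℕ.* d → + 1 + + a * + b ≡ + c * + d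
      cast a b c d e = trans (cong (λ z → + 1 + z) (sym (ℤP.pos-* a b))) (trans (cong +_ e) (ℤP.pos-* c d))
      l : ∀ {y n} x m → + 1 + y * n ≡ x * m → x * m + (- y) * n ≡ + 1
      l {y} {n} x m e = trans (cong (λ z → z + (- y) * n) (sym e)) (l′ y n)
        where
        l′ : ∀ y n → (+ 1 + y * n) + (- y) * n ≡ + 1
        l′ = solve-∀
      bez : Bézout.Identity 1 p n → Solvable (+ p * + n)
      bez (Bézout.+- x y e) = solvable-* (+ p) (+ n) (+ x) (- + y)
        (l {+ y} {+ n} (+ x) (+ p) (cast y n x p e)) prime-case rec
      bez (Bézout.-+ x y e) = solvable-* (+ p) (+ n) (- + x) (+ y)
        (trans (ℤP.+-comm ((- + x) * + p) (+ y * + n)) (l {+ x} {+ p} (+ y) (+ n) (cast x p y n e)))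
        prime-case rec

  solvable-odd : ∀ n → .{{_ : ℕ.NonZero n}} → 2 ∤ n → Solvable (+ n)
  solvable-odd n odd = subst (λ z →
    Solvable (+ z)) (sym (isFactorisation f))
    (solvable-product (factors f) (factorsPrime f) (subst (2 ∤_) (isFactorisation f) odd))
    where
    f = factorise n
    open PrimeFactorisation

-- Residue systems of ℤ[√2] modulo an element.

module Residues where
  open import Defs hiding (H; K)
  open OKRing hiding (ring)
  open Solver
  open ZArith
  open OKArith hiding (divide)
  open import Data.Integer as ℤ using (ℤ; +_; ∣_∣; 0ℤ; -_; _*_; _+_; _-_; _≟_)
  import Data.Integer.Properties as ℤP
  import Data.Integer.DivMod as ℤD
  open import Data.Integer.Tactic.RingSolver using (solve-∀)
  open import Data.Nat as ℕ using (ℕ; zero; suc)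
  import Data.Nat.Properties as ℕP
  open import Data.List using (List; []; _∷_; length; map; upTo; cartesianProductWith)
  open import Data.List.Properties using (length-++; length-map; length-upTo)
  open import Data.List.Membership.Propositional using (_∈_)
  open import Data.List.Membership.Propositional.Properties using (∈-cartesianProductWith⁺;
    ∈-cartesianProductWith⁻; ∈-upTo⁺; ∈-upTo⁻)
  open import Data.List.Relation.Unary.Unique.Propositional using (Unique)
  open import Data.List.Relation.Unary.Unique.Propositional.Properties using (cartesianProductWith⁺; upTo⁺)
  open import Data.Product using (∃-syntax; _×_; _,_)
  open import Relation.Binary.PropositionalEquality
  open import Relation.Nullary using (¬_)
  open import Data.Empty using (⊥-elim)

  record ResidueSystem (δ : OK) : Set where
    field
      residues : List OK
      length-residues : length residues ≡ Nm δ
      unique : Unique residues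
      complete : ∀ x → ∃[ r ] (r ∈ residues × δ ∣ x -ᴼ r)
      incongruent : ∀ r s → r ∈ residues → s ∈ residues → δ ∣ r -ᴼ s → r ≡ s

  private
    divideℤ : ∀ a b → ¬ b ≡ 0ℤ → ∃[ q ] ∣ a + - (b * q) ∣ ℕ.< ∣ b ∣
    divideℤ a b b≢0 = a ℤD./ b , subst (λ z → ∣ z ∣ ℕ.< ∣ b ∣) eq (ℤD.n%d<d a b)
      where
      instance
        nz : ℤ.NonZero b
        nz = ℤ.≢-nonZero b≢0
      eq : + (a ℤD.% b) ≡ a + - (b * (a ℤD./ b))
      eq = trans (l (+ (a ℤD.% b)) (a ℤD./ b) b) (cong (_+ - (b * (a ℤD./ b))) (sym (ℤD.a≡a%n+[a/n]*n a b)))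
        where
        l : ∀ r q b → r ≡ (r + q * b) + - (b * q)
        l = solve-∀

    module GCDℤ = EuclideanAlgorithm.Euclid ℤP.+-*-ring (_≟ 0ℤ) ∣_∣ divideℤ

    length-product : ∀ {A B C : Set} (f : A → B → C) xs ys →
      length (cartesianProductWith f xs ys) ≡ length xs ℕ.* length ys
    length-product f [] ys = refl
    length-product f (x ∷ xs) ys =
      trans (length-++ (map (f x) ys)) (cong₂ ℕ._+_ (length-map (f x) ys) (length-product f xs ys))

    close : ∀ {x y : ℕ} {n z : ℤ} → x ℕ.< ∣ n ∣ → y ℕ.< ∣ n ∣ → + x - + y ≡ n * z → x ≡ y
    close {x} {y} {n} {z} x< y< e =
      ℤP.+-injective (ℤP.i-j≡0⇒i≡j (+ x) (+ y) (trans e (zero-product ∣ z ∣ refl)))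
      where
      small : ∣ n ∣ ℕ.* ∣ z ∣ ℕ.< ∣ n ∣
      small = subst (ℕ._< ∣ n ∣) (trans (cong ∣_∣ (trans (sym (ℤP.m-n≡m⊖n x y)) e)) (ℤP.abs-* n z))
        (ℕP.≤-<-trans (ℤP.∣m⊝n∣≤m⊔n x y) (ℕP.⊔-lub x< y<))
      zero-product : ∀ k → ∣ z ∣ ≡ k → n * z ≡ 0ℤ
      zero-product zero h = trans (cong (λ z → n * z) (ℤP.∣i∣≡0⇒i≡0 h)) (ℤP.*-zeroʳ n)
      zero-product (suc k) h = ⊥-elim
        (ℕP.<⇒≱ small (subst (λ z → ∣ n ∣ ℕ.≤ ∣ n ∣ ℕ.* z) (sym h) (ℕP.m≤m*n ∣ n ∣ (suc k))))

  -- With g = gcd(a,b), the lattice (a+b√2) has the ℤ-basis N(a+b√2)/g, c+g√2 for some c.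
  module Construction (a b g s t a′ b′ : ℤ) (δ≢0 : ¬ mkO a b ≡ 0ᴼ)
    (bezout : g ≡ a * s + b * t) (ea : a ≡ g * a′) (eb : b ≡ g * b′) where
    δ : OK
    δ = mkO a b
    n : ℤ
    n = a * a′ - + 2 * (b * b′)

    norm-eq : N̂ δ ≡ n * g
    norm-eq = trans (cong₂ (λ x y → a * x - + 2 * (b * y)) ea eb) (l a b g a′ b′)
      where
      l : ∀ a b g a′ b′ → a * (g * a′) - + 2 * (b * (g * b′)) ≡ (a * a′ - + 2 * (b * b′)) * g
      l = solve-∀
    n≢0 : ¬ n ≡ 0ℤ
    n≢0 e = δ≢0 (N̂≡0⇒≡0 δ (trans norm-eq (cong (_* g) e)))
    g≢0 : ¬ g ≡ 0ℤ
    g≢0 e = δ≢0 (N̂≡0⇒≡0 δ (trans norm-eq (trans (cong (λ z → n * z) e) (ℤP.*-zeroʳ n))))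
    instance
      nz-n : ℤ.NonZero n
      nz-n = ℤ.≢-nonZero n≢0
      nz-g : ℤ.NonZero g
      nz-g = ℤ.≢-nonZero g≢0

    κ : OK
    κ = mkO a′ (- b′)
    δκ : δ *ᴼ κ ≡ int n
    δκ = cong₂ mkO (l a b a′ b′) (trans (cong₂ (λ x y → x * (- b′) + y * a′) ea eb) (l′ g a′ b′))
      where
      l : ∀ a b a′ b′ → a * a′ + + 2 * (b * (- b′)) ≡ a * a′ - + 2 * (b * b′)
      l = solve-∀
      l′ : ∀ g a′ b′ → (g * a′) * (- b′) + (g * b′) * a′ ≡ + 0
      l′ = solve-∀
    bezout′ : a′ * s + b′ * t ≡ + 1
    bezout′ = ℤP.*-cancelˡ-≡ g (a′ * s + b′ * t) (+ 1)
      (trans (l g a′ b′ s t) (trans (cong₂ (λ x y → x * s + y * t) (sym ea) (sym eb))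
      (trans (sym bezout) (sym (ℤP.*-identityʳ g)))))
      where
      l : ∀ g a′ b′ s t → g * (a′ * s + b′ * t) ≡ (g * a′) * s + (g * b′) * t
      l = solve-∀

    point : ℕ → ℕ → OK
    point x y = mkO (+ x) (+ y)
    list : List OK
    list = cartesianProductWith point (upTo ∣ n ∣) (upTo ∣ g ∣)

    list-length : length list ≡ Nm δ
    list-length = trans (length-product point (upTo ∣ n ∣) (upTo ∣ g ∣))
      (trans (cong₂ ℕ._*_ (length-upTo ∣ n ∣) (length-upTo ∣ g ∣))
      (trans (sym (ℤP.abs-* n g)) (cong ∣_∣ (sym norm-eq))))

    point-injective : ∀ {w x y z} → point w y ≡ point x z → w ≡ x × y ≡ z
    point-injective refl = refl , refl

    list-complete : ∀ x → ∃[ r ] (r ∈ list × δ ∣ x -ᴼ r)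
    list-complete (mkO X Y) = point x y , ∈-cartesianProductWith⁺ point {upTo ∣ n ∣} {upTo ∣ g ∣}
      (∈-upTo⁺ (ℤD.n%d<d X′ n)) (∈-upTo⁺ (ℤD.n%d<d Y g)) ,
      divides (int qy *ᴼ mkO t s +ᴼ κ *ᴼ int qx) eq
      where
      y = Y ℤD.% g
      qy = Y ℤD./ g
      -- The lattice vector subtracted is `δ(t + s√2)`: its irrational part is `g` by the Bézout
      -- relation and its rational part is `at + 2bs`.
      X′ = X - qy * (a * t + + 2 * (b * s))
      x = X′ ℤD.% n
      qx = X′ ℤD./ n
      im-eq : Y - + y ≡ qy * (a * s + b * t)
      im-eq = trans (cong (_- + y) (ℤD.a≡a%n+[a/n]*n Y g))
        (trans (l (+ y) (qy * g)) (cong (λ z → qy * z) bezout))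
        where
        l : ∀ y z → (y + z) - y ≡ z
        l = solve-∀
      re-eq : X - + x ≡ qy * (a * t + + 2 * (b * s)) + n * qx
      re-eq = trans (l₁ X (qy * (a * t + + 2 * (b * s))) (+ x))
        (trans (cong (λ z → qy * (a * t + + 2 * (b * s)) + (z - + x)) (ℤD.a≡a%n+[a/n]*n X′ n))
        (l₂ (qy * (a * t + + 2 * (b * s))) (+ x) qx n))
        where
        l₁ : ∀ X e x → X - x ≡ e + ((X - e) - x)
        l₁ = solve-∀
        l₂ : ∀ e x q n → e + ((x + q * n) - x) ≡ e + n * q
        l₂ = solve-∀
      eq : mkO X Y -ᴼ point x y ≡ δ *ᴼ (int qy *ᴼ mkO t s +ᴼ κ *ᴼ int qx)
      eq = sym (trans (distrib δ (int qy) (mkO t s) κ (int qx))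
        (trans (cong₂ (λ u v → u +ᴼ v *ᴼ int qx) (int-* qy (δ *ᴼ mkO t s)) δκ)
        (trans (cong (λ v → mkO (qy * re (δ *ᴼ mkO t s)) (qy * im (δ *ᴼ mkO t s)) +ᴼ v) (int-* n (int qx)))
          (cong₂ mkO (sym re-eq) (trans (cong (λ z → qy * (a * s + b * t) + z) (ℤP.*-zeroʳ n))
            (trans (ℤP.+-identityʳ _) (sym im-eq)))))))
        where
        distrib : ∀ d q e k p → d *ᴼ (q *ᴼ e +ᴼ k *ᴼ p) ≡ q *ᴼ (d *ᴼ e) +ᴼ (d *ᴼ k) *ᴼ p
        distrib d q e k p = prove 5 (λ d q e k p → d ⊗ (q ⊗ e ⊕ k ⊗ p) ≐ q ⊗ (d ⊗ e) ⊕ (d ⊗ k) ⊗ p) refl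
          (d ∷ q ∷ e ∷ k ∷ p ∷ [])

    -- κ·r = n·(s₀ + s₁√2) for r = δ(s₀ + s₁√2) rational.
    rational-multiple : ∀ r s₀ s₁ → int r ≡ δ *ᴼ mkO s₀ s₁ → r ≡ n * (s₀ * s - s₁ * t)
    rational-multiple r s₀ s₁ e = trans (sym (ℤP.*-identityʳ r))
      (trans (cong (λ z → r * z) (sym bezout′)) (trans (l₁ r a′ b′ s t)
      (trans (cong₂ (λ x y → x * s - y * t) (cong re κr) (cong im κr)) (l₂ n s₀ s₁ s t))))
      where
      κr : mkO (r * a′) (r * - b′) ≡ mkO (n * s₀) (n * s₁)
      κr = trans (sym (int-* r κ)) (trans (cong (_*ᴼ κ) e)
        (trans (swap δ (mkO s₀ s₁) κ) (trans (cong (_*ᴼ mkO s₀ s₁) δκ) (int-* n (mkO s₀ s₁)))))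
        where
        swap : ∀ d e k → (d *ᴼ e) *ᴼ k ≡ (d *ᴼ k) *ᴼ e
        swap d e k = prove 3 (λ d e k → (d ⊗ e) ⊗ k ≐ (d ⊗ k) ⊗ e) refl (d ∷ e ∷ k ∷ [])
      l₁ : ∀ r a b s t → r * (a * s + b * t) ≡ (r * a) * s - (r * - b) * t
      l₁ = solve-∀
      l₂ : ∀ n x y s t → (n * x) * s - (n * y) * t ≡ n * (x * s - y * t)
      l₂ = solve-∀

    incongruent-points : ∀ x y x' y' → x ℕ.< ∣ n ∣ → y ℕ.< ∣ g ∣ → x' ℕ.< ∣ n ∣ → y' ℕ.< ∣ g ∣ →
      δ ∣ point x y -ᴼ point x' y' → point x y ≡ point x' y'
    incongruent-points x y x' y' x< y< x'< y'< (divides (mkO s₀ s₁) e) = cong₂ point x≡ y≡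
      where
      y≡ : y ≡ y'
      y≡ = close {y} {y'} {g} {a′ * s₁ + b′ * s₀} y< y'<
        (trans (cong im e) (trans (cong₂ (λ p q → p * s₁ + q * s₀) ea eb) (l g a′ b′ s₀ s₁)))
        where
        l : ∀ g a b x y → (g * a) * y + (g * b) * x ≡ g * (a * y + b * x)
        l = solve-∀
      im0 : + y - + y' ≡ + 0
      im0 = trans (cong (λ z → + y - + z) (sym y≡)) (ℤP.+-inverseʳ (+ y))
      x≡ : x ≡ x'
      x≡ = close {x} {x'} {n} {s₀ * s - s₁ * t} x< x'<
        (rational-multiple (+ x - + x') s₀ s₁ (trans (cong (mkO (+ x - + x')) (sym im0)) e))

    system : ResidueSystem δ
    system = record
      { residues = list ; length-residues = list-length
      ; unique = cartesianProductWith⁺ point point-injective (upTo⁺ ∣ n ∣) (upTo⁺ ∣ g ∣)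
      ; complete = list-complete ; incongruent = incongruent }
      where
      incongruent : ∀ r s → r ∈ list → s ∈ list → δ ∣ r -ᴼ s → r ≡ s
      incongruent r s r∈ s∈ d with ∈-cartesianProductWith⁻ point (upTo ∣ n ∣)
        (upTo ∣ g ∣) r∈ | ∈-cartesianProductWith⁻ point (upTo ∣ n ∣) (upTo ∣ g ∣) s∈
      ... | x , y , x∈ , y∈ , refl | x' , y' , x'∈ , y'∈ , refl =
        incongruent-points x y x' y' (∈-upTo⁻ x∈) (∈-upTo⁻ y∈) (∈-upTo⁻ x'∈) (∈-upTo⁻ y'∈) d

  residue-system : ∀ δ → ¬ δ ≡ 0ᴼ → ResidueSystem δ
  residue-system (mkO a b) δ≢0 = Construction.system a b g s t a′ b′ δ≢0 bezout dividesˡ dividesʳ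
    where open GCDℤ.RightGCD (GCDℤ.rightGCD a b)

-- Hermite normal forms and the count for odd norms.

module OddCount where
  open import Defs hiding (H; K)
  open OKRing hiding (ring)
  open Solver
  open Quaternion
  open OKArith hiding (divide)
  open Matrices
  open Counting
  open TwoSquares using (solvable-odd; odd-form; Solvable)
  open Residues
  open Ideals
  open import Data.Integer using (ℤ; +_; -[1+_]; ∣_∣; 0ℤ; -_; _*_; _+_; _-_; _<_)
  import Data.Integer.Properties as ℤP
  open import Data.Integer.Tactic.RingSolver using (solve-∀)
  open import Data.Nat as ℕ using (ℕ)
  import Data.Nat.Properties as ℕP
  import Data.Nat.Divisibility as ℕD
  open import Data.Nat.Primality using (prime[2]; euclidsLemma)
  open import Data.Nat.ListAction using (sum)
  open import Data.List using (List; []; _∷_; map)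
  open import Data.List.Membership.Propositional using (_∈_)
  open import Data.List.Relation.Unary.Unique.Propositional using (Unique)
  open import Data.Product using (∃-syntax; _×_; _,_; proj₁; proj₂)
  open import Data.Sum using ([_,_]′)
  open import Function.Bundles using (_⇔_; mk⇔)
  open import Relation.Binary.PropositionalEquality hiding ([_])
  open import Relation.Nullary using (¬_)

  upper : OK → OK → OK → Quat OK
  upper d b d' = ⟪ d , b , 0ᴼ , d' ⟫

  *-≢0ˡ : ∀ {x y z} → ¬ z ≡ 0ᴼ → x *ᴼ y ≡ z → ¬ x ≡ 0ᴼ
  *-≢0ˡ {x} {y} z≢0 e x≡0 = z≢0 (trans (sym e) (trans (cong (_*ᴼ y) x≡0) (trans (*ᴼ-comm 0ᴼ y) (*ᴼ-zeroʳ y))))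

  *-≢0ʳ : ∀ {x y z} → ¬ z ≡ 0ᴼ → x *ᴼ y ≡ z → ¬ y ≡ 0ᴼ
  *-≢0ʳ {x} {y} z≢0 e = *-≢0ˡ {y} {x} z≢0 (trans (*ᴼ-comm y x) e)

  -- Hermite normal forms: the columns of the matrix lie in the lattice spanned by (d,0) and (b,d').
  module Hermite (m : OK) (m≢0 : ¬ m ≡ 0ᴼ) where
    upper-image : ∀ d b d' X k₁ k₂ c₁ c₂ → q₁ X ≡ d *ᴼ k₁ +ᴼ b *ᴼ c₁ → q₂ X ≡ d *ᴼ k₂ +ᴼ b *ᴼ c₂ →
      q₃ X ≡ d' *ᴼ c₁ → q₄ X ≡ d' *ᴼ c₂ → Im (upper d b d') X
    upper-image d b d' X k₁ k₂ c₁ c₂ e₁ e₂ e₃ e₄ =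
      im-by ⟪ k₁ , k₂ , c₁ , c₂ ⟫ (trans (quat≡ e₁ e₂ e₃ e₄) (sym (upper-mm d b d' ⟪ k₁ , k₂ , c₁ , c₂ ⟫)))

    change-residue : ∀ d b d' r X → d ∣ b -ᴼ r → Im (upper d b d') X → Im (upper d r d') X
    change-residue d b d' r X (divides c e) (im-by U eU) =
      upper-image d r d' X (q₁ U +ᴼ c *ᴼ q₃ U) (q₂ U +ᴼ c *ᴼ q₄ U) (q₃ U) (q₄ U)
        (trans (cong q₁ eX) (l (q₁ U) (q₃ U))) (trans (cong q₂ eX) (l (q₂ U) (q₄ U))) (cong q₃ eX) (cong q₄ eX)
      where
      eX = trans eU (upper-mm d b d' U)
      l : ∀ u v → d *ᴼ u +ᴼ b *ᴼ v ≡ d *ᴼ (u +ᴼ c *ᴼ v) +ᴼ r *ᴼ v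
      l u v = trans (l₁ d u b v r) (trans (cong (λ z → d *ᴼ u +ᴼ z *ᴼ v +ᴼ r *ᴼ v) e) (l₂ d u c v r))
        where
        l₁ : ∀ d u b v r → d *ᴼ u +ᴼ b *ᴼ v ≡ d *ᴼ u +ᴼ (b -ᴼ r) *ᴼ v +ᴼ r *ᴼ v
        l₁ d u b v r = prove 5 (λ d u b v r → d ⊗ u ⊕ b ⊗ v ≐ d ⊗ u ⊕ (b ⊕ (⊝ r)) ⊗ v ⊕ r ⊗ v) refl
          (d ∷ u ∷ b ∷ v ∷ r ∷ [])
        l₂ : ∀ d u c v r → d *ᴼ u +ᴼ d *ᴼ c *ᴼ v +ᴼ r *ᴼ v ≡ d *ᴼ (u +ᴼ c *ᴼ v) +ᴼ r *ᴼ v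
        l₂ d u c v r = prove 5 (λ d u c v r → d ⊗ u ⊕ d ⊗ c ⊗ v ⊕ r ⊗ v ≐ d ⊗ (u ⊕ c ⊗ v) ⊕ r ⊗ v) refl
          (d ∷ u ∷ c ∷ v ∷ r ∷ [])

    record Form (d : OK) (X : Quat OK) : Set where
      constructor form
      field
        b d' : OK
        cofactor : d *ᴼ d' ≡ m
        image : Im (upper d b d') X

    -- Here g is a greatest common divisor of the bottom row (c,e) and m, and m = g·h with h associated to d.
    from-gcd : ∀ a b c e D d g h S T V c₁ c₂ w v → a *ᴼ e -ᴼ b *ᴼ c ≡ m *ᴼ D → c ≡ g *ᴼ c₁ → e ≡ g *ᴼ c₂ →
      m ≡ g *ᴼ h →
      g ≡ c *ᴼ S +ᴼ e *ᴼ T +ᴼ m *ᴼ V → h ≡ d *ᴼ w → d ≡ h *ᴼ v → Form d ⟪ a , b , c , e ⟫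
    from-gcd a b c e D d g h S T V c₁ c₂ w v eD ec ee em eg eh ed = form β d' dd'
      (upper-image d β d' ⟪ a , b , c , e ⟫ k₁ k₂ (v *ᴼ c₁) (v *ᴼ c₂)
        (solve-top a k₁ (v *ᴼ c₁) top₁) (solve-top b k₂ (v *ᴼ c₂) top₂) (bottom c c₁ ec) (bottom e c₂ ee))
      where
      d' = g *ᴼ w
      dd' : d *ᴼ d' ≡ m
      dd' = trans (l d g w) (trans (cong (g *ᴼ_) (sym eh)) (sym em))
        where
        l : ∀ d g w → d *ᴼ (g *ᴼ w) ≡ g *ᴼ (d *ᴼ w)
        l d g w = prove 3 (λ d g w → d ⊗ (g ⊗ w) ≐ g ⊗ (d ⊗ w)) refl (d ∷ g ∷ w ∷ [])
      h≢0 : ¬ h ≡ 0ᴼ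
      h≢0 = *-≢0ʳ {g} {h} m≢0 (sym em)
      wv : w *ᴼ v ≡ oneᴼ
      wv = *ᴼ-cancelˡ h h≢0 (trans (l h w v) (trans (cong (_*ᴼ w) (sym ed)) (trans (sym eh) (sym (*ᴼ-idʳ h)))))
        where
        l : ∀ h w v → h *ᴼ (w *ᴼ v) ≡ h *ᴼ v *ᴼ w
        l h w v = prove 3 (λ h w v → h ⊗ (w ⊗ v) ≐ h ⊗ v ⊗ w) refl (h ∷ w ∷ v ∷ [])
      bottom : ∀ c c₁ → c ≡ g *ᴼ c₁ → c ≡ d' *ᴼ (v *ᴼ c₁)
      bottom c c₁ e = trans e (trans (sym (*ᴼ-idʳ (g *ᴼ c₁)))
        (trans (cong (g *ᴼ c₁ *ᴼ_) (sym wv)) (l g c₁ w v)))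
        where
        l : ∀ g c w v → g *ᴼ c *ᴼ (w *ᴼ v) ≡ g *ᴼ w *ᴼ (v *ᴼ c)
        l g c w v = prove 4 (λ g c w v → g ⊗ c ⊗ (w ⊗ v) ≐ g ⊗ w ⊗ (v ⊗ c)) refl (g ∷ c ∷ w ∷ v ∷ [])
      -- The combination of the columns of the matrix with coefficients `S` and `T` has lower entry
      -- `g − mV`. Scaled by the unit `w` it agrees modulo `m` with the second basis vector
      -- `(β, d')`.
      β = w *ᴼ (a *ᴼ S +ᴼ b *ᴼ T)
      k₁ = w *ᴼ (V *ᴼ a) +ᴼ w *ᴼ (T *ᴼ D)
      k₂ = w *ᴼ (V *ᴼ b) +ᴼ -ᴼ (w *ᴼ (S *ᴼ D))
      d'≢0 : ¬ d' ≡ 0ᴼ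
      d'≢0 = *-≢0ʳ {d} {d'} m≢0 dd'
      d'≡ : d' ≡ w *ᴼ (c *ᴼ S +ᴼ e *ᴼ T +ᴼ m *ᴼ V)
      d'≡ = trans (*ᴼ-comm g w) (cong (w *ᴼ_) eg)
      solve-top : ∀ a k c → d' *ᴼ (a -ᴼ β *ᴼ c) ≡ m *ᴼ k → a ≡ d *ᴼ k +ᴼ β *ᴼ c
      solve-top a k c e = trans (l a (β *ᴼ c))
        (cong (_+ᴼ β *ᴼ c) (*ᴼ-cancelˡ d' d'≢0
        (trans e (trans (cong (_*ᴼ k) (trans (sym dd') (*ᴼ-comm d d'))) (*ᴼ-assoc d' d k)))))
        where
        l : ∀ a y → a ≡ (a -ᴼ y) +ᴼ y
        l a y = prove 2 (λ a y → a ≐ (a ⊕ (⊝ y)) ⊕ y) refl (a ∷ y ∷ [])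
      l₁ : ∀ d a β c → d *ᴼ (a -ᴼ β *ᴼ c) ≡ d *ᴼ a -ᴼ β *ᴼ (d *ᴼ c)
      l₁ d a β c = prove 4 (λ d a β c → d ⊗ (a ⊕ (⊝ (β ⊗ c))) ≐ d ⊗ a ⊕ (⊝ (β ⊗ (d ⊗ c)))) refl
        (d ∷ a ∷ β ∷ c ∷ [])
      top₁ : d' *ᴼ (a -ᴼ β *ᴼ (v *ᴼ c₁)) ≡ m *ᴼ k₁
      top₁ = trans (l₁ d' a β (v *ᴼ c₁))
        (trans (cong₂ (λ x y → x *ᴼ a -ᴼ β *ᴼ y) d'≡ (sym (bottom c c₁ ec)))
        (trans (l₂ a b c e S T V m w) (trans (cong (λ z → m *ᴼ (w *ᴼ (V *ᴼ a)) +ᴼ w *ᴼ (T *ᴼ z)) eD)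
        (l₃ m V a w T D))))
        where
        l₂ : ∀ a b c e S T V m w → w *ᴼ (c *ᴼ S +ᴼ e *ᴼ T +ᴼ m *ᴼ V) *ᴼ a -ᴼ w *ᴼ (a *ᴼ S +ᴼ b *ᴼ T) *ᴼ c
          ≡ m *ᴼ (w *ᴼ (V *ᴼ a)) +ᴼ w *ᴼ (T *ᴼ (a *ᴼ e -ᴼ b *ᴼ c))
        l₂ a b c e S T V m w = prove 9 (λ a b c e S T V m w →
          w ⊗ (c ⊗ S ⊕ e ⊗ T ⊕ m ⊗ V) ⊗ a ⊕ (⊝ (w ⊗ (a ⊗ S ⊕ b ⊗ T) ⊗ c))
          ≐ m ⊗ (w ⊗ (V ⊗ a)) ⊕ w ⊗ (T ⊗ (a ⊗ e ⊕ (⊝ (b ⊗ c))))) refl (a ∷ b ∷ c ∷ e ∷ S ∷ T ∷ V ∷ m ∷ w ∷ [])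
        l₃ : ∀ m V a w T D → m *ᴼ (w *ᴼ (V *ᴼ a)) +ᴼ w *ᴼ (T *ᴼ (m *ᴼ D))
          ≡ m *ᴼ (w *ᴼ (V *ᴼ a) +ᴼ w *ᴼ (T *ᴼ D))
        l₃ m V a w T D = prove 6 (λ m V a w T D →
          m ⊗ (w ⊗ (V ⊗ a)) ⊕ w ⊗ (T ⊗ (m ⊗ D)) ≐ m ⊗ (w ⊗ (V ⊗ a) ⊕ w ⊗ (T ⊗ D))) refl
          (m ∷ V ∷ a ∷ w ∷ T ∷ D ∷ [])
      top₂ : d' *ᴼ (b -ᴼ β *ᴼ (v *ᴼ c₂)) ≡ m *ᴼ k₂
      top₂ = trans (l₁ d' b β (v *ᴼ c₂))
        (trans (cong₂ (λ x y → x *ᴼ b -ᴼ β *ᴼ y) d'≡ (sym (bottom e c₂ ee)))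
        (trans (l₂ a b c e S T V m w) (trans (cong (λ z → m *ᴼ (w *ᴼ (V *ᴼ b)) -ᴼ w *ᴼ (S *ᴼ z)) eD)
        (l₃ m V b w S D))))
        where
        l₂ : ∀ a b c e S T V m w → w *ᴼ (c *ᴼ S +ᴼ e *ᴼ T +ᴼ m *ᴼ V) *ᴼ b -ᴼ w *ᴼ (a *ᴼ S +ᴼ b *ᴼ T) *ᴼ e
          ≡ m *ᴼ (w *ᴼ (V *ᴼ b)) -ᴼ w *ᴼ (S *ᴼ (a *ᴼ e -ᴼ b *ᴼ c))
        l₂ a b c e S T V m w = prove 9 (λ a b c e S T V m w →
          w ⊗ (c ⊗ S ⊕ e ⊗ T ⊕ m ⊗ V) ⊗ b ⊕ (⊝ (w ⊗ (a ⊗ S ⊕ b ⊗ T) ⊗ e))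
          ≐ m ⊗ (w ⊗ (V ⊗ b)) ⊕ (⊝ (w ⊗ (S ⊗ (a ⊗ e ⊕ (⊝ (b ⊗ c))))))) refl
          (a ∷ b ∷ c ∷ e ∷ S ∷ T ∷ V ∷ m ∷ w ∷ [])
        l₃ : ∀ m V b w S D → m *ᴼ (w *ᴼ (V *ᴼ b)) -ᴼ w *ᴼ (S *ᴼ (m *ᴼ D))
          ≡ m *ᴼ (w *ᴼ (V *ᴼ b) +ᴼ -ᴼ (w *ᴼ (S *ᴼ D)))
        l₃ m V b w S D = prove 6 (λ m V b w S D → m ⊗ (w ⊗ (V ⊗ b)) ⊕ (⊝ (w ⊗ (S ⊗ (m ⊗ D))))
          ≐ m ⊗ (w ⊗ (V ⊗ b) ⊕ (⊝ (w ⊗ (S ⊗ D))))) refl (m ∷ V ∷ b ∷ w ∷ S ∷ D ∷ [])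

    hermite : ∀ (ds : List OK) → (∀ δ → δ ∣ m → ∃[ d ] (d ∈ ds × (d ∣ δ) × (δ ∣ d))) →
      ∀ X D → det X ≡ m *ᴼ D → ∃[ d ] (d ∈ ds × Form d X)
    hermite ds complete ⟪ a , b , c , e ⟫ D eD = go (GCDᴼ.rightGCD c e)
      where
      go : GCDᴼ.RightGCD c e → ∃[ d ] (d ∈ ds × Form d ⟪ a , b , c , e ⟫)
      go G = go′ (GCDᴼ.rightGCD G.g m)
        where
        module G = GCDᴼ.RightGCD G
        go′ : GCDᴼ.RightGCD G.g m → ∃[ d ] (d ∈ ds × Form d ⟪ a , b , c , e ⟫)
        go′ G′ = finish (complete G′.b′ (divides G′.g (trans G′.dividesʳ (*ᴼ-comm G′.g G′.b′))))
          where
          module G′ = GCDᴼ.RightGCD G′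
          finish : ∃[ d ] (d ∈ ds × (d ∣ G′.b′) × (G′.b′ ∣ d)) → ∃[ d ] (d ∈ ds × Form d ⟪ a , b , c , e ⟫)
          finish (d , d∈ , divides w eh , divides v ed) = d , d∈ ,
            from-gcd a b c e D d G′.g G′.b′ (G.s *ᴼ G′.s) (G.t *ᴼ G′.s) G′.t (G′.a′ *ᴼ G.a′) (G′.a′ *ᴼ G.b′) w v
              (trans (sym (det-entries a b c e)) eD)
              (trans G.dividesˡ (trans (cong (_*ᴼ G.a′) G′.dividesˡ) (*ᴼ-assoc G′.g G′.a′ G.a′)))
              (trans G.dividesʳ (trans (cong (_*ᴼ G.b′) G′.dividesˡ) (*ᴼ-assoc G′.g G′.a′ G.b′)))
              G′.dividesʳ
              (trans G′.bezout (trans (cong (λ z → z *ᴼ G′.s +ᴼ m *ᴼ G′.t) G.bezout)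
                (l c G.s e G.t G′.s m G′.t)))
              eh ed
            where
            l : ∀ c s e t u m v → (c *ᴼ s +ᴼ e *ᴼ t) *ᴼ u +ᴼ m *ᴼ v ≡ c *ᴼ (s *ᴼ u) +ᴼ e *ᴼ (t *ᴼ u) +ᴼ m *ᴼ v
            l c s e t u m v = prove 7 (λ c s e t u m v →
              (c ⊗ s ⊕ e ⊗ t) ⊗ u ⊕ m ⊗ v ≐ c ⊗ (s ⊗ u) ⊕ e ⊗ (t ⊗ u) ⊕ m ⊗ v) refl
              (c ∷ s ∷ e ∷ t ∷ u ∷ m ∷ v ∷ [])

    -- From det X = m(1 + mQ) and X = A₁U it follows that det U ≡ 1 modulo m, so A₁ ≡ X·adj U modulo m.
    transfer : ∀ A₁ A₂ X Q → det A₁ ≡ m → det A₂ ≡ m → det X ≡ m *ᴼ (oneᴼ +ᴼ m *ᴼ Q) → Im A₁ X → Im A₂ X →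
      Im A₂ A₁
    transfer A₁ A₂ X Q d₁ d₂ dX (im-by U eU) i₂ = subst (Im A₂) (sym (move A₁ m (Q • A₁) eq))
      (Im-+ {A₂} (Im-mm {A₂} (adj U) i₂)
        (subst (λ z → Im A₂ (z • negᵠ (Q • A₁))) d₂ (Im-det A₂ (negᵠ (Q • A₁)))))
      where
      detU : det U ≡ oneᴼ +ᴼ m *ᴼ Q
      detU = *ᴼ-cancelˡ m m≢0 (trans (cong (_*ᴼ det U) (sym d₁))
        (trans (sym (det-mm A₁ U)) (trans (cong det (sym eU)) dX)))
      eq : mm X (adj U) ≡ A₁ +ᵠ m • (Q • A₁)
      eq = trans (cong (λ z → mm z (adj U)) eU)
        (trans (mm-adjʳ U A₁) (trans (cong (_• A₁) detU)
        (quat≡ (l (q₁ A₁)) (l (q₂ A₁)) (l (q₃ A₁)) (l (q₄ A₁)))))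
        where
        l : ∀ a → (oneᴼ +ᴼ m *ᴼ Q) *ᴼ a ≡ a +ᴼ m *ᴼ (Q *ᴼ a)
        l a = prove 3 (λ m Q a → (Κ oneᴼ ⊕ m ⊗ Q) ⊗ a ≐ a ⊕ m ⊗ (Q ⊗ a)) refl (m ∷ Q ∷ a ∷ [])

    -- Two lattices in Hermite normal form with the same index, one contained in the other: the
    -- diagonal entries are compared by divisibility, then the upper right entries modulo the common
    -- first entry.
    module Entries (d₁ b₁ d₁' d₂ b₂ d₂' : OK) (e₁ : d₁ *ᴼ d₁' ≡ m) (e₂ : d₂ *ᴼ d₂' ≡ m)
      (i : Im (upper d₂ b₂ d₂') (upper d₁ b₁ d₁')) where
      Z : Quat OK
      Z = Im.preimage i
      eq : upper d₁ b₁ d₁' ≡ ⟪ d₂ *ᴼ q₁ Z +ᴼ b₂ *ᴼ q₃ Z , d₂ *ᴼ q₂ Z +ᴼ b₂ *ᴼ q₄ Z , d₂' *ᴼ q₃ Z , d₂' *ᴼ q₄ Z ⟫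
      eq = trans (Im.image-eq i) (upper-mm d₂ b₂ d₂' Z)
      d₂'≢0 : ¬ d₂' ≡ 0ᴼ
      d₂'≢0 = *-≢0ʳ {d₂} {d₂'} m≢0 e₂
      z₃≡0 : q₃ Z ≡ 0ᴼ
      z₃≡0 = *ᴼ-cancel-0 d₂' (q₃ Z) d₂'≢0 (sym (cong q₃ eq))
      divides-d : d₂ ∣ d₁
      divides-d = divides (q₁ Z) (trans (cong q₁ eq)
        (trans (cong (λ z → d₂ *ᴼ q₁ Z +ᴼ b₂ *ᴼ z) z₃≡0)
        (trans (cong (d₂ *ᴼ q₁ Z +ᴼ_) (*ᴼ-zeroʳ b₂)) (+ᴼ-idʳ (d₂ *ᴼ q₁ Z)))))
      divides-b : d₁ ≡ d₂ → d₂ ∣ b₁ -ᴼ b₂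
      divides-b refl = divides (q₂ Z)
        (trans (cong (_-ᴼ b₂) (trans (cong q₂ eq) (cong (λ z → d₂ *ᴼ q₂ Z +ᴼ b₂ *ᴼ z) z₄≡1))) (l d₂ (q₂ Z) b₂))
        where
        d'≡ : d₁' ≡ d₂'
        d'≡ = *ᴼ-cancelˡ d₂ (*-≢0ˡ {d₂} {d₂'} m≢0 e₂) (trans e₁ (sym e₂))
        z₄≡1 : q₄ Z ≡ oneᴼ
        z₄≡1 = *ᴼ-cancelˡ d₂' d₂'≢0 (trans (sym (cong q₄ eq)) (trans d'≡ (sym (*ᴼ-idʳ d₂'))))
        l : ∀ d z b → (d *ᴼ z +ᴼ b *ᴼ oneᴼ) -ᴼ b ≡ d *ᴼ z
        l d z b = prove 3 (λ d z b → (d ⊗ z ⊕ b ⊗ Κ oneᴼ) ⊕ (⊝ b) ≐ d ⊗ z) refl (d ∷ z ∷ b ∷ [])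

  module Assembly (m p q ρ' : OK) (0<m : 0ℤ < re m) (0<Nm : 0ℤ < N̂ m)
    (ρ≡ : Representation.ρ p q ≡ int (N̂ m) *ᴼ int (N̂ m) *ᴼ ρ') where
    open Representation p q
    open Generators m p q ρ' 0<m 0<Nm
    m≢0′ : ¬ m ≡ 0ᴼ
    m≢0′ = m≢0 ρ≡
    open Hermite m m≢0′

    R : OK → 𝒪 → Set
    R d x = N x ≡ m × Form d (φ x)

    Q : 𝒪 → OK
    Q x = m̄ *ᴼ (m̄ *ᴼ ρ') *ᴼ det-defect x

    -- The defect is divisible by `m²`, so the determinant is `m` even modulo `m²`. Dividing by a
    -- determinant `m` then leaves something congruent to 1 modulo `m`, as `transfer` requires.
    det-φ : ∀ x → N x ≡ m → det (φ x) ≡ m *ᴼ (oneᴼ +ᴼ m *ᴼ Q x)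
    det-φ x e = trans (φ-det x) (trans (cong₂ (λ y z →
      y +ᴼ z *ᴼ det-defect x) e (trans (ρ≡m ρ≡) (cong (λ z → m *ᴼ (z *ᴼ (m̄ *ᴼ ρ'))) (sym (*-conjᴼ m)))))
      (l m m̄ ρ' (det-defect x)))
      where
      l : ∀ m m̄ r z → m +ᴼ m *ᴼ (m *ᴼ m̄ *ᴼ (m̄ *ᴼ r)) *ᴼ z ≡ m *ᴼ (oneᴼ +ᴼ m *ᴼ (m̄ *ᴼ (m̄ *ᴼ r) *ᴼ z))
      l m m̄ r z = prove 4 (λ m m̄ r z →
        m ⊕ m ⊗ (m ⊗ m̄ ⊗ (m̄ ⊗ r)) ⊗ z ≐ m ⊗ (Κ oneᴼ ⊕ m ⊗ (m̄ ⊗ (m̄ ⊗ r) ⊗ z))) refl (m ∷ m̄ ∷ r ∷ z ∷ [])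

    det-upper : ∀ d b d' → d *ᴼ d' ≡ m → det (upper d b d') ≡ m
    det-upper d b d' e = trans (upper-det d b d') e

    forms-divide : ∀ d₁ d₂ x → R d₁ x → R d₂ x → d₂ ∣ d₁
    forms-divide d₁ d₂ x (e , form b₁ d₁' c₁ i₁) (_ , form b₂ d₂' c₂ i₂) =
      Entries.divides-d d₁ b₁ d₁' d₂ b₂ d₂' c₁ c₂
      (transfer (upper d₁ b₁ d₁') (upper d₂ b₂ d₂') (φ x) (Q x) (det-upper d₁ b₁ d₁' c₁)
        (det-upper d₂ b₂ d₂' c₂) (det-φ x e) i₁ i₂)

    forms-congruent : ∀ d d' b₁ b₂ x → N x ≡ m → d *ᴼ d' ≡ m → Im (upper d b₁ d') (φ x) →
      Im (upper d b₂ d') (φ x) → d ∣ b₁ -ᴼ b₂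
    forms-congruent d d' b₁ b₂ x e c i₁ i₂ = Entries.divides-b d b₁ d' d b₂ d' c c
      (transfer (upper d b₁ d') (upper d b₂ d') (φ x) (Q x) (det-upper d b₁ d' c) (det-upper d b₂ d' c)
        (det-φ x e) i₁ i₂) refl

    -- The entry `d'` is determined by `d`, and the upper right entry matters only modulo `d`. So
    -- there are `Nm d` lattices; their ideals share no element of norm `m`, and each has 48 such
    -- elements.
    count-R : ∀ d → d ∣ m → Count (R d) (Nm d ℕ.* 48)
    count-R d (divides d' e) = count-with (residue-system d (*-≢0ˡ {d} {d'} m≢0′ (sym e)))
      where
      count-with : ResidueSystem d → Count (R d) (Nm d ℕ.* 48)
      count-with S = subst (Count (R d)) (trans (∑-const residues 48) (cong (ℕ._* 48) length-residues))
        (count-resp to-R (count-⋃ residues (λ b x → N x ≡ m × Im (upper d b d') (φ x)) (λ _ → 48) unique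
          (λ b _ → ideal-count ρ≡ (upper d b d') (det-upper d b d' (sym e)))
          (λ b b' x b∈ b'∈ (ex , i) (_ , i') →
            incongruent b b' b∈ b'∈ (forms-congruent d d' b b' x ex (sym e) i i'))))
        where
        open ResidueSystem S
        to-R : ∀ x → (∃[ b ] (b ∈ residues × N x ≡ m × Im (upper d b d') (φ x))) ⇔ R d x
        to-R x = mk⇔ (λ (b , _ , ex , i) → ex , form b d' (sym e) i) back
          where
          back : R d x → ∃[ b ] (b ∈ residues × N x ≡ m × Im (upper d b d') (φ x))
          back (ex , form b d'' c i) = reduce (complete b)
            where
            i′ : Im (upper d b d') (φ x)
            i′ = subst (λ z → Im (upper d b z) (φ x))
              (*ᴼ-cancelˡ d {d''} {d'} (*-≢0ˡ {d} {d'} m≢0′ (sym e)) (trans c e)) i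
            reduce : ∃[ r ] (r ∈ residues × d ∣ b -ᴼ r) →
              ∃[ b ] (b ∈ residues × N x ≡ m × Im (upper d b d') (φ x))
            reduce (r , r∈ , d∣) = r , r∈ , ex , change-residue d b d' r (φ x) d∣ i′

    total : ∀ (ds : List OK) → Unique ds → (∀ d → d ∈ ds → d ∣ m) →
      (∀ δ → δ ∣ m → ∃[ d ] (d ∈ ds × (d ∣ δ) × (δ ∣ d))) →
      (∀ d d' → d ∈ ds → d' ∈ ds → d ∣ d' → d' ∣ d → d ≡ d') → Count (λ x → N x ≡ m) (48 ℕ.* sum (map Nm ds))
    total ds u divisor complete nonassociate = subst (Count (λ x → N x ≡ m)) arith
      (count-resp whole (count-⋃ ds R (λ d → Nm d ℕ.* 48) u (λ d d∈ → count-R d (divisor d d∈))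
        (λ d d' x d∈ d'∈ r r' → nonassociate d d' d∈ d'∈ (forms-divide d' d x r' r)
          (forms-divide d d' x r r'))))
      where
      whole : ∀ x → (∃[ d ] (d ∈ ds × R d x)) ⇔ (N x ≡ m)
      whole x = mk⇔ (λ (_ , _ , e , _) → e) back
        where
        back : N x ≡ m → ∃[ d ] (d ∈ ds × R d x)
        back e = attach (hermite ds complete (φ x) (oneᴼ +ᴼ m *ᴼ Q x) (det-φ x e))
          where
          attach : ∃[ d ] (d ∈ ds × Form d (φ x)) → ∃[ d ] (d ∈ ds × R d x)
          attach (d , d∈ , f) = d , d∈ , e , f
      arith : ∑ ds (λ d → Nm d ℕ.* 48) ≡ 48 ℕ.* sum (map Nm ds)
      arith = trans (∑-cong ds (λ d _ → ℕP.*-comm (Nm d) 48)) (∑-* ds 48 Nm)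

  √2∣-even : ∀ a b k → a ≡ + 2 * k → √2ᴼ ∣ mkO a b
  √2∣-even a b k e = divides (mkO b k) (cong₂ mkO (trans e (l b k)) (l′ b k))
    where
    l : ∀ b k → + 2 * k ≡ + 0 * b + + 2 * (+ 1 * k)
    l = solve-∀
    l′ : ∀ b k → b ≡ + 0 * k + + 1 * b
    l′ = solve-∀

  private
    abs-even : ∀ a → 2 ℕD.∣ ∣ a ∣ → ∃[ k ] a ≡ + 2 * k
    abs-even (+ n) (ℕD.divides k e) = + k , trans (cong +_ (trans e (ℕP.*-comm k 2))) (ℤP.pos-* 2 k)
    abs-even -[1+ n ] (ℕD.divides k e) = - + k , trans (cong (λ z → - (+ z)) (trans e (ℕP.*-comm k 2)))
      (trans (cong -_ (ℤP.pos-* 2 k)) (ℤP.neg-distribʳ-* (+ 2) (+ k)))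

    abs-divides : ∀ x y → x ≡ + 2 * y → 2 ℕD.∣ ∣ x ∣
    abs-divides x y e = ℕD.divides ∣ y ∣ (trans (cong ∣_∣ e) (trans (ℤP.abs-* (+ 2) y) (ℕP.*-comm 2 ∣ y ∣)))

  odd-norm : ∀ m → ¬ √2ᴼ ∣ m → ¬ 2 ℕD.∣ Nm m
  odd-norm (mkO a b) odd d = odd (√2∣-even a b (proj₁ half-a) (proj₂ half-a))
    where
    h = abs-even (a * a - + 2 * (b * b)) d
    l : ∀ x y → x ≡ (x - + 2 * y) + + 2 * y
    l = solve-∀
    aa : a * a ≡ + 2 * (proj₁ h + b * b)
    aa = trans (l (a * a) (b * b))
      (trans (cong (_+ + 2 * (b * b)) (proj₂ h)) (sym (ℤP.*-distribˡ-+ (+ 2) (proj₁ h) (b * b))))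
    half-a : ∃[ k ] a ≡ + 2 * k
    half-a = abs-even a ([ (λ z → z) , (λ z →
      z) ]′ (euclidsLemma ∣ a ∣ ∣ a ∣ prime[2]
      (subst (2 ℕD.∣_) (ℤP.abs-* a a) (abs-divides (a * a) (proj₁ h + b * b) aa))))

  -- From a² + b² + 1 = kM with M = 2h+1 odd: p = √2c and q = b with 2c ≡ a + b + 1 modulo M.
  module Conic (M h a b k : ℤ) (M≡ : M ≡ + 2 * h + + 1) (e : a * a + b * b + + 1 ≡ k * M) where
    t c P Z : ℤ
    t = a + b + + 1
    c = t * (h + + 1)
    P = + 2 * (c * c) + b * b + b + + 1 - + 2 * (c * (+ 1 + b))
    Z = (h + + 1) * (k + + 2 * (a * t) + t * t * M) - P
    -- Since `2c = t + tM`, completing the square gives `2P = (a + tM)² + b² + 1`, which is a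
    -- multiple of `M`. As `2(h + 1) = M + 1`, one recovers `P` as `(h + 1)·2P − MP`.
    P≡ : P ≡ M * Z
    P≡ = trans (l₁ a b h) (trans (cong (λ z →
      (h + + 1) * (z + + 2 * (a * t) * M′ + t * t * M′ * M′) - M′ * P) (trans e (cong (λ z → k * z) M≡)))
        (trans (l₂ h k a t M′ P) (cong (λ z → z * ((h + + 1) * (k + + 2 * (a * t) + t * t * z) - P)) (sym M≡))))
      where
      M′ = + 2 * h + + 1
      l₁ : ∀ a b h → let t = a + b + + 1 ; c = t * (h + + 1) ; M = + 2 * h + + 1
                         P = + 2 * (c * c) + b * b + b + + 1 - + 2 * (c * (+ 1 + b)) in
        P ≡ (h + + 1) * ((a * a + b * b + + 1) + + 2 * (a * t) * M + t * t * M * M) - M * P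
      l₁ = solve-∀
      l₂ : ∀ h k a t M P → (h + + 1) * (k * M + + 2 * (a * t) * M + t * t * M * M) - M * P
        ≡ M * ((h + + 1) * (k + + 2 * (a * t) + t * t * M) - P)
      l₂ = solve-∀
    p q : OK
    p = mkO (+ 0) c
    q = mkO b (+ 0)
    ρ-int : p *ᴼ p +ᴼ q *ᴼ q +ᴼ q +ᴼ oneᴼ +ᴼ -ᴼ (√2ᴼ *ᴼ p *ᴼ (oneᴼ +ᴼ q)) ≡ int P
    ρ-int = cong₂ mkO (l c b) (l′ c b)
      where
      l : ∀ c b → + 0 * + 0 + + 2 * (c * c) + (b * b + + 2 * (+ 0 * + 0)) + b + + 1
        + - ((+ 0 * + 0 + + 2 * (+ 1 * c)) * (+ 1 + b) + + 2 * ((+ 0 * c + + 1 * + 0) * (+ 0 + + 0)))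
        ≡ + 2 * (c * c) + b * b + b + + 1 - + 2 * (c * (+ 1 + b))
      l = solve-∀
      l′ : ∀ c b → + 0 * c + c * + 0 + (b * + 0 + + 0 * b) + + 0 + + 0
        + - ((+ 0 * + 0 + + 2 * (+ 1 * c)) * (+ 0 + + 0) + (+ 0 * c + + 1 * + 0) * (+ 1 + b)) ≡ + 0
      l′ = solve-∀

  -- Every x of norm m lies in exactly one of the right ideals attached to the sublattices of O_K² of
  -- index m, and each of these ideals is principal, with 48 generators of norm m.
  odd-count : ∀ m → 0ℤ < re m → 0ℤ < N̂ m → ¬ √2ᴼ ∣ m → (ds : List OK) → Unique ds → (∀ d → d ∈ ds → d ∣ m) →
    (∀ δ → δ ∣ m → ∃[ d ] (d ∈ ds × (d ∣ δ) × (δ ∣ d))) →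
      (∀ d d' → d ∈ ds → d' ∈ ds → d ∣ d' → d' ∣ d → d ≡ d') →
    Count (λ x → N x ≡ m) (48 ℕ.* sum (map Nm ds))
  odd-count m 0<m 0<Nm odd = go (solvable-odd (n ℕ.* n) {{ℕP.m*n≢0 n n}} odd-nn)
    where
    n = Nm m
    instance
      n≢0 : ℕ.NonZero n
      n≢0 = ℕ.≢-nonZero (λ e → ℤP.<-irrefl (sym (ℤP.∣i∣≡0⇒i≡0 e)) 0<Nm)
    odd-nn : ¬ 2 ℕD.∣ n ℕ.* n
    odd-nn d = odd-norm m odd ([ (λ z → z) , (λ z → z) ]′ (euclidsLemma n n prime[2] d))
    o = odd-form (n ℕ.* n) odd-nn
    go : Solvable (+ (n ℕ.* n)) → _
    go (a , b , k , e) = Assembly.total m p q (int Z) 0<m 0<Nm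
      (trans (Representation.ρ-def p q)
        (trans ρ-int (trans (cong int P≡)
        (sym (trans (cong (_*ᴼ int Z) (int-int (N̂ m) (N̂ m)))
        (trans (int-int (N̂ m * N̂ m) Z) (cong (λ z → int (z * Z)) nn)))))))
      where
      open Conic (+ (n ℕ.* n)) (+ proj₁ o) a b k
        (trans (cong +_ (proj₂ o)) (cong (λ z → z + + 1) (ℤP.pos-* 2 (proj₁ o)))) e
      int-int : ∀ x y → int x *ᴼ int y ≡ int (x * y)
      int-int x y = trans (int-* x (int y)) (cong (mkO (x * y)) (ℤP.*-zeroʳ x))
      nn : N̂ m * N̂ m ≡ + (n ℕ.* n)
      nn = trans (cong₂ _*_ N̂≡ N̂≡) (sym (ℤP.pos-* n n))
        where
        N̂≡ : N̂ m ≡ + n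
        N̂≡ = sym (ℤP.0≤i⇒+∣i∣≡i (ℤP.<⇒≤ 0<Nm))

-- Reduction modulo 2 and exhaustive checks on the residues.

module Mod2 where
  open import Defs hiding (H; K)
  open OKRing hiding (ring)
  open Solver
  open Quaternion
  open OKArith hiding (divide)
  open import Data.Integer using (ℤ; +_; ∣_∣; -_; _*_; _+_; _-_)
  import Data.Integer.Properties as ℤP
  open import Data.Integer.DivMod using (_/ℕ_; _%ℕ_; n%ℕd<d; a≡a%ℕn+[a/ℕn]*n)
  open import Data.Integer.Tactic.RingSolver using (solve-∀)
  open import Data.Nat as ℕ using (ℕ; zero; suc)
  import Data.Nat.Properties as ℕP
  open import Data.Bool using (Bool; true; false; _xor_; _∧_; _∨_; not)
  import Data.Bool.Properties as BoolP
  open import Data.Fin using (Fin)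
  open import Data.Vec using (lookup)
  import Data.Vec as Vec
  import Data.Vec.Properties as VecP
  open import Data.Product using (∃-syntax; _×_; _,_; proj₁; proj₂)
  open import Data.Empty using (⊥-elim)
  open import Relation.Binary.PropositionalEquality
  open import Relation.Nullary using (¬_)

  bit : Bool → ℤ
  bit false = + 0
  bit true = + 1

  odd : ℕ → Bool
  odd zero = false
  odd (suc zero) = true
  odd (suc (suc n)) = odd n

  parity : ℤ → Bool
  parity z = odd (z %ℕ 2)

  parity-form : ∀ z → ∃[ k ] z ≡ + 2 * k + bit (parity z)
  parity-form z = z /ℕ 2 , trans (a≡a%ℕn+[a/ℕn]*n z 2)
    (trans (cong (_+ (z /ℕ 2) * + 2) (small (z %ℕ 2) (n%ℕd<d z 2))) (l (bit (parity z)) (z /ℕ 2)))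
    where
    small : ∀ r → r ℕ.< 2 → + r ≡ bit (odd r)
    small 0 _ = refl
    small 1 _ = refl
    small (suc (suc r)) (ℕ.s≤s (ℕ.s≤s ()))
    l : ∀ b q → b + q * + 2 ≡ + 2 * q + b
    l = solve-∀

  private
    2k≢1 : ∀ k → ¬ + 2 * k ≡ + 1
    2k≢1 k e = ℕ2k≢1 ∣ k ∣ (trans (sym (ℤP.abs-* (+ 2) k)) (cong ∣_∣ e))
      where
      ℕ2k≢1 : ∀ k → ¬ 2 ℕ.* k ≡ 1
      ℕ2k≢1 (suc k) e = ℕP.1+n≢0 (ℕP.suc-injective (trans (sym (cong suc (ℕP.+-suc k (k ℕ.+ 0)))) e))

    same-bit : ∀ k l b c → + 2 * k + bit b ≡ + 2 * l + bit c → b ≡ c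
    same-bit k l false false e = refl
    same-bit k l true true e = refl
    same-bit k l false true e = ⊥-elim (2k≢1 (k - l) (trans (d k l) (trans (cong (_- + 2 * l) e) (d′ l))))
      where
      d : ∀ k l → + 2 * (k - l) ≡ (+ 2 * k + + 0) - + 2 * l
      d = solve-∀
      d′ : ∀ l → (+ 2 * l + + 1) - + 2 * l ≡ + 1
      d′ = solve-∀
    same-bit k l true false e = ⊥-elim (2k≢1 (l - k) (trans (d l k) (trans (cong (_- + 2 * k) (sym e)) (d′ k))))
      where
      d : ∀ k l → + 2 * (k - l) ≡ (+ 2 * k + + 0) - + 2 * l
      d = solve-∀
      d′ : ∀ l → (+ 2 * l + + 1) - + 2 * l ≡ + 1
      d′ = solve-∀

  parity-unique : ∀ z k b → z ≡ + 2 * k + bit b → parity z ≡ b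
  parity-unique z k b e = same-bit (proj₁ (parity-form z)) k (parity z) b
    (trans (sym (proj₂ (parity-form z))) e)

  parity-+ : ∀ a b → parity (a + b) ≡ parity a xor parity b
  parity-+ a b = go (parity a) (parity b) (parity-form a) (parity-form b)
    where
    go : ∀ x y → ∃[ k ] a ≡ + 2 * k + bit x → ∃[ k ] b ≡ + 2 * k + bit y → parity (a + b) ≡ x xor y
    go false y (k , e) (l , f) = parity-unique (a + b) (k + l) y (trans (cong₂ _+_ e f) (h k l (bit y)))
      where
      h : ∀ k l c → (+ 2 * k + + 0) + (+ 2 * l + c) ≡ + 2 * (k + l) + c
      h = solve-∀
    go true false (k , e) (l , f) = parity-unique (a + b) (k + l) true (trans (cong₂ _+_ e f) (h k l))
      where
      h : ∀ k l → (+ 2 * k + + 1) + (+ 2 * l + + 0) ≡ + 2 * (k + l) + + 1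
      h = solve-∀
    go true true (k , e) (l , f) = parity-unique (a + b) (k + l + + 1) false (trans (cong₂ _+_ e f) (h k l))
      where
      h : ∀ k l → (+ 2 * k + + 1) + (+ 2 * l + + 1) ≡ + 2 * (k + l + + 1) + + 0
      h = solve-∀

  parity-* : ∀ a b → parity (a * b) ≡ parity a ∧ parity b
  parity-* a b = go (parity a) (parity b) (parity-form a) (parity-form b)
    where
    go : ∀ x y → ∃[ k ] a ≡ + 2 * k + bit x → ∃[ k ] b ≡ + 2 * k + bit y → parity (a * b) ≡ x ∧ y
    go false y (k , e) _ = parity-unique (a * b) (k * b) false (trans (cong (_* b) e) (h k b))
      where
      h : ∀ k b → (+ 2 * k + + 0) * b ≡ + 2 * (k * b) + + 0
      h = solve-∀
    go true y (k , e) (l , f) = parity-unique (a * b) (k * b + l) y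
      (trans (cong (_* b) e) (trans (h k b) (trans (cong (λ z → + 2 * (k * b) + z) f) (h′ (k * b) l (bit y)))))
      where
      h : ∀ k b → (+ 2 * k + + 1) * b ≡ + 2 * (k * b) + b
      h = solve-∀
      h′ : ∀ m l c → + 2 * m + (+ 2 * l + c) ≡ + 2 * (m + l) + c
      h′ = solve-∀

  parity-neg : ∀ a → parity (- a) ≡ parity a
  parity-neg a = parity-unique (- a) (- (proj₁ f) - bit (parity a)) (parity a)
    (trans (cong -_ (proj₂ f)) (h (proj₁ f) (bit (parity a))))
    where
    f = parity-form a
    h : ∀ k c → - (+ 2 * k + c) ≡ + 2 * (- k - c) + c
    h = solve-∀

  even-half : ∀ z → parity z ≡ false → ∃[ k ] z ≡ + 2 * k
  even-half z e = proj₁ f , trans (proj₂ f) (trans (cong (λ b → + 2 * proj₁ f + bit b) e) (ℤP.+-identityʳ _))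
    where f = parity-form z

  half-even : ∀ k → parity (+ 2 * k) ≡ false
  half-even k = parity-unique (+ 2 * k) k false (sym (ℤP.+-identityʳ _))

  -- O_K/2 = 𝔽₂[√2]/(√2)²
  𝔹 : Set
  𝔹 = Bool × Bool

  infixl 6 _⊕ᵇ_
  infixl 7 _⊗ᵇ_
  _⊕ᵇ_ _⊗ᵇ_ : 𝔹 → 𝔹 → 𝔹
  (a , b) ⊕ᵇ (c , d) = a xor c , b xor d
  (a , b) ⊗ᵇ (c , d) = a ∧ c , (a ∧ d) xor (b ∧ c)
  ⊝ᵇ_ : 𝔹 → 𝔹
  ⊝ᵇ x = x

  red : OK → 𝔹
  red (mkO a b) = parity a , parity b

  red-+ : ∀ x y → red (x +ᴼ y) ≡ red x ⊕ᵇ red y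
  red-+ (mkO a b) (mkO c d) = cong₂ _,_ (parity-+ a c) (parity-+ b d)

  red-* : ∀ x y → red (x *ᴼ y) ≡ red x ⊗ᵇ red y
  red-* (mkO a b) (mkO c d) = cong₂ _,_
    (trans (parity-+ (a * c) (+ 2 * (b * d))) (trans (cong₂ _xor_ (parity-* a c) (half-even (b * d)))
      (BoolP.xor-identityʳ (parity a ∧ parity c))))
    (trans (parity-+ (a * d) (b * c)) (cong₂ _xor_ (parity-* a d) (parity-* b c)))

  red-neg : ∀ x → red (-ᴼ x) ≡ red x
  red-neg (mkO a b) = cong₂ _,_ (parity-neg a) (parity-neg b)

  private
    -- A syntax for the quaternion formulas: one induction shows that reduction modulo 2 commutes
    -- with every formula, so product, norm and conjugate need no separate computation.
    data Term (n : ℕ) : Set where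
      var : Fin n → Term n
      √2ᵗ : Term n
      _⊕ᵗ_ _⊗ᵗ_ : Term n → Term n → Term n
      ⊝ᵗ_ : Term n → Term n

    evalᴼ : ∀ {n} → Term n → Vec OK n → OK
    evalᴼ (var i) ρ = lookup ρ i
    evalᴼ √2ᵗ ρ = √2ᴼ
    evalᴼ (s ⊕ᵗ t) ρ = evalᴼ s ρ +ᴼ evalᴼ t ρ
    evalᴼ (s ⊗ᵗ t) ρ = evalᴼ s ρ *ᴼ evalᴼ t ρ
    evalᴼ (⊝ᵗ t) ρ = -ᴼ evalᴼ t ρ

    eval𝔹 : ∀ {n} → Term n → Vec 𝔹 n → 𝔹
    eval𝔹 (var i) ρ = lookup ρ i
    eval𝔹 √2ᵗ ρ = false , true
    eval𝔹 (s ⊕ᵗ t) ρ = eval𝔹 s ρ ⊕ᵇ eval𝔹 t ρ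
    eval𝔹 (s ⊗ᵗ t) ρ = eval𝔹 s ρ ⊗ᵇ eval𝔹 t ρ
    eval𝔹 (⊝ᵗ t) ρ = ⊝ᵇ eval𝔹 t ρ

    red-eval : ∀ {n} (t : Term n) ρ → red (evalᴼ t ρ) ≡ eval𝔹 t (Vec.map red ρ)
    red-eval (var i) ρ = sym (VecP.lookup-map i red ρ)
    red-eval √2ᵗ ρ = refl
    red-eval (s ⊕ᵗ t) ρ = trans (red-+ (evalᴼ s ρ) (evalᴼ t ρ)) (cong₂ _⊕ᵇ_ (red-eval s ρ) (red-eval t ρ))
    red-eval (s ⊗ᵗ t) ρ = trans (red-* (evalᴼ s ρ) (evalᴼ t ρ)) (cong₂ _⊗ᵇ_ (red-eval s ρ) (red-eval t ρ))
    red-eval (⊝ᵗ t) ρ = trans (red-neg (evalᴼ t ρ)) (red-eval t ρ)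

  module FB = Formulas _⊕ᵇ_ _⊗ᵇ_ ⊝ᵇ_ (false , true)
  private
    module FT {n} = Formulas {Term n} _⊕ᵗ_ _⊗ᵗ_ ⊝ᵗ_ √2ᵗ

  redQ : 𝒪 → Quat 𝔹
  redQ = mapQ red

  private
    open import Data.Fin.Patterns
    X Y : Quat (Term 8)
    X = ⟪ var 0F , var 1F , var 2F , var 3F ⟫
    Y = ⟪ var 4F , var 5F , var 6F , var 7F ⟫
    product conjugate : Quat (Term 8)
    product = FT.mul X Y
    conjugate = FT.bar X

    red-evalQ : ∀ {n} (p : Quat (Term n)) ρ →
      mapQ (λ t → red (evalᴼ t ρ)) p ≡ mapQ (λ t → eval𝔹 t (Vec.map red ρ)) p
    red-evalQ p ρ = quat≡ (red-eval (q₁ p) ρ) (red-eval (q₂ p) ρ) (red-eval (q₃ p) ρ) (red-eval (q₄ p) ρ)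

  opaque
    unfolding _·_
    redQ-· : ∀ x y → redQ (x · y) ≡ FB.mul (redQ x) (redQ y)
    redQ-· ⟪ t , x , y , z ⟫ ⟪ a , b , c , d ⟫ = red-evalQ product (t ∷ x ∷ y ∷ z ∷ a ∷ b ∷ c ∷ d ∷ [])
    red-N : ∀ x → red (N x) ≡ FB.form (redQ x)
    red-N ⟪ t , x , y , z ⟫ = red-eval (FT.form X) (t ∷ x ∷ y ∷ z ∷ t ∷ x ∷ y ∷ z ∷ [])
    redQ-conj : ∀ x → redQ (conj x) ≡ FB.bar (redQ x)
    redQ-conj ⟪ t , x , y , z ⟫ = red-evalQ conjugate (t ∷ x ∷ y ∷ z ∷ t ∷ x ∷ y ∷ z ∷ [])

  -- η = √2(1+√2) replaces √2, which is not totally positive.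
  η : OK
  η = mkO (+ 2) (+ 1)

  private
    η-quotient : ∀ a b k → a ≡ + 2 * k → mkO a b ≡ η *ᴼ mkO (+ 2 * k - b) (b - k)
    η-quotient a b k e = cong₂ mkO (trans e (l k b)) (l′ k b)
      where
      l : ∀ k b → + 2 * k ≡ + 2 * (+ 2 * k - b) + + 2 * (+ 1 * (b - k))
      l = solve-∀
      l′ : ∀ k b → b ≡ + 2 * (b - k) + + 1 * (+ 2 * k - b)
      l′ = solve-∀

  η-divides : ∀ v → proj₁ (red v) ≡ false → η ∣ v
  η-divides (mkO a b) e = divides (mkO (+ 2 * k - b) (b - k)) (η-quotient a b k (proj₂ (even-half a e)))
    where k = proj₁ (even-half a e)

  -- Modulo 2 the element `η = 2 + √2` is `√2`, which shifts the residue of `v` modulo `√2` into the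
  -- second place.
  red-η* : ∀ v → red (η *ᴼ v) ≡ (false , proj₁ (red v))
  red-η* v = trans (red-* η v) (cong (λ z → false , z) refl)

  divides-η : ∀ v → η ∣ v → proj₁ (red v) ≡ false
  divides-η _ (divides c refl) = cong proj₁ (red-η* c)

  zero₁ : Quat 𝔹 → Bool
  zero₁ ⟪ a , b , c , d ⟫ = not (proj₁ a ∨ proj₁ b ∨ proj₁ c ∨ proj₁ d)

  zero₁-false : ∀ r → zero₁ r ≡ true →
    proj₁ (q₁ r) ≡ false × proj₁ (q₂ r) ≡ false × proj₁ (q₃ r) ≡ false × proj₁ (q₄ r) ≡ false
  zero₁-false ⟪ (false , _) , (false , _) , (false , _) , (false , _) ⟫ _ = refl , refl , refl , refl

  zero₁-η : ∀ x → zero₁ (redQ x) ≡ true → ∃[ y ] x ≡ η • y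
  zero₁-η x e = ⟪ quotient (d q₁ e₁) , quotient (d q₂ e₂) , quotient (d q₃ e₃) , quotient (d q₄ e₄) ⟫ ,
    quat≡ (equality (d q₁ e₁)) (equality (d q₂ e₂)) (equality (d q₃ e₃)) (equality (d q₄ e₄))
    where
    f = zero₁-false (redQ x) e
    e₁ = proj₁ f
    e₂ = proj₁ (proj₂ f)
    e₃ = proj₁ (proj₂ (proj₂ f))
    e₄ = proj₂ (proj₂ (proj₂ f))
    d : (π : 𝒪 → OK) → proj₁ (red (π x)) ≡ false → η ∣ π x
    d π = η-divides (π x)

  redQ-η• : ∀ y → redQ (η • y) ≡ mapQ (λ v → false , proj₁ v) (redQ y)
  redQ-η• ⟪ a , b , c , d ⟫ = quat≡ (red-η* a) (red-η* b) (red-η* c) (red-η* d)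

  η-zero₁ : ∀ y → zero₁ (redQ (η • y)) ≡ true
  η-zero₁ y = cong zero₁ (redQ-η• y)

  all𝔹 : (𝔹 → Bool) → Bool
  all𝔹 f = f (false , false) ∧ f (false , true) ∧ f (true , false) ∧ f (true , true)

  private
    ∧-split : ∀ {a b} → a ∧ b ≡ true → a ≡ true × b ≡ true
    ∧-split {true} {true} _ = refl , refl

  all𝔹-sound : ∀ f → all𝔹 f ≡ true → ∀ x → f x ≡ true
  all𝔹-sound f h (false , false) = proj₁ (∧-split h)
  all𝔹-sound f h (false , true) = proj₁ (∧-split (proj₂ (∧-split {f (false , false)} h)))
  all𝔹-sound f h (true , false) =
    proj₁ (∧-split (proj₂ (∧-split {f (false , true)} (proj₂ (∧-split {f (false , false)} h)))))
  all𝔹-sound f h (true , true) =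
    proj₂ (∧-split {f (true , false)}
    (proj₂ (∧-split {f (false , true)} (proj₂ (∧-split {f (false , false)} h)))))

  -- The order has 256 residues modulo 2, so a Boolean property of them is decided by evaluation.
  allQ𝔹 : (Quat 𝔹 → Bool) → Bool
  allQ𝔹 f = all𝔹 λ a → all𝔹 λ b → all𝔹 λ c → all𝔹 λ d → f ⟪ a , b , c , d ⟫

  allQ𝔹-sound : ∀ f → allQ𝔹 f ≡ true → ∀ x → f x ≡ true
  allQ𝔹-sound f h ⟪ a , b , c , d ⟫ =
    all𝔹-sound (λ d → f ⟪ a , b , c , d ⟫) (all𝔹-sound (λ c → all𝔹 λ d → f ⟪ a , b , c , d ⟫)
    (all𝔹-sound (λ b → all𝔹 λ c → all𝔹 λ d → f ⟪ a , b , c , d ⟫) (all𝔹-sound (λ a → all𝔹 λ b → all𝔹 λ c →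
      all𝔹 λ d → f ⟪ a , b , c , d ⟫) h a) b) c) d

-- The Hecke relation at the prime above 2.

module Hecke where
  open import Defs hiding (H; K)
  open OKRing hiding (ring)
  open Solver
  open Quaternion
  open OKArith hiding (divide)
  open Order hiding (divide)
  open Counting
  open Mod2
  open import Data.Integer using (+_; -[1+_])
  open import Data.Nat as ℕ using (ℕ)
  import Data.Nat.Properties as ℕP
  open import Data.Bool using (Bool; true; false; _∨_; if_then_else_; T)
  import Data.Bool.Properties as BoolP
  open import Data.List using (List; []; _∷_; map; length; _++_)
  open import Data.List.Membership.Propositional using (_∈_)
  open import Data.List.Membership.Propositional.Properties using (∈-map⁺; ∈-map⁻; ∈-++⁺ˡ; ∈-++⁺ʳ; ∈-++⁻)
  open import Data.List.Relation.Unary.Any using (here; there)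
  open import Data.List.Relation.Unary.All as All using (All; []; _∷_)
  open import Data.Product using (∃-syntax; _×_; _,_; proj₁; proj₂)
  open import Data.Sum using (inj₁; inj₂)
  open import Data.Empty using (⊥-elim)
  open import Function.Bundles using (mk⇔; Equivalence)
  open import Relation.Binary.PropositionalEquality hiding ([_])
  open import Relation.Nullary using (¬_; yes; no; Dec)

  η≢0 : ¬ η ≡ 0ᴼ
  η≢0 ()

  η•-injective : ∀ {x y} → η • x ≡ η • y → x ≡ y
  η•-injective {x} {y} e = quat≡ (c (cong q₁ e)) (c (cong q₂ e)) (c (cong q₃ e)) (c (cong q₄ e))
    where
    c : ∀ {a b} → η *ᴼ a ≡ η *ᴼ b → a ≡ b
    c {a} {b} = *ᴼ-cancelˡ η {a} {b} η≢0

  η∣ : 𝒪 → Set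
  η∣ x = zero₁ (redQ x) ≡ true

  η∣? : ∀ x → Dec (η∣ x)
  η∣? x = zero₁ (redQ x) BoolP.≟ true

  -- Generators of the three right ideals of norm η.
  β₁ β₂ β₃ : 𝒪
  β₁ = ⟪ oneᴼ , oneᴼ , 0ᴼ , 0ᴼ ⟫
  β₂ = ⟪ 0ᴼ , oneᴼ , 0ᴼ , oneᴼ ⟫
  β₃ = ⟪ oneᴼ , mkO -[1+ 0 ] -[1+ 0 ] , mkO (+ 0) -[1+ 0 ] , oneᴼ ⟫

  βs : List 𝒪
  βs = β₁ ∷ β₂ ∷ β₃ ∷ []

  opaque
    unfolding N
    N-βs : All (λ β → N β ≡ η) βs
    N-βs = refl ∷ refl ∷ refl ∷ []

  Divides : 𝒪 → 𝒪 → Set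
  Divides β x = η∣ (conj β · x)

  Divides? : ∀ β x → Dec (Divides β x)
  Divides? β x = η∣? (conj β · x)

  private
    toℕ : Bool → ℕ
    toℕ b = if b then 1 else 0

    indicator-bool : ∀ b → indicator (b BoolP.≟ true) ≡ toℕ b
    indicator-bool true = refl
    indicator-bool false = refl

    dividing : Quat 𝔹 → ℕ
    dividing r = ∑ βs (λ β → toℕ (zero₁ (FB.mul (FB.bar (redQ β)) r)))

    expected : Quat 𝔹 → ℕ
    expected r = 1 ℕ.+ 2 ℕ.* toℕ (zero₁ r)

    check : Quat 𝔹 → Bool
    check r = proj₁ (FB.form r) ∨ (dividing r ℕ.≡ᵇ expected r)

    check-all : allQ𝔹 check ≡ true
    check-all = refl

    check-use : ∀ r → proj₁ (FB.form r) ≡ false → dividing r ≡ expected r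
    check-use r e = ℕP.≡ᵇ⇒≡ (dividing r) (expected r)
      (subst T (sym (trans (cong (_∨ (dividing r ℕ.≡ᵇ expected r)) (sym e)) (allQ𝔹-sound check check-all r))) _)

  -- Modulo `√2` the order becomes the matrices over the field of two elements. There `x` is
  -- singular: of rank one, with column space equal to one of the three lines, or zero, with column
  -- space inside all three. The numbers 1 and 3 are confirmed on all residues.
  count-dividing : ∀ x → η ∣ N x → ∑ βs (λ β → indicator (Divides? β x)) ≡ 1 ℕ.+ 2 ℕ.* indicator (η∣? x)
  count-dividing x d = trans (∑-cong βs (λ β _ →
    trans (indicator-bool (zero₁ (redQ (conj β · x))))
    (cong (λ r → toℕ (zero₁ r)) (trans (redQ-· (conj β) x) (cong (λ r → FB.mul r (redQ x)) (redQ-conj β))))))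
    (trans (check-use (redQ x) (trans (cong proj₁ (sym (red-N x))) (divides-η (N x) d)))
      (cong (λ z → 1 ℕ.+ 2 ℕ.* z) (sym (indicator-bool (zero₁ (redQ x))))))

  -- β β̄ = η, so β divides x on the left exactly when η divides β̄x.
  factor-out : ∀ β x → N β ≡ η → Divides β x → ∃[ y ] x ≡ β · y
  factor-out β x Nβ h = y , η•-injective
    (sym (trans (sym (·-•-comm η β y))
    (trans (cong (β ·_) (sym e)) (trans (sym (·-assoc β (conj β) x))
    (trans (cong (_· x) (·-conj β)) (trans (•-·-assoc (N β) 1ᵠ x) (cong₂ _•_ Nβ (·-identityˡ x))))))))
    where
    y = proj₁ (zero₁-η (conj β · x) h)
    e = proj₂ (zero₁-η (conj β · x) h)

  divides-product : ∀ β y → N β ≡ η → Divides β (β · y)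
  divides-product β y Nβ = subst η∣
    (sym (trans (sym (·-assoc (conj β) β y))
    (trans (cong (_· y) (conj-· β)) (trans (•-·-assoc (N β) 1ᵠ y) (cong₂ _•_ Nβ (·-identityˡ y)))))) (η-zero₁ y)

  norm-quotient : ∀ β y α → N β ≡ η → N (β · y) ≡ η *ᴼ α → N y ≡ α
  norm-quotient β y α Nβ e = *ᴼ-cancelˡ η η≢0 (trans (cong (_*ᴼ N y) (sym Nβ)) (trans (sym (N-· β y)) e))

  norm-product : ∀ β y α → N β ≡ η → N y ≡ α → N (β · y) ≡ η *ᴼ α
  norm-product β y α Nβ e = trans (N-· β y) (cong₂ _*ᴼ_ Nβ e)

  N-η≢0 : ∀ β → N β ≡ η → ¬ N β ≡ 0ᴼ
  N-η≢0 β Nβ e = η≢0 (trans (sym Nβ) e)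

  count-multiples : ∀ {α b} β → N β ≡ η → Count (λ x → N x ≡ α) b → Count (λ x → N x ≡ η *ᴼ α × Divides β x) b
  count-multiples {α} β Nβ = count-map {P = λ x → N x ≡ α} {Q = λ x → N x ≡ η *ᴼ α × Divides β x} (β ·_)
    (·-cancelˡ β (N-η≢0 β Nβ))
    (λ y e → norm-product β y α Nβ e , divides-product β y Nβ)
    (λ x (e , d) → let y = proj₁ (factor-out β x Nβ d) ; x≡ = proj₂ (factor-out β x Nβ d) in
      y , norm-quotient β y α Nβ (trans (cong N (sym x≡)) e) , x≡)

  private
    0≢1+ : ∀ n → ¬ 0 ≡ 1 ℕ.+ n
    0≢1+ n ()

    find : ∀ (bs : List 𝒪) x → ¬ ∑ bs (λ β → indicator (Divides? β x)) ≡ 0 → ∃[ β ] (β ∈ bs × Divides β x)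
    find [] x h = ⊥-elim (h refl)
    find (β ∷ bs) x h = split (Divides? β x) refl
      where
      split : (d : Dec (Divides β x)) → d ≡ Divides? β x → ∃[ γ ] (γ ∈ β ∷ bs × Divides γ x)
      split (yes d) _ = β , here refl , d
      split (no ¬d) e =
        let γ , γ∈ , d = find bs x (λ z →
              h (trans (cong (λ i → indicator i ℕ.+ ∑ bs (λ β → indicator (Divides? β x))) (sym e)) z))
        in γ , there γ∈ , d

  -- Every element of norm `ηα` is a left multiple by some `βᵢ` of an element of norm `α`. The
  -- concatenated list may repeat entries, since multiples of `η` come from all three.
  norm-enumeration : ∀ α b → Count (λ x → N x ≡ α) b → ∃[ c ] Count (λ x → N x ≡ η *ᴼ α) c
  norm-enumeration α b C = enumerate _≟ᵠ_ list (λ x → mk⇔ (there′ x) (back x))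
    where
    ys = proj₁ C
    member = proj₁ (proj₂ (proj₂ C))
    list = map (β₁ ·_) ys ++ map (β₂ ·_) ys ++ map (β₃ ·_) ys
    piece : ∀ β → N β ≡ η → ∀ x → x ∈ map (β ·_) ys → N x ≡ η *ᴼ α
    piece β Nβ x x∈ with ∈-map⁻ (β ·_) x∈
    ... | y , y∈ , refl = norm-product β y α Nβ (Equivalence.to (member y) y∈)
    N₁ = All.lookup N-βs (here refl)
    N₂ = All.lookup N-βs (there (here refl))
    N₃ = All.lookup N-βs (there (there (here refl)))
    there′ : ∀ x → x ∈ list → N x ≡ η *ᴼ α
    there′ x x∈ with ∈-++⁻ (map (β₁ ·_) ys) x∈
    ... | inj₁ p = piece β₁ N₁ x p
    ... | inj₂ p with ∈-++⁻ (map (β₂ ·_) ys) p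
    ...   | inj₁ q = piece β₂ N₂ x q
    ...   | inj₂ q = piece β₃ N₃ x q
    multiple : ∀ β → N β ≡ η → ∀ x → N x ≡ η *ᴼ α → Divides β x → x ∈ map (β ·_) ys
    multiple β Nβ x e d = subst (_∈ map (β ·_) ys) (sym (proj₂ f))
      (∈-map⁺ (β ·_) (Equivalence.from (member (proj₁ f))
      (norm-quotient β (proj₁ f) α Nβ (trans (cong N (sym (proj₂ f))) e))))
      where f = factor-out β x Nβ d
    back : ∀ x → N x ≡ η *ᴼ α → x ∈ list
    back x e = place (find βs x (λ z → 0≢1+ _ (trans (sym z) (count-dividing x (divides α e)))))
      where
      place : ∃[ β ] (β ∈ βs × Divides β x) → x ∈ list
      place (_ , here refl , d) = ∈-++⁺ˡ (multiple β₁ N₁ x e d)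
      place (_ , there (here refl) , d) = ∈-++⁺ʳ (map (β₁ ·_) ys) (∈-++⁺ˡ (multiple β₂ N₂ x e d))
      place (_ , there (there (here refl)) , d) =
        ∈-++⁺ʳ (map (β₁ ·_) ys) (∈-++⁺ʳ (map (β₂ ·_) ys) (multiple β₃ N₃ x e d))

  -- The Hecke relation at the prime above 2: an element of norm ηα is divisible on the left by exactly one
  -- of the three elements βᵢ if η does not divide it, and by all of them otherwise.
  hecke : ∀ α {a b c} → Count (λ x → N x ≡ α) b → Count (λ x → N x ≡ η *ᴼ α × η∣ x) a →
    Count (λ x → N x ≡ η *ᴼ α) c → c ℕ.+ 2 ℕ.* a ≡ 3 ℕ.* b
  hecke α {a} {b} {c} B A C = trans (sym weights)
    (double-count {P = λ x → N x ≡ η *ᴼ α} {n = c} {m = b} βs Divides? (λ x → 1 ℕ.+ 2 ℕ.* indicator (η∣? x)) C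
      (λ β β∈ → count-multiples β (All.lookup N-βs β∈) B)
      (λ x e → count-dividing x (divides α e)))
    where
    xs = proj₁ C
    weights : ∑ xs (λ x → 1 ℕ.+ 2 ℕ.* indicator (η∣? x)) ≡ c ℕ.+ 2 ℕ.* a
    weights = trans (∑-+ xs (λ _ → 1) (λ x → 2 ℕ.* indicator (η∣? x))) (cong₂ ℕ._+_
      (trans (∑-const xs 1) (trans (ℕP.*-identityʳ (length xs)) (proj₂ (proj₂ (proj₂ C)))))
      (trans (∑-* xs 2 (λ x → indicator (η∣? x)))
        (cong (2 ℕ.*_) (count-∑ {P = λ x → N x ≡ η *ᴼ α} {n = c} η∣? C A))))

  count-η : ∀ α {a} → Count (λ x → N x ≡ α) a → Count (λ x → N x ≡ η *ᴼ (η *ᴼ α) × η∣ x) a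
  count-η α = count-map {P = λ x → N x ≡ α} {Q = λ x → N x ≡ η *ᴼ (η *ᴼ α) × η∣ x} (η •_) η•-injective
    (λ y e → trans (N-• η y) (trans (*ᴼ-assoc η η (N y)) (cong (λ z → η *ᴼ (η *ᴼ z)) e)) , η-zero₁ y)
    (λ x (e , d) → let y = proj₁ (zero₁-η x d) ; x≡ = proj₂ (zero₁-η x d) in
      y , *ᴼ-cancelˡ η η≢0 (*ᴼ-cancelˡ η η≢0
        (trans (sym (trans (cong N x≡) (trans (N-• η y) (*ᴼ-assoc η η (N y))))) e)) , x≡)

-- Averaging over twists by units.

module Weights where
  open import Defs hiding (H; K)
  open OKRing hiding (ring)
  open Solver
  open Quaternion
  open OKArith hiding (divide)
  open Counting
  open Mod2
  open Hecke
  open import Data.Integer using (+_; -[1+_])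
  open import Data.Nat as ℕ using (ℕ)
  import Data.Nat.Properties as ℕP
  open import Data.Nat.ListAction.Properties using (sum-++)
  open import Data.Bool using (Bool; true; false; _∧_; _∨_; not; _xor_; if_then_else_; T)
  import Data.Bool.Properties as BoolP
  open import Data.List using (List; []; _∷_; map; cartesianProductWith)
  open import Data.List.Properties using (map-++; map-∘)
  open import Data.List.Membership.Propositional.Properties using (∈-cartesianProductWith⁻)
  open import Data.List.Relation.Unary.All as All using (All; []; _∷_)
  open import Data.Product using (∃-syntax; _×_; _,_; proj₁; proj₂)
  open import Relation.Binary.PropositionalEquality
  open import Relation.Nullary using (¬_; Dec)

  -1ᴼ -√2ᴼ 2ᴼ -2ᴼ : OK
  -1ᴼ = mkO -[1+ 0 ] (+ 0)
  -√2ᴼ = mkO (+ 0) -[1+ 0 ]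
  2ᴼ = mkO (+ 2) (+ 0)
  -2ᴼ = mkO -[1+ 1 ] (+ 0)

  -- The lattice 𝒢 is isometric to the order of all x whose image in 𝒪/2 ≅ M₂(𝔽₂[√2]) is diagonal;
  -- it consists of the x with 2 ∣ q₂ x and 2 ∣ q₃ x − q₄ x.
  diagonal : Quat 𝔹 → Bool
  diagonal ⟪ a , (b , b′) , (c , c′) , (d , d′) ⟫ = not (b ∨ b′ ∨ (c xor d) ∨ (c′ xor d′))

  Diagonal : 𝒪 → Set
  Diagonal x = diagonal (redQ x) ≡ true

  Diagonal? : ∀ x → Dec (Diagonal x)
  Diagonal? x = diagonal (redQ x) BoolP.≟ true

  -- Representatives modulo ±1 of the 48 units of norm 1, which act simply transitively on the ordered pairs
  -- of points of ℙ¹(𝔽₂[√2]) distinct modulo √2, and a subgroup of order 3 moving the pair of the fixed points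
  -- of the diagonal matrices to three disjoint pairs.
  lefts rights : List 𝒪
  lefts =
      ⟪ 2ᴼ , -√2ᴼ , -√2ᴼ , oneᴼ ⟫ ∷ ⟪ oneᴼ , 0ᴼ , 0ᴼ , 0ᴼ ⟫ ∷ ⟪ oneᴼ , 0ᴼ , 0ᴼ , -1ᴼ ⟫
    ∷ ⟪ oneᴼ , 0ᴼ , -√2ᴼ , oneᴼ ⟫ ∷ ⟪ oneᴼ , 0ᴼ , -√2ᴼ , 0ᴼ ⟫ ∷ ⟪ oneᴼ , -√2ᴼ , 0ᴼ , oneᴼ ⟫
    ∷ ⟪ oneᴼ , -√2ᴼ , 0ᴼ , 0ᴼ ⟫ ∷ ⟪ oneᴼ , -√2ᴼ , -√2ᴼ , 2ᴼ ⟫ ∷ ⟪ oneᴼ , -√2ᴼ , -√2ᴼ , oneᴼ ⟫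
    ∷ ⟪ √2ᴼ , 0ᴼ , -1ᴼ , 0ᴼ ⟫ ∷ ⟪ √2ᴼ , -1ᴼ , 0ᴼ , 0ᴼ ⟫ ∷ ⟪ √2ᴼ , -1ᴼ , -1ᴼ , √2ᴼ ⟫
    ∷ ⟪ √2ᴼ , -1ᴼ , -1ᴼ , 0ᴼ ⟫ ∷ ⟪ √2ᴼ , -1ᴼ , -2ᴼ , √2ᴼ ⟫ ∷ ⟪ √2ᴼ , -2ᴼ , -1ᴼ , √2ᴼ ⟫
    ∷ ⟪ 0ᴼ , oneᴼ , oneᴼ , -√2ᴼ ⟫ ∷ ⟪ 0ᴼ , oneᴼ , 0ᴼ , 0ᴼ ⟫ ∷ ⟪ 0ᴼ , oneᴼ , 0ᴼ , -√2ᴼ ⟫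
    ∷ ⟪ 0ᴼ , oneᴼ , -1ᴼ , 0ᴼ ⟫ ∷ ⟪ 0ᴼ , √2ᴼ , 0ᴼ , -1ᴼ ⟫ ∷ ⟪ 0ᴼ , 0ᴼ , oneᴼ , 0ᴼ ⟫
    ∷ ⟪ 0ᴼ , 0ᴼ , oneᴼ , -√2ᴼ ⟫ ∷ ⟪ 0ᴼ , 0ᴼ , √2ᴼ , -1ᴼ ⟫ ∷ ⟪ 0ᴼ , 0ᴼ , 0ᴼ , oneᴼ ⟫ ∷ []
  rights = 1ᵠ ∷ ⟪ 0ᴼ , -√2ᴼ , 0ᴼ , oneᴼ ⟫ ∷ ⟪ oneᴼ , -√2ᴼ , 0ᴼ , oneᴼ ⟫ ∷ []

  opaque
    unfolding N
    N-lefts : All (λ u → N u ≡ oneᴼ) lefts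
    N-lefts = refl ∷ refl ∷ refl ∷ refl ∷ refl ∷ refl ∷ refl ∷ refl ∷ refl ∷ refl ∷ refl ∷ refl ∷ refl
      ∷ refl ∷ refl ∷ refl ∷ refl ∷ refl ∷ refl ∷ refl ∷ refl ∷ refl ∷ refl ∷ refl ∷ []
    N-rights : All (λ u → N u ≡ oneᴼ) rights
    N-rights = refl ∷ refl ∷ refl ∷ []

  twists : List (𝒪 × 𝒪)
  twists = cartesianProductWith _,_ rights lefts

  Twisted : 𝒪 × 𝒪 → 𝒪 → Set
  Twisted (v , u) x = Diagonal (u · (x · v))

  Twisted? : ∀ s x → Dec (Twisted s x)
  Twisted? (v , u) x = Diagonal? (u · (x · v))

  private
    unit-cancelˡ : ∀ u x → N u ≡ oneᴼ → u · (conj u · x) ≡ x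
    unit-cancelˡ u x e = trans (sym (·-assoc u (conj u) x))
      (trans (cong (_· x) (·-conj u))
      (trans (•-·-assoc (N u) 1ᵠ x) (trans (cong₂ _•_ e (·-identityˡ x)) (•-identityˡ x))))

    unit-cancelˡ′ : ∀ u x → N u ≡ oneᴼ → conj u · (u · x) ≡ x
    unit-cancelˡ′ u x e = trans (sym (·-assoc (conj u) u x))
      (trans (cong (_· x) (conj-· u))
      (trans (•-·-assoc (N u) 1ᵠ x) (trans (cong₂ _•_ e (·-identityˡ x)) (•-identityˡ x))))

    unit-cancelʳ : ∀ v x → N v ≡ oneᴼ → (x · conj v) · v ≡ x
    unit-cancelʳ v x e = trans (·-assoc x (conj v) v)
      (trans (cong (x ·_) (trans (conj-· v) (trans (cong (_• 1ᵠ) e) (•-identityˡ 1ᵠ)))) (·-identityʳ x))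

    unit-cancelʳ′ : ∀ v x → N v ≡ oneᴼ → (x · v) · conj v ≡ x
    unit-cancelʳ′ v x e = trans (·-assoc x v (conj v))
      (trans (cong (x ·_) (trans (·-conj v) (trans (cong (_• 1ᵠ) e) (•-identityˡ 1ᵠ)))) (·-identityʳ x))

    untwist : ∀ v u y → N v ≡ oneᴼ → N u ≡ oneᴼ → u · ((conj u · (y · conj v)) · v) ≡ y
    untwist v u y ev eu = trans (cong (u ·_) (·-assoc (conj u) (y · conj v) v))
      (trans (unit-cancelˡ u ((y · conj v) · v) eu) (unit-cancelʳ v y ev))

    retwist : ∀ v u x → N v ≡ oneᴼ → N u ≡ oneᴼ → conj u · ((u · (x · v)) · conj v) ≡ x
    retwist v u x ev eu = trans (cong (conj u ·_) (·-assoc u (x · v) (conj v)))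
      (trans (unit-cancelˡ′ u ((x · v) · conj v) eu) (unit-cancelʳ′ v x ev))

    norm-units : ∀ u x v → N u ≡ oneᴼ → N v ≡ oneᴼ → N (u · (x · v)) ≡ N x
    norm-units u x v eu ev = trans (N-· u (x · v))
      (trans (cong₂ _*ᴼ_ eu (trans (N-· x v) (trans (cong (N x *ᴼ_) ev) (*ᴼ-idʳ (N x))))) (*ᴼ-idˡ (N x)))

  count-twisted : ∀ {α r} v u → N v ≡ oneᴼ → N u ≡ oneᴼ → Count (λ x → N x ≡ α × Diagonal x) r →
    Count (λ x → N x ≡ α × Twisted (v , u) x) r
  count-twisted {α} v u ev eu = count-map {P = λ x → N x ≡ α × Diagonal x}
    {Q = λ x → N x ≡ α × Twisted (v , u) x} (λ y → conj u · (y · conj v))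
    (λ {y} {y'} e → trans (sym (untwist v u y ev eu))
      (trans (cong (λ z → u · (z · v)) e) (untwist v u y' ev eu)))
    (λ y (e , d) → trans (norm-units (conj u) y (conj v) (trans (N-conj u) eu) (trans (N-conj v) ev)) e ,
      subst Diagonal (sym (untwist v u y ev eu)) d)
    (λ x (e , d) → u · (x · v) , (trans (norm-units u x v eu ev) e , d) , sym (retwist v u x ev eu))

  toℕ : Bool → ℕ
  toℕ b = if b then 1 else 0

  private
    indicator-bool : ∀ b → indicator (b BoolP.≟ true) ≡ toℕ b
    indicator-bool true = refl
    indicator-bool false = refl

    ∑-product : ∀ {A B : Set} (xs : List A) (ys : List B) (f : A × B → ℕ) →
      ∑ (cartesianProductWith _,_ xs ys) f ≡ ∑ xs (λ x → ∑ ys (λ y → f (x , y)))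
    ∑-product [] ys f = refl
    ∑-product (x ∷ xs) ys f = trans (cong sum′ (map-++ f (map (x ,_) ys) (cartesianProductWith _,_ xs ys)))
      (trans (sum-++ (map f (map (x ,_) ys)) (map f (cartesianProductWith _,_ xs ys)))
        (cong₂ ℕ._+_ (cong sum′ (sym (map-∘ ys))) (∑-product xs ys f)))
      where
      open import Data.Nat.ListAction using () renaming (sum to sum′)

    left-sum : Quat 𝔹 → ℕ
    left-sum r = ∑ lefts (λ u → toℕ (diagonal (FB.mul (redQ u) r)))

  weight : Quat 𝔹 → ℕ
  weight r = ∑ rights (λ v → left-sum (FB.mul r (redQ v)))

  count-twists : ∀ x → ∑ twists (λ s → indicator (Twisted? s x)) ≡ weight (redQ x)
  count-twists x = trans (∑-product rights lefts (λ s → indicator (Twisted? s x)))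
    (∑-cong rights (λ v _ → ∑-cong lefts (λ u _ → trans (indicator-bool (diagonal (redQ (u · (x · v)))))
      (cong (λ r → toℕ (diagonal r)) (trans (redQ-· u (x · v)) (cong (FB.mul (redQ u)) (redQ-· x v)))))))

  zero₂ : Quat 𝔹 → Bool
  zero₂ ⟪ (a , a′) , (b , b′) , (c , c′) , (d , d′) ⟫ = not (a ∨ a′ ∨ b ∨ b′ ∨ c ∨ c′ ∨ d ∨ d′)

  -- For `x = ηy` this recovers `y` modulo `√2` from `x` modulo 2, which is all that the parity of
  -- the norm of `y` depends on.
  halved : Quat 𝔹 → Quat 𝔹
  halved = mapQ (λ v → proj₂ v , false)

  private
    odd-norm? odd-half-norm? : Quat 𝔹 → Bool
    odd-norm? r = proj₁ (FB.form r)
    odd-half-norm? r = proj₁ (FB.form (halved r))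

    -- The twist `u x v` is diagonal when `x` maps the ordered pair of lines chosen by `v` into the
    -- pair chosen by `u`. If `x` is invertible, the images determine `u`: 1 for each of three `v`.
    -- If `x = ηy`, only lines modulo `√2` matter: an invertible `y` leaves 4 choices for each `v`,
    -- while a `y` of rank one leaves 8 for each of the two `v` whose pair contains its kernel and
    -- none for the third. For other singular `x` the two lifts of the kernel modulo `√2` lie in
    -- different pairs and contribute 4 + 0 or 2 + 2.
    expected : Quat 𝔹 → ℕ
    expected r = if odd-norm? r then 3 else
      (if zero₁ r then (if zero₂ r then 72 else (if odd-half-norm? r then 12 else 16)) else 4)

    opaque
      weight-check : allQ𝔹 (λ r → weight r ℕ.≡ᵇ expected r) ≡ true
      weight-check = refl

    weight-expected : ∀ r → weight r ≡ expected r
    weight-expected r = ℕP.≡ᵇ⇒≡ (weight r) (expected r)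
      (subst T (sym (allQ𝔹-sound (λ r → weight r ℕ.≡ᵇ expected r) weight-check r)) _)

    low-check : allQ𝔹 (λ r → odd-norm? r ∨
      ((zero₁ r ∧ not (odd-half-norm? r)) ∨ (expected r ℕ.≡ᵇ 4 ℕ.+ 8 ℕ.* toℕ (zero₁ r)))) ≡ true
    low-check = refl

    high-check : allQ𝔹 (λ r → odd-norm? r ∨
      ((zero₁ r ∧ odd-half-norm? r) ∨
      (expected r ℕ.≡ᵇ 4 ℕ.+ (12 ℕ.* toℕ (zero₁ r) ℕ.+ 56 ℕ.* toℕ (zero₁ r ∧ zero₂ r))))) ≡ true
    high-check = refl

    resolve : ∀ {a b c} → a ∨ (b ∨ c) ≡ true → a ≡ false → b ≡ false → c ≡ true
    resolve h refl refl = h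

  weight-odd : ∀ r → proj₁ (FB.form r) ≡ true → weight r ≡ 3
  weight-odd r e = trans (weight-expected r)
    (cong (λ b → if b then 3 else (if zero₁ r then
    (if zero₂ r then 72 else (if odd-half-norm? r then 12 else 16)) else 4)) e)

  -- When the quotient by `η` has odd norm the possible weights are 4 and 12 = 4 + 8, so the weight
  -- is a combination of the constant 1 and one indicator.
  weight-low : ∀ r → proj₁ (FB.form r) ≡ false → (zero₁ r ≡ true → proj₁ (FB.form (halved r)) ≡ true) →
    weight r ≡ 4 ℕ.+ 8 ℕ.* toℕ (zero₁ r)
  weight-low r e h = trans (weight-expected r)
    (ℕP.≡ᵇ⇒≡ (expected r) (4 ℕ.+ 8 ℕ.* toℕ (zero₁ r)) (subst T (sym (resolve (allQ𝔹-sound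
      (λ r → odd-norm? r ∨ ((zero₁ r ∧ not (odd-half-norm? r)) ∨
        (expected r ℕ.≡ᵇ 4 ℕ.+ 8 ℕ.* toℕ (zero₁ r)))) low-check r) e
        (exclude (zero₁ r) (odd-half-norm? r) h))) _))
    where
    exclude : ∀ z o → (z ≡ true → o ≡ true) → z ∧ not o ≡ false
    exclude false o h = refl
    exclude true o h = cong not (h refl)

  -- Here the weights are 4, 16 = 4 + 12 and 72 = 4 + 12 + 56, with one indicator for divisibility
  -- by `η` and one for divisibility by `η²`.
  weight-high : ∀ r → proj₁ (FB.form r) ≡ false → (zero₁ r ≡ true → proj₁ (FB.form (halved r)) ≡ false) →
    weight r ≡ 4 ℕ.+ (12 ℕ.* toℕ (zero₁ r) ℕ.+ 56 ℕ.* toℕ (zero₁ r ∧ zero₂ r))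
  weight-high r e h = trans (weight-expected r)
    (ℕP.≡ᵇ⇒≡ (expected r) (4 ℕ.+ (12 ℕ.* toℕ (zero₁ r) ℕ.+ 56 ℕ.* toℕ (zero₁ r ∧ zero₂ r)))
    (subst T (sym (resolve (allQ𝔹-sound
      (λ r → odd-norm? r ∨ ((zero₁ r ∧ odd-half-norm? r) ∨
        (expected r ℕ.≡ᵇ 4 ℕ.+ (12 ℕ.* toℕ (zero₁ r) ℕ.+ 56 ℕ.* toℕ (zero₁ r ∧ zero₂ r))))) high-check r)
        e (exclude (zero₁ r) (odd-half-norm? r) h))) _))
    where
    exclude : ∀ z o → (z ≡ true → o ≡ false) → z ∧ o ≡ false
    exclude false o h = refl
    exclude true o h = h refl

  -- Since `η² = 2(3 + 2√2)` is an associate of 2, divisibility by it means that all residues modulo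
  -- 2 vanish.
  η²∣ : 𝒪 → Set
  η²∣ x = zero₁ (redQ x) ∧ zero₂ (redQ x) ≡ true

  η²∣? : ∀ x → Dec (η²∣ x)
  η²∣? x = (zero₁ (redQ x) ∧ zero₂ (redQ x)) BoolP.≟ true

  -- Averaging over the twists x ↦ u x v, which permute the elements of a given norm.
  module Average {α : OK} {n r : ℕ} (C : Count (λ x → N x ≡ α) n) (D : Count (λ x →
    N x ≡ α × Diagonal x) r) where
    private
      xs = proj₁ C
      total : ∀ (W : 𝒪 → ℕ) → (∀ x → N x ≡ α → weight (redQ x) ≡ W x) → ∑ xs W ≡ 72 ℕ.* r
      total W w = double-count {P = λ x → N x ≡ α} {n = n} {m = r} twists Twisted? W C
        (λ (v , u) s∈ → let _ , _ , v∈ , u∈ , e = ∈-cartesianProductWith⁻ _,_ rights lefts s∈ in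
          subst (λ s → Count (λ x → N x ≡ α × Twisted s x) r) (sym e)
            (count-twisted _ _ (All.lookup N-rights v∈) (All.lookup N-lefts u∈) D))
        (λ x e → trans (count-twists x) (w x e))
      ones : ∀ c → ∑ xs (λ _ → c) ≡ c ℕ.* n
      ones c = trans (∑-const xs c) (trans (cong (ℕ._* c) (proj₂ (proj₂ (proj₂ C)))) (ℕP.*-comm n c))

    average-odd : ¬ η ∣ α → 72 ℕ.* r ≡ 3 ℕ.* n
    average-odd odd = trans (sym (total (λ _ → 3) (λ x e →
      weight-odd (redQ x) (trans (cong proj₁ (sym (red-N x))) (parity-odd (N x) (λ d →
      odd (subst (η ∣_) e d))))))) (ones 3)
      where
      parity-odd : ∀ v → ¬ η ∣ v → proj₁ (red v) ≡ true
      parity-odd v h = BoolP.¬-not (λ e → h (η-divides v e))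

    private
      even-form : η ∣ α → ∀ x → N x ≡ α → proj₁ (FB.form (redQ x)) ≡ false
      even-form d x e = trans (cong proj₁ (sym (red-N x))) (divides-η (N x) (subst (η ∣_) (sym e) d))

      half-form : ∀ x → zero₁ (redQ x) ≡ true →
        ∃[ y ] (x ≡ η • y × proj₁ (FB.form (halved (redQ x))) ≡ proj₁ (red (N y)))
      half-form x z = y , e , trans (cong (λ x → proj₁ (FB.form (halved (redQ x)))) e)
        (trans (cong (λ r → proj₁ (FB.form (halved r))) (redQ-η• y)) (cong proj₁ (sym (red-N y))))
        where
        y = proj₁ (zero₁-η x z)
        e = proj₂ (zero₁-η x z)

      indicator-η : ∀ x → toℕ (zero₁ (redQ x)) ≡ indicator (η∣? x)
      indicator-η x = sym (indicator-bool (zero₁ (redQ x)))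
      indicator-η² : ∀ x → toℕ (zero₁ (redQ x) ∧ zero₂ (redQ x)) ≡ indicator (η²∣? x)
      indicator-η² x = sym (indicator-bool (zero₁ (redQ x) ∧ zero₂ (redQ x)))

    average-low : ∀ {a} → η ∣ α → (∀ y → N (η • y) ≡ α → ¬ η ∣ N y) → Count (λ x → N x ≡ α × η∣ x) a →
      72 ℕ.* r ≡ 4 ℕ.* n ℕ.+ 8 ℕ.* a
    average-low {a} d odd A = trans (sym (total (λ x → 4 ℕ.+ 8 ℕ.* indicator (η∣? x)) w))
      (trans (∑-+ xs (λ _ → 4) (λ x → 8 ℕ.* indicator (η∣? x)))
        (cong₂ ℕ._+_ (ones 4) (trans (∑-* xs 8 (λ x → indicator (η∣? x)))
        (cong (8 ℕ.*_) (count-∑ {P = λ x → N x ≡ α} {n = n} η∣? C A)))))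
      where
      w : ∀ x → N x ≡ α → weight (redQ x) ≡ 4 ℕ.+ 8 ℕ.* indicator (η∣? x)
      w x e = trans (weight-low (redQ x) (even-form d x e) h) (cong (λ i → 4 ℕ.+ 8 ℕ.* i) (indicator-η x))
        where
        h : zero₁ (redQ x) ≡ true → proj₁ (FB.form (halved (redQ x))) ≡ true
        h z = let y , x≡ , f = half-form x z in
          trans f (BoolP.¬-not (λ p → odd y (trans (cong N (sym x≡)) e) (η-divides (N y) p)))

    average-high : ∀ {a b} → η ∣ α → (∀ y → N (η • y) ≡ α → η ∣ N y) → Count (λ x → N x ≡ α × η∣ x) a →
      Count (λ x → N x ≡ α × η²∣ x) b →
      72 ℕ.* r ≡ 4 ℕ.* n ℕ.+ (12 ℕ.* a ℕ.+ 56 ℕ.* b)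
    average-high {a} {b} d even A B =
      trans (sym (total (λ x → 4 ℕ.+ (12 ℕ.* indicator (η∣? x) ℕ.+ 56 ℕ.* indicator (η²∣? x))) w))
      (trans (∑-+ xs (λ _ → 4) (λ x → 12 ℕ.* indicator (η∣? x) ℕ.+ 56 ℕ.* indicator (η²∣? x)))
        (cong₂ ℕ._+_ (ones 4)
        (trans (∑-+ xs (λ x → 12 ℕ.* indicator (η∣? x)) (λ x → 56 ℕ.* indicator (η²∣? x))) (cong₂ ℕ._+_
          (trans (∑-* xs 12 (λ x → indicator (η∣? x)))
            (cong (12 ℕ.*_) (count-∑ {P = λ x → N x ≡ α} {n = n} η∣? C A)))
          (trans (∑-* xs 56 (λ x → indicator (η²∣? x)))
            (cong (56 ℕ.*_) (count-∑ {P = λ x → N x ≡ α} {n = n} η²∣? C B)))))))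
      where
      w : ∀ x → N x ≡ α → weight (redQ x) ≡ 4 ℕ.+ (12 ℕ.* indicator (η∣? x) ℕ.+ 56 ℕ.* indicator (η²∣? x))
      w x e = trans (weight-high (redQ x) (even-form d x e) h) (cong₂ (λ i j →
        4 ℕ.+ (12 ℕ.* i ℕ.+ 56 ℕ.* j)) (indicator-η x) (indicator-η² x))
        where
        h : zero₁ (redQ x) ≡ true → proj₁ (FB.form (halved (redQ x))) ≡ false
        h z = let y , x≡ , f = half-form x z in trans f (divides-η (N y) (even y (trans (cong N (sym x≡)) e)))

  count-η² : ∀ α {a} → Count (λ x → N x ≡ α × η∣ x) a → Count (λ x → N x ≡ η *ᴼ (η *ᴼ α) × η²∣ x) a
  count-η² α = count-map {P = λ x → N x ≡ α × η∣ x} {Q = λ x → N x ≡ η *ᴼ (η *ᴼ α) × η²∣ x} (η •_) η•-injective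
    (λ y (e , d) → trans (N-• η y) (trans (*ᴼ-assoc η η (N y)) (cong (λ z → η *ᴼ (η *ᴼ z)) e)) ,
      trans (cong (λ r → zero₁ r ∧ zero₂ r) (redQ-η• y)) (trans (scaled (redQ y)) d))
    back
    where
    scaled : ∀ r → zero₁ (mapQ (λ v → false , proj₁ v) r) ∧ zero₂ (mapQ (λ v → false , proj₁ v) r) ≡ zero₁ r
    scaled r = refl
    ∧-left : ∀ {a b} → a ∧ b ≡ true → a ≡ true
    ∧-left {true} _ = refl
    back : ∀ x → N x ≡ η *ᴼ (η *ᴼ α) × η²∣ x → ∃[ y ] ((N y ≡ α × η∣ y) × x ≡ η • y)
    back x (e , d) = y , (*ᴼ-cancelˡ η η≢0
      (*ᴼ-cancelˡ η η≢0 (trans (sym (trans (cong N x≡) (trans (N-• η y) (*ᴼ-assoc η η (N y))))) e)) ,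
        trans (sym (scaled (redQ y))) (trans (cong (λ r → zero₁ r ∧ zero₂ r) (sym (redQ-η• y)))
          (trans (cong (λ x → zero₁ (redQ x) ∧ zero₂ (redQ x)) (sym x≡)) d))) , x≡
      where
      z = zero₁-η x (∧-left {zero₁ (redQ x)} {zero₂ (redQ x)} d)
      y = proj₁ z
      x≡ = proj₂ z

-- The isometry of 𝒢 with the diagonal suborder.

module Embed where
  open import Defs renaming (H to ℍ; K to 𝕂)
  open OKRing hiding (ring)
  open Solver
  open Quaternion
  open OKArith hiding (divide; _∣_; divides)
  open OKArith using (_∣_; divides)
  open Counting
  open Mod2
  open Weights
  open import Data.Integer using (ℤ; +_; _*_; _+_)
  import Data.Integer.Properties as ℤP
  open import Data.Integer.Tactic.RingSolver using (solve-∀)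
  open import Data.Nat using (ℕ; suc)
  open import Data.Rational as ℚ using (ℚ; fromℚᵘ)
  import Data.Rational.Properties as ℚP
  open import Data.Rational.Unnormalised as ℚᵘ using (ℚᵘ; mkℚᵘ; *≡*)
  import Data.Rational.Unnormalised.Properties as ℚᵘP
  open import Data.Bool using (Bool; true; false)
  open import Data.Product using (∃-syntax; _×_; _,_; proj₁; proj₂)
  open import Relation.Binary.PropositionalEquality

  private
    fromℚᵘ-+ : ∀ p q → fromℚᵘ p ℚ.+ fromℚᵘ q ≡ fromℚᵘ (p ℚᵘ.+ q)
    fromℚᵘ-+ p q = ℚP.toℚᵘ-injective (ℚᵘP.≃-trans (ℚP.toℚᵘ-homo-+ (fromℚᵘ p) (fromℚᵘ q))
      (ℚᵘP.≃-trans (ℚᵘP.+-cong (ℚP.toℚᵘ-fromℚᵘ p) (ℚP.toℚᵘ-fromℚᵘ q)) (ℚᵘP.≃-sym (ℚP.toℚᵘ-fromℚᵘ (p ℚᵘ.+ q)))))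

    fromℚᵘ-* : ∀ p q → fromℚᵘ p ℚ.* fromℚᵘ q ≡ fromℚᵘ (p ℚᵘ.* q)
    fromℚᵘ-* p q = ℚP.toℚᵘ-injective (ℚᵘP.≃-trans (ℚP.toℚᵘ-homo-* (fromℚᵘ p) (fromℚᵘ q))
      (ℚᵘP.≃-trans (ℚᵘP.*-cong (ℚP.toℚᵘ-fromℚᵘ p) (ℚP.toℚᵘ-fromℚᵘ q)) (ℚᵘP.≃-sym (ℚP.toℚᵘ-fromℚᵘ (p ℚᵘ.* q)))))

  -- a / (1 + d)
  frac : ℕ → ℤ → ℚ
  frac d a = fromℚᵘ (mkℚᵘ a d)

  frac-+ : ∀ d a b → frac d a ℚ.+ frac d b ≡ frac d (a + b)
  frac-+ d a b = trans (fromℚᵘ-+ (mkℚᵘ a d) (mkℚᵘ b d))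
    (ℚP.fromℚᵘ-cong {mkℚᵘ a d ℚᵘ.+ mkℚᵘ b d} {mkℚᵘ (a + b) d} (*≡* (l a b (+ suc d))))
    where
    l : ∀ a b n → (a * n + b * n) * n ≡ (a + b) * (n * n)
    l = solve-∀

  frac-injective : ∀ d a b → frac d a ≡ frac d b → a ≡ b
  frac-injective d a b e with ℚP.fromℚᵘ-injective {mkℚᵘ a d} {mkℚᵘ b d} e
  ... | *≡* h = ℤP.*-cancelʳ-≡ a b (+ suc d) h

  private
    frac-*₁ : ∀ a b → frac 0 a ℚ.* frac 3 b ≡ frac 3 (a * b)
    frac-*₁ a b = trans (fromℚᵘ-* (mkℚᵘ a 0) (mkℚᵘ b 3))
      (ℚP.fromℚᵘ-cong {mkℚᵘ a 0 ℚᵘ.* mkℚᵘ b 3} {mkℚᵘ (a * b) 3} (*≡* refl))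

    frac-*₄ : ∀ a b → frac 3 a ℚ.* frac 3 b ≡ frac 15 (a * b)
    frac-*₄ a b = trans (fromℚᵘ-* (mkℚᵘ a 3) (mkℚᵘ b 3))
      (ℚP.fromℚᵘ-cong {mkℚᵘ a 3 ℚᵘ.* mkℚᵘ b 3} {mkℚᵘ (a * b) 15} (*≡* refl))

    frac-*₁₆ : ∀ a b → frac 0 a ℚ.* frac 15 b ≡ frac 15 (a * b)
    frac-*₁₆ a b = trans (fromℚᵘ-* (mkℚᵘ a 0) (mkℚᵘ b 15))
      (ℚP.fromℚᵘ-cong {mkℚᵘ a 0 ℚᵘ.* mkℚᵘ b 15} {mkℚᵘ (a * b) 15} (*≡* refl))

    frac-16 : ∀ a → frac 15 (+ 16 * a) ≡ frac 0 a
    frac-16 a = ℚP.fromℚᵘ-cong {mkℚᵘ (+ 16 * a) 15} {mkℚᵘ a 0} (*≡* (l a))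
      where
      l : ∀ a → + 16 * a * + 1 ≡ a * + 16
      l = solve-∀

  -- The index is the denominator minus one: 3 for the quarters in which the coordinates are
  -- written, 15 for their products, and 0 for `ι`.
  quotientᴷ : ℕ → OK → 𝕂
  quotientᴷ d (mkO a b) = mkK (frac d a) (frac d b)

  quotientᴷ-+ : ∀ d x y → quotientᴷ d x +ᴷ quotientᴷ d y ≡ quotientᴷ d (x +ᴼ y)
  quotientᴷ-+ d (mkO a b) (mkO a' b') = cong₂ mkK (frac-+ d a a') (frac-+ d b b')

  quotientᴷ-injective : ∀ d {x y} → quotientᴷ d x ≡ quotientᴷ d y → x ≡ y
  quotientᴷ-injective d {mkO a b} {mkO a' b'} e =
    OK-ext (frac-injective d a a' (cong 𝕂.kre e)) (frac-injective d b b' (cong 𝕂.kim e))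

  private
    ι-* : ∀ x y → ι x *ᴷ quotientᴷ 3 y ≡ quotientᴷ 3 (x *ᴼ y)
    ι-* (mkO a b) (mkO a' b') = cong₂ mkK
      (trans (cong₂ ℚ._+_ (frac-*₁ a a')
        (trans (cong (frac 0 (+ 2) ℚ.*_) (frac-*₁ b b')) (frac-*₁ (+ 2) (b * b'))))
        (frac-+ 3 (a * a') (+ 2 * (b * b'))))
      (trans (cong₂ ℚ._+_ (frac-*₁ a b') (frac-*₁ b a')) (frac-+ 3 (a * b') (b * a')))

    quarter-* : ∀ x y → quotientᴷ 3 x *ᴷ quotientᴷ 3 y ≡ quotientᴷ 15 (x *ᴼ y)
    quarter-* (mkO a b) (mkO a' b') = cong₂ mkK
      (trans (cong₂ ℚ._+_ (frac-*₄ a a')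
        (trans (cong (frac 0 (+ 2) ℚ.*_) (frac-*₄ b b')) (frac-*₁₆ (+ 2) (b * b'))))
        (frac-+ 15 (a * a') (+ 2 * (b * b'))))
      (trans (cong₂ ℚ._+_ (frac-*₄ a b') (frac-*₄ b a')) (frac-+ 15 (a * b') (b * a')))

    16ᴼ : OK
    16ᴼ = int (+ 16)

    quotient-16 : ∀ x → quotientᴷ 15 (16ᴼ *ᴼ x) ≡ ι x
    quotient-16 x = trans (cong (quotientᴷ 15) (int-* (+ 16) x)) (cong₂ mkK (frac-16 (re x)) (frac-16 (im x)))

  -- The isometry x ↦ c x c⁻¹ with c = −(1+√2) + (2+√2)e + f + g, in the coordinates 1, i, j, k, times 4.
  private
    module L {A : Set} (_+_ _*_ : A → A → A) (-_ : A → A) (w 2# 4# : A) where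
      linear : Quat A → Quat A
      linear ⟪ t , x , y , z ⟫ =
        ⟪ (4# * t) + ((2# * (w * (x + y))) + (2# * z)) , (2# * x) + ((w * y) + ((2# + w) * z)) ,
          (2# * x) + ((- (w * y)) + ((w + (- 2#)) * z)) , 2# * y ⟫
      squares : Quat A → A
      squares ⟪ a , b , c , d ⟫ = (((a * a) + (b * b)) + (c * c)) + (d * d)
      -- 16 times the inverse of linear
      inverse : Quat A → Quat A
      inverse ⟪ a , b , c , d ⟫ = ⟪ (4# * a) + (- ((w * (x₈ + (4# * d))) + z₈)) , 2# * x₈ ,
        2# * (4# * d) , 2# * z₈ ⟫
        where
        z₈ = (2# * (b + (- c))) + (- (2# * (w * d)))
        x₈ = (2# * (b + c)) + ((w * (c + (- b))) + (2# * d))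
      -- The element of the maximal order that the isometry carries to the combination of
      -- `g₁, …, g₄` with the given coefficients.
      diag : Quat A → Quat A
      diag ⟪ a , b , c , d ⟫ = ⟪ a + (- ((2# * b) + (((c * w) + c) + (w * d)))) ,
        2# * (((w * b) + (- b)) + (c + d)) , d , (2# * ((w * b) + c)) + d ⟫
      -- Solves `diag c = ⟪ t , 2x' , y , y + 2z' ⟫`: the last two coordinates give `z' = √2b + c`,
      -- and then the second gives `x' = z' − b + y`.
      undiag : A → A → A → A → Quat A
      undiag t x' y z' = ⟪ t + ((2# * b) + (((c * w) + c) + (w * y))) , b , c , y ⟫
        where
        b = (z' + (- x')) + y
        c = z' + (- (w * b))
      -- 4 times the coordinates of c₁g₁ + c₂g₂ + c₃g₃ + c₄g₄
      gram : Quat A → Quat A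
      gram ⟪ a , b , c , d ⟫ = ⟪ (4# * a) + ((2# * d) + (2# * (w * d))) ,
        (2# * (4# * (w * b))) + (((2# * (4# * c)) + (2# * (w * c))) + (((4# + 2#) * d) + (2# * (w * d))))
        , (2# * (w * c)) + (2# * d) , 2# * d ⟫

    4ᴼ : OK
    4ᴼ = int (+ 4)
    module LO = L _+ᴼ_ _*ᴼ_ -ᴼ_ √2ᴼ 2ᴼ 4ᴼ
    module LE {n : ℕ} = L {Expr OK n} _⊕_ _⊗_ ⊝_ (Κ √2ᴼ) (Κ 2ᴼ) (Κ 4ᴼ)

  embed : 𝒪 → ℍ
  embed x = quat (quotientᴷ 3 (q₁ (LO.linear x))) (quotientᴷ 3 (q₂ (LO.linear x)))
    (quotientᴷ 3 (q₃ (LO.linear x))) (quotientᴷ 3 (q₄ (LO.linear x)))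

  private
    opaque
      unfolding N
      squares-linear : ∀ x → LO.squares (LO.linear x) ≡ 16ᴼ *ᴼ N x
      squares-linear ⟪ t , x , y , z ⟫ =
        prove 4 (λ t x y z → LE.squares (LE.linear ⟪ t , x , y , z ⟫) ≐ Κ 16ᴼ ⊗ E.form ⟪ t , x , y , z ⟫)
        refl (t ∷ x ∷ y ∷ z ∷ [])

    inverse-linear : ∀ x → LO.inverse (LO.linear x) ≡ 16ᴼ • x
    inverse-linear ⟪ t , x , y , z ⟫ =
      proveQ 4 (λ t x y z → LE.inverse (LE.linear ⟪ t , x , y , z ⟫) ≐ E.scale (Κ 16ᴼ) ⟪ t , x , y , z ⟫)
      refl (t ∷ x ∷ y ∷ z ∷ [])

    linear-diag : ∀ c → LO.linear (LO.diag c) ≡ LO.gram c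
    linear-diag ⟪ a , b , c , d ⟫ =
      proveQ 4 (λ a b c d → LE.linear (LE.diag ⟪ a , b , c , d ⟫) ≐ LE.gram ⟪ a , b , c , d ⟫) refl
      (a ∷ b ∷ c ∷ d ∷ [])

    diag-undiag : ∀ t x' y z' → LO.diag (LO.undiag t x' y z') ≡ ⟪ t , 2ᴼ *ᴼ x' , y , y +ᴼ 2ᴼ *ᴼ z' ⟫
    diag-undiag t x' y z' = proveQ 4 (λ t x y z →
      LE.diag (LE.undiag t x y z) ≐ ⟪ t , Κ 2ᴼ ⊗ x , y , y ⊕ Κ 2ᴼ ⊗ z ⟫) refl (t ∷ x' ∷ y ∷ z' ∷ [])

  embed-injective : ∀ {x y} → embed x ≡ embed y → x ≡ y
  embed-injective {x} {y} e = quat≡ (c (cong q₁ scaled)) (c (cong q₂ scaled)) (c (cong q₃ scaled))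
    (c (cong q₄ scaled))
    where
    linear≡ : LO.linear x ≡ LO.linear y
    linear≡ = quat≡ (quotientᴷ-injective 3 (cong ℍ.t e)) (quotientᴷ-injective 3 (cong ℍ.x e))
      (quotientᴷ-injective 3 (cong ℍ.y e)) (quotientᴷ-injective 3 (cong ℍ.z e))
    scaled : 16ᴼ • x ≡ 16ᴼ • y
    scaled = trans (sym (inverse-linear x)) (trans (cong LO.inverse linear≡) (inverse-linear y))
    c : ∀ {a b} → 16ᴼ *ᴼ a ≡ 16ᴼ *ᴼ b → a ≡ b
    c {a} {b} = *ᴼ-cancelˡ 16ᴼ {a} {b} (λ ())

  nrd-embed : ∀ x → nrd (embed x) ≡ ι (N x)
  nrd-embed x = trans (sum (q₁ (LO.linear x)) (q₂ (LO.linear x)) (q₃ (LO.linear x)) (q₄ (LO.linear x)))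
    (trans (cong (quotientᴷ 15) (squares-linear x)) (quotient-16 (N x)))
    where
    sum : ∀ a b c d → nrd (quat (quotientᴷ 3 a) (quotientᴷ 3 b) (quotientᴷ 3 c) (quotientᴷ 3 d))
      ≡ quotientᴷ 15 (a *ᴼ a +ᴼ b *ᴼ b +ᴼ c *ᴼ c +ᴼ d *ᴼ d)
    sum a b c d = trans (cong₂ _+ᴷ_ (cong₂ _+ᴷ_ (cong₂ _+ᴷ_ (quarter-* a a) (quarter-* b b))
      (quarter-* c c)) (quarter-* d d))
      (trans (cong (λ z → z +ᴷ quotientᴷ 15 (c *ᴼ c) +ᴷ quotientᴷ 15 (d *ᴼ d))
        (quotientᴷ-+ 15 (a *ᴼ a) (b *ᴼ b)))
      (trans (cong (_+ᴷ quotientᴷ 15 (d *ᴼ d)) (quotientᴷ-+ 15 (a *ᴼ a +ᴼ b *ᴼ b) (c *ᴼ c)))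
        (quotientᴷ-+ 15 (a *ᴼ a +ᴼ b *ᴼ b +ᴼ c *ᴼ c) (d *ᴼ d))))

  combination : OK → OK → OK → OK → ℍ
  combination c₁ c₂ c₃ c₄ = ι c₁ ·ᴴ g₁ +ᴴ ι c₂ ·ᴴ g₂ +ᴴ ι c₃ ·ᴴ g₃ +ᴴ ι c₄ ·ᴴ g₄

  private
    quat-cong : ∀ {a b c d a' b' c' d' : 𝕂} → a ≡ a' → b ≡ b' → c ≡ c' → d ≡ d' →
      quat a b c d ≡ quat a' b' c' d'
    quat-cong refl refl refl refl = refl

    -- u, v, w, z are four times the corresponding coordinates of g₁, …, g₄.
    coordinate : ∀ c₁ c₂ c₃ c₄ u v w z →
      ι c₁ *ᴷ quotientᴷ 3 u +ᴷ ι c₂ *ᴷ quotientᴷ 3 v +ᴷ ι c₃ *ᴷ quotientᴷ 3 w +ᴷ ι c₄ *ᴷ quotientᴷ 3 z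
      ≡ quotientᴷ 3 (c₁ *ᴼ u +ᴼ c₂ *ᴼ v +ᴼ c₃ *ᴼ w +ᴼ c₄ *ᴼ z)
    coordinate c₁ c₂ c₃ c₄ u v w z =
      trans (cong₂ _+ᴷ_ (cong₂ _+ᴷ_ (cong₂ _+ᴷ_ (ι-* c₁ u) (ι-* c₂ v)) (ι-* c₃ w)) (ι-* c₄ z))
      (trans (cong (λ s → s +ᴷ quotientᴷ 3 (c₃ *ᴼ w) +ᴷ quotientᴷ 3 (c₄ *ᴼ z))
        (quotientᴷ-+ 3 (c₁ *ᴼ u) (c₂ *ᴼ v)))
      (trans (cong (_+ᴷ quotientᴷ 3 (c₄ *ᴼ z)) (quotientᴷ-+ 3 (c₁ *ᴼ u +ᴼ c₂ *ᴼ v) (c₃ *ᴼ w)))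
        (quotientᴷ-+ 3 (c₁ *ᴼ u +ᴼ c₂ *ᴼ v +ᴼ c₃ *ᴼ w) (c₄ *ᴼ z))))

    gram-eq : ∀ a b c d → LO.gram ⟪ a , b , c , d ⟫ ≡
      ⟪ a *ᴼ mkO (+ 4) (+ 0) +ᴼ b *ᴼ mkO (+ 0) (+ 0) +ᴼ c *ᴼ mkO (+ 0) (+ 0) +ᴼ d *ᴼ mkO (+ 2) (+ 2)
      , a *ᴼ mkO (+ 0) (+ 0) +ᴼ b *ᴼ mkO (+ 0) (+ 8) +ᴼ c *ᴼ mkO (+ 8) (+ 2) +ᴼ d *ᴼ mkO (+ 6) (+ 2)
      , a *ᴼ mkO (+ 0) (+ 0) +ᴼ b *ᴼ mkO (+ 0) (+ 0) +ᴼ c *ᴼ mkO (+ 0) (+ 2) +ᴼ d *ᴼ mkO (+ 2) (+ 0)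
      , a *ᴼ mkO (+ 0) (+ 0) +ᴼ b *ᴼ mkO (+ 0) (+ 0) +ᴼ c *ᴼ mkO (+ 0) (+ 0) +ᴼ d *ᴼ mkO (+ 2) (+ 0) ⟫
    gram-eq a b c d = proveQ 4 (λ a b c d → LE.gram ⟪ a , b , c , d ⟫ ≐
      ⟪ a ⊗ Κ (mkO (+ 4) (+ 0)) ⊕ b ⊗ Κ (mkO (+ 0) (+ 0)) ⊕ c ⊗ Κ (mkO (+ 0) (+ 0)) ⊕ d ⊗ Κ (mkO (+ 2) (+ 2))
      , a ⊗ Κ (mkO (+ 0) (+ 0)) ⊕ b ⊗ Κ (mkO (+ 0) (+ 8)) ⊕ c ⊗ Κ (mkO (+ 8) (+ 2)) ⊕ d ⊗ Κ (mkO (+ 6) (+ 2))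
      , a ⊗ Κ (mkO (+ 0) (+ 0)) ⊕ b ⊗ Κ (mkO (+ 0) (+ 0)) ⊕ c ⊗ Κ (mkO (+ 0) (+ 2)) ⊕ d ⊗ Κ (mkO (+ 2) (+ 0))
      , a ⊗ Κ (mkO (+ 0) (+ 0)) ⊕ b ⊗ Κ (mkO (+ 0) (+ 0)) ⊕ c ⊗ Κ (mkO (+ 0) (+ 0)) ⊕ d ⊗ Κ (mkO (+ 2)
        (+ 0)) ⟫) refl (a ∷ b ∷ c ∷ d ∷ [])

  combination-embed : ∀ a b c d → combination a b c d ≡ embed (LO.diag ⟪ a , b , c , d ⟫)
  combination-embed a b c d = trans (quat-cong
      (coordinate a b c d (mkO (+ 4) (+ 0)) (mkO (+ 0) (+ 0)) (mkO (+ 0) (+ 0)) (mkO (+ 2) (+ 2)))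
      (coordinate a b c d (mkO (+ 0) (+ 0)) (mkO (+ 0) (+ 8)) (mkO (+ 8) (+ 2)) (mkO (+ 6) (+ 2)))
      (coordinate a b c d (mkO (+ 0) (+ 0)) (mkO (+ 0) (+ 0)) (mkO (+ 0) (+ 2)) (mkO (+ 2) (+ 0)))
      (coordinate a b c d (mkO (+ 0) (+ 0)) (mkO (+ 0) (+ 0)) (mkO (+ 0) (+ 0)) (mkO (+ 2) (+ 0))))
    (cong (λ v → quat (quotientᴷ 3 (q₁ v)) (quotientᴷ 3 (q₂ v)) (quotientᴷ 3 (q₃ v)) (quotientᴷ 3 (q₄ v)))
      (trans (sym (gram-eq a b c d)) (sym (linear-diag ⟪ a , b , c , d ⟫))))

  private
    red-2* : ∀ v → red (2ᴼ *ᴼ v) ≡ (false , false)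
    red-2* v = red-* 2ᴼ v

    2-divides : ∀ v → red v ≡ (false , false) → 2ᴼ ∣ v
    2-divides (mkO a b) e = divides (mkO (proj₁ ha) (proj₁ hb))
      (trans (cong₂ mkO (proj₂ ha) (proj₂ hb)) (sym (int-* (+ 2) (mkO (proj₁ ha) (proj₁ hb)))))
      where
      ha = even-half a (cong proj₁ e)
      hb = even-half b (cong proj₂ e)

    diagonal-parts : ∀ r → diagonal r ≡ true → q₂ r ≡ (false , false) × (q₄ r ⊕ᵇ q₃ r) ≡ (false , false)
    diagonal-parts ⟪ a , (false , false) , (false , false) , (false , false) ⟫ _ = refl , refl
    diagonal-parts ⟪ a , (false , false) , (false , true) , (false , true) ⟫ _ = refl , refl
    diagonal-parts ⟪ a , (false , false) , (true , false) , (true , false) ⟫ _ = refl , refl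
    diagonal-parts ⟪ a , (false , false) , (true , true) , (true , true) ⟫ _ = refl , refl

    diagonal-of : ∀ a b c d → b ≡ (false , false) → d ≡ c → diagonal ⟪ a , b , c , d ⟫ ≡ true
    diagonal-of a b (false , false) d refl refl = refl
    diagonal-of a b (false , true) d refl refl = refl
    diagonal-of a b (true , false) d refl refl = refl
    diagonal-of a b (true , true) d refl refl = refl

  diag-Diagonal : ∀ c → Diagonal (LO.diag c)
  diag-Diagonal ⟪ a , b , c , d ⟫ =
    diagonal-of (red (q₁ x)) (red (q₂ x)) (red d) (red (q₄ x)) (red-2* (√2ᴼ *ᴼ b +ᴼ -ᴼ b +ᴼ (c +ᴼ d)))
    (trans (red-+ (2ᴼ *ᴼ (√2ᴼ *ᴼ b +ᴼ c)) d) (cong (_⊕ᵇ red d) (red-2* (√2ᴼ *ᴼ b +ᴼ c))))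
    where x = LO.diag ⟪ a , b , c , d ⟫

  Diagonal-diag : ∀ x → Diagonal x → ∃[ c ] x ≡ LO.diag c
  Diagonal-diag ⟪ t , x , y , z ⟫ h =
    go (2-divides x (proj₁ p)) (2-divides (z -ᴼ y)
    (trans (red-+ z (-ᴼ y)) (trans (cong (red z ⊕ᵇ_) (red-neg y)) (proj₂ p))))
    where
    p = diagonal-parts (redQ ⟪ t , x , y , z ⟫) h
    go : 2ᴼ ∣ x → 2ᴼ ∣ z -ᴼ y → ∃[ c ] ⟪ t , x , y , z ⟫ ≡ LO.diag c
    go (divides x' ex) (divides z' ez) =
      LO.undiag t x' y z' , trans (quat≡ refl ex refl (trans (l y z) (cong (y +ᴼ_) ez)))
      (sym (diag-undiag t x' y z'))
      where
      l : ∀ y z → z ≡ y +ᴼ (z -ᴼ y)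
      l y z = prove 2 (λ y z → z ≐ y ⊕ (z ⊕ (⊝ y))) refl (y ∷ z ∷ [])

  count-𝒢 : ∀ α r → Count (λ x → N x ≡ α × Diagonal x) r → r𝒢≡ α r
  count-𝒢 α r = count-map {P = λ x → N x ≡ α × Diagonal x} {Q = λ q → q ∈𝒢 × nrd q ≡ ι α} embed
    embed-injective forth back
    where
    forth : ∀ x → N x ≡ α × Diagonal x → embed x ∈𝒢 × nrd (embed x) ≡ ι α
    forth x (e , d) = member (Diagonal-diag x d) , trans (nrd-embed x) (cong ι e)
      where
      member : ∃[ c ] x ≡ LO.diag c → embed x ∈𝒢
      member (⟪ a , b , c , d ⟫ , x≡) = a , b , c , d , trans (cong embed x≡) (sym (combination-embed a b c d))
    back : ∀ q → q ∈𝒢 × nrd q ≡ ι α → ∃[ x ] ((N x ≡ α × Diagonal x) × q ≡ embed x)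
    back q ((a , b , c , d , q≡) , e) =
      x , (quotientᴷ-injective 0 (trans (sym (nrd-embed x)) (trans (cong nrd (sym q≡′)) e)) ,
      diag-Diagonal ⟪ a , b , c , d ⟫) , q≡′
      where
      x = LO.diag ⟪ a , b , c , d ⟫
      q≡′ : q ≡ embed x
      q≡′ = trans q≡ (combination-embed a b c d)

-- Powers of `η`, the odd part of `α`, and the final count.

open import Defs
open OKRing hiding (ring)
open Solver
open Quaternion hiding (module E; module F)
open ZArith
open OKArith hiding (divide)
open Ideals using (positive-cofactor)
open OddCount using (odd-count)
open Counting
open Mod2
open Hecke
open Weights
open Embed using (count-𝒢)
open import Data.Nat as ℕ using (ℕ; zero; suc; _*_; _+_; _^_; _∸_)
import Data.Nat.Properties as ℕP
open import Data.Nat.Tactic.RingSolver using () renaming (solve-∀ to ℕsolve)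
open import Data.Nat.ListAction using (sum)
open import Data.Integer as ℤ using (ℤ; +_; -[1+_]; 0ℤ)
import Data.Integer.Properties as ℤP
open import Data.Integer.Tactic.RingSolver using (solve-∀)
open import Data.Bool using (Bool; true; false; _∧_)
import Data.Bool.Properties as BoolP
open import Data.List using (List; []; _∷_; map; applyUpTo)
open import Data.List.Membership.Propositional using (_∈_)
open import Data.List.Relation.Unary.Any using (here; there)
open import Data.List.Relation.Unary.All as All using (All; []; _∷_)
open import Data.List.Relation.Unary.AllPairs as AllPairs using (AllPairs; []; _∷_)
open import Data.List.Relation.Unary.Unique.Propositional using (Unique)
open import Data.Product using (∃-syntax; _×_; _,_; proj₁; proj₂)
open import Data.Empty using (⊥-elim)
open import Relation.Binary.PropositionalEquality
open import Relation.Nullary using (¬_)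

η^ : ℕ → OK → OK
η^ zero m = m
η^ (suc e) m = η *ᴼ η^ e m

√2-1 1+√2 : OK
√2-1 = mkO -[1+ 0 ] (+ 1)
1+√2 = mkO (+ 1) (+ 1)

η^-scale : ∀ e m u → η^ e (m *ᴼ u) ≡ η^ e m *ᴼ u
η^-scale zero m u = refl
η^-scale (suc e) m u = trans (cong (η *ᴼ_) (η^-scale e m u)) (sym (*ᴼ-assoc η (η^ e m) u))

-- As `√2 = η(√2 − 1)` with `√2 − 1` a unit, the powers of `√2` can be traded for powers of `η`; the
-- units are absorbed in the odd part.
√2^-multiple : ∀ e c → ∃[ m ] (√2ᴼ ^ᴼ e) *ᴼ c ≡ η^ e m
√2^-multiple zero c = c , *ᴼ-idˡ c
√2^-multiple (suc e) c = m *ᴼ √2-1 , trans (*ᴼ-assoc √2ᴼ (√2ᴼ ^ᴼ e) c)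
  (trans (cong (√2ᴼ *ᴼ_) (proj₂ (√2^-multiple e c)))
    (trans (l (η^ e m)) (cong (η *ᴼ_) (sym (η^-scale e m √2-1)))))
  where
  m = proj₁ (√2^-multiple e c)
  l : ∀ x → √2ᴼ *ᴼ x ≡ η *ᴼ (x *ᴼ √2-1)
  l x = prove 1 (λ x → Κ √2ᴼ ⊗ x ≐ Κ η ⊗ (x ⊗ Κ √2-1)) refl (x ∷ [])

√2^-divides : ∀ e y → (√2ᴼ ^ᴼ suc e) ∣ η^ e (√2ᴼ *ᴼ y)
√2^-divides zero y = divides y (cong (_*ᴼ y) (sym (*ᴼ-idʳ √2ᴼ)))
√2^-divides (suc e) y = divides (1+√2 *ᴼ quotient d)
  (trans (cong (η *ᴼ_) (equality d)) (l (√2ᴼ ^ᴼ suc e) (quotient d)))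
  where
  d = √2^-divides e y
  l : ∀ p z → η *ᴼ (p *ᴼ z) ≡ √2ᴼ *ᴼ p *ᴼ (1+√2 *ᴼ z)
  l p z = prove 2 (λ p z → Κ η ⊗ (p ⊗ z) ≐ Κ √2ᴼ ⊗ p ⊗ (Κ 1+√2 ⊗ z)) refl (p ∷ z ∷ [])

N̂-η : ∀ x → N̂ (η *ᴼ x) ≡ + 2 ℤ.* N̂ x
N̂-η x = N̂-* η x

η-positive : ∀ x → 0ℤ ℤ.< re (η *ᴼ x) → 0ℤ ℤ.< N̂ (η *ᴼ x) → 0ℤ ℤ.< re x × 0ℤ ℤ.< N̂ x
η-positive x 0<re 0<N = positive-cofactor η x (ℤ.+<+ (ℕ.s≤s ℕ.z≤n)) (ℤ.+<+ (ℕ.s≤s ℕ.z≤n))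
  (ℤP.<⇒≤ 0<re) 0<Nx , 0<Nx
  where
  0<Nx : 0ℤ ℤ.< N̂ x
  0<Nx = ℤP.*-cancelˡ-<-nonNeg (+ 2) (subst (0ℤ ℤ.<_) (N̂-η x) 0<N)

η^-positive : ∀ e m → 0ℤ ℤ.< re (η^ e m) → 0ℤ ℤ.< N̂ (η^ e m) → 0ℤ ℤ.< re m × 0ℤ ℤ.< N̂ m
η^-positive zero m p q = p , q
η^-positive (suc e) m p q = let p′ , q′ = η-positive (η^ e m) p q in η^-positive e m p′ q′

η∣⇒√2∣ : ∀ {x} → η ∣ x → √2ᴼ ∣ x
η∣⇒√2∣ (divides c e) = divides (1+√2 *ᴼ c) (trans e (l c))
  where
  l : ∀ c → η *ᴼ c ≡ √2ᴼ *ᴼ (1+√2 *ᴼ c)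
  l c = prove 1 (λ c → Κ η ⊗ c ≐ Κ √2ᴼ ⊗ (Κ 1+√2 ⊗ c)) refl (c ∷ [])

-- The residue field at `η` has two elements, so `η` is prime: in `d c = η z` with `d` odd, `c` must
-- be divisible by `η`, and one factor cancels. Thus the summation over divisors of `α` is one over
-- divisors of its odd part.
odd-divisor : ∀ e d m → ¬ √2ᴼ ∣ d → d ∣ η^ e m → d ∣ m
odd-divisor zero d m odd h = h
odd-divisor (suc e) d m odd (divides c eq) = odd-divisor e d m odd (divides (quotient h) (*ᴼ-cancelˡ η η≢0
    (trans eq (trans (cong (d *ᴼ_) (equality h)) (l d (quotient h))))))
  where
  l : ∀ d c → d *ᴼ (η *ᴼ c) ≡ η *ᴼ (d *ᴼ c)
  l d c = prove 2 (λ d c → d ⊗ (Κ η ⊗ c) ≐ Κ η ⊗ (d ⊗ c)) refl (d ∷ c ∷ [])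
  d-odd : proj₁ (red d) ≡ true
  d-odd = BoolP.¬-not (λ p → odd (η∣⇒√2∣ (η-divides d p)))
  product : proj₁ (red d) ∧ proj₁ (red c) ≡ false
  product = trans (cong proj₁ (sym (red-* d c)))
    (trans (cong (λ z → proj₁ (red z)) (sym eq)) (cong proj₁ (red-η* (η^ e m))))
  h : η ∣ c
  h = η-divides c (trans (cong (_∧ proj₁ (red c)) (sym d-odd)) product)

pairwise : ∀ {A : Set} {R : A → A → Set} {xs} → AllPairs (λ x y → ¬ R x y) xs →
  (∀ {x y} → R x y → R y x) → ∀ x y → x ∈ xs → y ∈ xs → R x y → x ≡ y
pairwise (_ ∷ _) s x y (here refl) (here refl) r = refl
pairwise (h ∷ _) s x y (here refl) (there y∈) r = ⊥-elim (All.lookup h y∈ r)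
pairwise (h ∷ _) s x y (there x∈) (here refl) r = ⊥-elim (All.lookup h x∈ (s r))
pairwise (_ ∷ p) s x y (there x∈) (there y∈) r = pairwise p s x y x∈ y∈ r

-- A geometric sum in additive form: the extra `2 ^ c` doubles the first term and the carry runs
-- through the remaining ones.
powers-sum : ∀ n c f → (∀ i → f i ≡ i + c) → sum (map (λ k → 2 ^ k) (applyUpTo f n)) + 2 ^ c ≡ 2 ^ (n + c)
powers-sum zero c f h = refl
powers-sum (suc n) c f h = trans (cong (λ z → 2 ^ z + s + 2 ^ c) (h 0))
  (trans (l (2 ^ c) s) (trans (powers-sum n (suc c) (λ i → f (suc i)) (λ i →
  trans (h (suc i)) (sym (ℕP.+-suc i c)))) (cong (2 ^_) (ℕP.+-suc n c))))
  where
  s = sum (map (λ k → 2 ^ k) (applyUpTo (λ i → f (suc i)) n))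
  l : ∀ p s → p + s + p ≡ s + 2 * p
  l = ℕsolve

-- With `e = 4 + k` the last case is `2(2^(e+1) − 8) + 3·2^e − 8 = 7·2^e − 24`, and `7·2⁴ = 112`.
-- The bound `8≤X` makes the truncated subtraction exact.
factor-closed : ∀ k → factor (4 + k) + 24 ≡ 112 * 2 ^ k
factor-closed k = trans (sym (ℕP.+-assoc (X ∸ 8) 8 16))
  (trans (cong (_+ 16) (ℕP.m∸n+n≡m 8≤X))
  (trans (l₁ S (2 ^ k)) (trans (cong (λ z → 2 * z + 48 * 2 ^ k) S+8) (l₂ (2 ^ k)))))
  where
  S = pow2Sum3 (4 + k)
  X = 2 * S + 3 * 2 ^ (4 + k)
  S+8 : S + 8 ≡ 32 * 2 ^ k
  S+8 = trans (powers-sum (suc (suc k)) 3 (λ x → suc (suc (suc x))) (λ i → sym (ℕP.+-comm i 3)))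
    (trans (cong (2 ^_) (ℕP.+-comm (suc (suc k)) 3)) (l (2 ^ k)))
    where
    l : ∀ p → 2 * (2 * (2 * (2 * (2 * p)))) ≡ 32 * p
    l = ℕsolve
  l₁ : ∀ S p → 2 * S + 3 * (2 * (2 * (2 * (2 * p)))) + 16 ≡ 2 * (S + 8) + 48 * p
  l₁ = ℕsolve
  l₂ : ∀ p → 2 * (32 * p) + 48 * p ≡ 112 * p
  l₂ = ℕsolve
  8≤X : 8 ℕ.≤ X
  8≤X = ℕP.≤-trans (ℕP.≤-trans (ℕP.m≤n+m 8 40)
    (ℕP.≤-trans (ℕP.*-monoʳ-≤ 48 (ℕP.m^n>0 2 k)) (ℕP.≤-reflexive (l (2 ^ k)))))
    (ℕP.m≤n+m (3 * 2 ^ (4 + k)) (2 * S))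
    where
    l : ∀ p → 48 * p ≡ 3 * (2 * (2 * (2 * (2 * p))))
    l = ℕsolve

-- The number of elements of norm ηᵏm in 𝒪 is growth u k = (2ᵏ⁺¹ − 1)u, with u that of norm m.
growth : ℕ → ℕ → ℕ
growth u zero = u
growth u (suc k) = 2 * growth u k + u

growth-closed : ∀ u k → growth u k + u ≡ 2 * (u * 2 ^ k)
growth-closed u zero = l u
  where
  l : ∀ u → u + u ≡ 2 * (u * 1)
  l = ℕsolve
growth-closed u (suc k) = trans (l (growth u k) u) (trans (cong (2 *_) (growth-closed u k)) (l′ u (2 ^ k)))
  where
  l : ∀ g u → 2 * g + u + u ≡ 2 * (g + u)
  l = ℕsolve
  l′ : ∀ u p → 2 * (2 * (u * p)) ≡ 2 * (u * (2 * p))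
  l′ = ℕsolve

module Main (m : OK) (odd : ¬ η ∣ m) (σ : ℕ) (C₀ : Count (λ x → N x ≡ m) (48 * σ)) where
  u : ℕ
  u = 48 * σ

  η-norm : ∀ y k → N (η • y) ≡ η^ (suc (suc k)) m → N y ≡ η^ k m
  η-norm y k e = *ᴼ-cancelˡ η η≢0 (*ᴼ-cancelˡ η η≢0 (trans (sym (trans (N-• η y) (*ᴼ-assoc η η (N y)))) e))

  no-η-multiple : ∀ y → ¬ N (η • y) ≡ η *ᴼ m
  no-η-multiple y e = odd (divides (N y)
    (sym (*ᴼ-cancelˡ η η≢0 (trans (sym (*ᴼ-assoc η η (N y))) (trans (sym (N-• η y)) e)))))

  none : Count (λ x → N x ≡ η *ᴼ m × η∣ x) 0
  none = count-⊥ (λ x (e , d) → no-η-multiple (proj₁ (zero₁-η x d))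
    (trans (cong N (sym (proj₂ (zero₁-η x d)))) e))

  sized : ∀ {P : 𝒪 → Set} {a b} → a ≡ b → Count P a → Count P b
  sized {P} = subst (Count P)

  mutual
    count-norm : ∀ k → Count (λ x → N x ≡ η^ k m) (growth u k)
    count-norm zero = C₀
    count-norm (suc k) = next k (norm-enumeration (η^ k m) (growth u k) (count-norm k))

    -- Enumeration supplies a finite but unknown number `c`, and the Hecke relation determines it.
    -- The multiples of `η` that enter are none for the first step, `m` being odd, and afterwards
    -- the elements of norm smaller by `η²`.
    next : ∀ k → ∃[ c ] Count (λ x → N x ≡ η^ (suc k) m) c → Count (λ x → N x ≡ η^ (suc k) m) (growth u (suc k))
    next zero (c , C) = sized (trans (sym (ℕP.+-identityʳ c)) (trans (hecke m C₀ none C) (l u))) C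
      where
      l : ∀ u → 3 * u ≡ 2 * u + u
      l = ℕsolve
    next (suc k) (c , C) = sized (ℕP.+-cancelʳ-≡ (2 * growth u k) c (growth u (suc (suc k)))
      (trans (hecke (η^ (suc k) m) (count-norm (suc k)) (count-η (η^ k m) (count-norm k)) C)
      (l (growth u k) u))) C
      where
      l : ∀ g u → 3 * (2 * g + u) ≡ 2 * (2 * g + u) + u + 2 * g
      l = ℕsolve

  η-divisible : ∀ k → η ∣ η^ (suc k) m
  η-divisible k = divides (η^ k m) refl

  -- The cases follow the weights of the 72 twists: 3 for `e = 0`; 4 and 12 for `e = 1, 2`, where a
  -- quotient by `η` does not exist or has odd norm; then 4, 16 and 72, the last possible only from
  -- `e = 4` on.
  count-diagonal : ∀ e {r} → Count (λ x → N x ≡ η^ e m × Diagonal x) r → r ≡ 2 * σ * factor e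
  count-diagonal 0 {r} D = ℕP.*-cancelˡ-≡ r (2 * σ * factor 0) 72
    (trans (Average.average-odd (count-norm 0) D odd) (l σ))
    where
    l : ∀ σ → 3 * (48 * σ) ≡ 72 * (2 * σ * 1)
    l = ℕsolve
  count-diagonal 1 {r} D = ℕP.*-cancelˡ-≡ r (2 * σ * factor 1) 72
    (trans (Average.average-low (count-norm 1) D (η-divisible 0) (λ y e →
    ⊥-elim (no-η-multiple y e)) none) (l σ))
    where
    l : ∀ σ → 4 * (2 * (48 * σ) + 48 * σ) + 8 * 0 ≡ 72 * (2 * σ * 4)
    l = ℕsolve
  count-diagonal 2 {r} D = ℕP.*-cancelˡ-≡ r (2 * σ * factor 2) 72
    (trans (Average.average-low (count-norm 2) D (η-divisible 1)
      (λ y e d → odd (subst (η ∣_) (η-norm y 0 e) d)) (count-η m C₀)) (l σ))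
    where
    l : ∀ σ → 4 * (2 * (2 * (48 * σ) + 48 * σ) + 48 * σ) + 8 * (48 * σ) ≡ 72 * (2 * σ * 12)
    l = ℕsolve
  count-diagonal 3 {r} D = ℕP.*-cancelˡ-≡ r (2 * σ * factor 3) 72
    (trans (Average.average-high (count-norm 3) D (η-divisible 2)
      (λ y e → subst (η ∣_) (sym (η-norm y 1 e)) (η-divisible 0)) (count-η (η^ 1 m) (count-norm 1))
        (count-η² (η^ 1 m) none)) (l σ))
    where
    l : ∀ σ → 4 * (2 * (2 * (2 * (48 * σ) + 48 * σ) + 48 * σ) + 48 * σ)
      + (12 * (2 * (48 * σ) + 48 * σ) + 56 * 0) ≡ 72 * (2 * σ * 32)
    l = ℕsolve
  count-diagonal (suc (suc (suc (suc k)))) {r} D =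
    -- Both closed forms contain a negative constant. Adding `48σ` to both sides matches
    -- `growth-closed` on the left and `factor-closed` on the right, where `168·96 = 144·112`.
    ℕP.+-cancelʳ-≡ (48 * σ) r (2 * σ * factor (4 + k))
      (ℕP.*-cancelˡ-≡ (r + 48 * σ) (2 * σ * factor (4 + k) + 48 * σ) 72 equation)
    where
    average = Average.average-high (count-norm (4 + k)) D (η-divisible (3 + k))
      (λ y e → subst (η ∣_) (sym (η-norm y (2 + k) e)) (η-divisible (1 + k)))
        (count-η (η^ (2 + k) m) (count-norm (2 + k)))
      (count-η² (η^ (2 + k) m) (count-η (η^ k m) (count-norm k)))
    l₁ : ∀ r σ → 72 * (r + 48 * σ) ≡ 72 * r + 72 * (48 * σ)
    l₁ = ℕsolve
    l₂ : ∀ g σ → 4 * (2 * (2 * (2 * (2 * g + 48 * σ) + 48 * σ) + 48 * σ) + 48 * σ)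
      + (12 * (2 * (2 * g + 48 * σ) + 48 * σ) + 56 * g) + 72 * (48 * σ) ≡ 168 * (g + 48 * σ)
    l₂ = ℕsolve
    l₃ : ∀ σ p → 168 * (2 * (48 * σ * p)) ≡ 144 * (σ * (112 * p))
    l₃ = ℕsolve
    l₄ : ∀ σ f → 72 * (2 * σ * f + 48 * σ) ≡ 144 * (σ * (f + 24))
    l₄ = ℕsolve
    equation : 72 * (r + 48 * σ) ≡ 72 * (2 * σ * factor (4 + k) + 48 * σ)
    equation = trans (l₁ r σ) (trans (cong (_+ 72 * (48 * σ)) average)
      (trans (l₂ (growth u k) σ) (trans (cong (λ z → 168 * z) (growth-closed u k))
      (trans (l₃ σ (2 ^ k)) (sym (trans (l₄ σ (factor (4 + k)))
        (cong (λ z → 144 * (σ * z)) (factor-closed k))))))))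

  representation-number : ∀ e → r𝒢≡ (η^ e m) (2 * σ * factor e)
  representation-number e = count-𝒢 (η^ e m) (2 * σ * factor e)
    (from (count-filter {n = growth u e} Diagonal? (count-norm e)))
    where
    from : ∃[ r ] Count (λ x → N x ≡ η^ e m × Diagonal x) r →
      Count (λ x → N x ≡ η^ e m × Diagonal x) (2 * σ * factor e)
    from (r , D) = sized (count-diagonal e D) D

theorem3p35 : (α : OK) (e : ℕ) → TotallyPositive α →
    ((√2ᴼ ^ᴼ e) ∣ᴼ α) × ¬ ((√2ᴼ ^ᴼ suc e) ∣ᴼ α) →
    (ds : List OK) → DivisorIdealList α ds →
    r𝒢≡ α (2 * sum (map Nm ds) * factor e)
theorem3p35 α e (0<α , α²) ((c , α≡) , not-more) ds (divisors , complete , nonassociate) =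
  subst (λ α → r𝒢≡ α (2 * sum (map Nm ds) * factor e)) (sym α≡η^m)
    (Main.representation-number m m-odd (sum (map Nm ds))
    (odd-count m (proj₁ m-positive) (proj₂ m-positive) √2∤m ds unique ds∣m complete′ same) e)
  where
  m = proj₁ (√2^-multiple e c)
  α≡η^m : α ≡ η^ e m
  α≡η^m = trans α≡ (proj₂ (√2^-multiple e c))
  √2∤m : ¬ √2ᴼ ∣ m
  √2∤m (divides y e′) = not-more
    (∣⇒∣ᴼ (subst ((√2ᴼ ^ᴼ suc e) ∣_) (sym (trans α≡η^m (cong (η^ e) e′))) (√2^-divides e y)))
  m-odd : ¬ η ∣ m
  m-odd d = √2∤m (η∣⇒√2∣ d)
  0<N̂α : 0ℤ ℤ.< N̂ α
  0<N̂α = gap< α²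
  m-positive : 0ℤ ℤ.< re m × 0ℤ ℤ.< N̂ m
  m-positive = η^-positive e m (subst (λ z → 0ℤ ℤ.< re z) α≡η^m 0<α) (subst (λ z → 0ℤ ℤ.< N̂ z) α≡η^m 0<N̂α)
  m∣α : m ∣ α
  m∣α = subst (m ∣_) (sym α≡η^m) (multiple e)
    where
    multiple : ∀ e → m ∣ η^ e m
    multiple zero = ∣-refl
    multiple (suc e) = ∣-*ˡ η (multiple e)
  unique : Unique ds
  unique = AllPairs.map (λ { {d} h refl → h (∣⇒∣ᴼ (∣-refl {d}) , ∣⇒∣ᴼ (∣-refl {d})) }) nonassociate
  -- Divisors of `α` prime to `√2` are divisors of the odd part `m`, so the given list represents
  -- every divisor of `m` once, as the odd count requires.
  ds∣m : ∀ d → d ∈ ds → d ∣ m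
  ds∣m d d∈ = let d∣α , odd = All.lookup divisors d∈ in odd-divisor e d m (λ h →
    odd (∣⇒∣ᴼ h)) (subst (d ∣_) α≡η^m (∣ᴼ⇒∣ d∣α))
  complete′ : ∀ δ → δ ∣ m → ∃[ d ] (d ∈ ds × (d ∣ δ) × (δ ∣ d))
  complete′ δ δ∣m =
    let d , d∈ , (h , h′) = complete δ (∣⇒∣ᴼ (∣-trans δ∣m m∣α)) (λ h → √2∤m (∣-trans (∣ᴼ⇒∣ h) δ∣m))
    in d , d∈ , ∣ᴼ⇒∣ h , ∣ᴼ⇒∣ h′
  same : ∀ d d' → d ∈ ds → d' ∈ ds → d ∣ d' → d' ∣ d → d ≡ d'
  same d d' d∈ d'∈ h h′ = pairwise {R = _~ᴼ_} nonassociate (λ (p , q) → q , p) d d' d∈ d'∈ (∣⇒∣ᴼ h , ∣⇒∣ᴼ h′)
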